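{- Let $k\ge 2$ and $1\le n_1\le\cdots\le n_k$ be integers, let $R\subseteq[n_1]$ be a non-empty set of integers, and let $\mathscr{F}\subseteq\mathcal{K}_R(n_1,\ldots,n_k)$ be an intersecting family. Then \[ |\mathscr{F}|\le\sum_{r\in R}\frac{(n_1-1)_{r-1}\cdots(n_k-1)_{r-1}}{(r-1)!}. \] Furthermore, equality is attained if and only if $\mathscr{F}$ is a star of $\mathcal{K}_R(n_1,\ldots,n_k)$.
   Context: For a positive integer $n$, $[n]=\{1,\ldots,n\}$. For non-negative integers $b\le a$, $(a)_b=\frac{a!}{(a-b)!}$. $\mathcal{K}(n_1,\ldots,n_k)$ denotes the complete $k$-partite $k$-graph with parts $[n_1],\ldots,[n_k]$ (regarded as disjoint); its edges are identified with the $k$-tuples $(x_1,\ldots,x_k)\in[n_1]\times\cdots\times[n_k]$. An $r$-matching is a set of $r$ pairwise vertex-disjoint edges, i.e. a set of $r$ such $k$-tuples any two of which differ in every coordinate. $\mathcal{K}_r(n_1,\ldots,n_k)$ is the set of all $r$-matchings of $\mathcal{K}(n_1,\ldots,n_k)$, and $\mathcal{K}_R(n_1,\ldots,n_k)=\bigcup_{r\in R}\mathcal{K}_r(n_1,\ldots,n_k)$. A family $\mathscr{F}\subseteq\mathcal{K}_R(n_1,\ldots,n_k)$ is intersecting if every pair of members of $\mathscr{F}$ share a common edge. A star of $\mathcal{K}_R(n_1,\ldots,n_k)$ is a family of the form $\{M\in\mathcal{K}_R(n_1,\ldots,n_k): e\in M\}$ for some edge $e$ of $\mathcal{K}(n_1,\ldots,n_k)$.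 -}

module Defs where

open import Data.Fin.Base using (Fin)
open import Data.List.Base as List using (List; length)
open import Data.List.Membership.Propositional using (_∈_)
import Data.List.Membership.Setoid as SetoidMembership
open import Data.List.Relation.Binary.BagAndSetEquality using ([_]-Equality; set)
open import Data.List.Relation.Unary.AllPairs using (AllPairs)
import Data.List.Relation.Unary.Unique.Setoid as SetoidUnique
open import Data.Nat.Base using (ℕ; _∸_; _*_; _!; _/_)
open import Data.Nat.Combinatorics using (_P_)
open import Data.Nat.ListAction using (sum)
open import Data.Nat.Properties using (_!≢0)
open import Data.Product.Base using (_×_; ∃-syntax)
open import Data.Vec.Base as Vec using (Vec)
open import Data.Vec.Relation.Unary.All using (All)
open import Data.Vec.Relation.Unary.All.Properties using (lookup⁺)
open import Function.Bundles using (_⇔_)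
open import Relation.Binary.Bundles using (Setoid)
open import Relation.Binary.PropositionalEquality.Core using (_≢_)
open import Level using (0ℓ)

-- The part [nᵢ] is modelled by Fin nᵢ, so that for ns = n₁ ∷ … ∷ nₖ ∷ []
-- an edge is a tuple in Fin n₁ × … × Fin nₖ.

Edge : ∀ {k} → Vec ℕ k → Set
Edge ns = All Fin ns

Disjoint : ∀ {k} {ns : Vec ℕ k} → Edge ns → Edge ns → Set
Disjoint e f = ∀ i → lookup⁺ e i ≢ lookup⁺ f i

-- A matching is a list of edges.  For k ≥ 1 pairwise disjointness of the
-- entries also excludes repetitions, so length is the number of edges.

IsMatching : ∀ {k} {ns : Vec ℕ k} → List (Edge ns) → Set
IsMatching = AllPairs Disjoint

-- 𝒦 R ns M states M ∈ 𝒦_R(n₁,…,nₖ).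

𝒦 : List ℕ → ∀ {k} (ns : Vec ℕ k) → List (Edge ns) → Set
𝒦 R ns M = IsMatching M × length M ∈ R

-- Lists of edges are compared as sets: xs ≈ ys when they have the same
-- members.

EdgeSets : ∀ {k} → Vec ℕ k → Setoid 0ℓ 0ℓ
EdgeSets ns = [ set ]-Equality (Edge ns)

-- A family of matchings is a list F of edge lists; under Distinct F no two
-- entries are the same set of edges, so length F is the size of the family.

module _ {k} {ns : Vec ℕ k} where

  open SetoidMembership (EdgeSets ns) public using () renaming (_∈_ to _∈ᶠ_)
  open SetoidUnique (EdgeSets ns) public using () renaming (Unique to Distinct)

  Intersecting : List (List (Edge ns)) → Set
  Intersecting F = ∀ {M N} → M ∈ F → N ∈ F → ∃[ e ] (e ∈ M × e ∈ N)

  -- F = {M ∈ 𝒦_R : e ∈ M} for some edge e, for F already contained in 𝒦_R.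
  -- M ranges over 𝒦 R ns only, since a list with repeated edges can be
  -- equal as a set to a matching without being one.

  IsStar : List ℕ → List (List (Edge ns)) → Set
  IsStar R F = ∃[ e ] (∀ M → 𝒦 R ns M → (M ∈ᶠ F ⇔ e ∈ M))

-- (n₁-1)_{r-1} ⋯ (nₖ-1)_{r-1} / (r-1)!.  For k ≥ 1 the division is exact,
-- because (r-1)! divides each factor (nᵢ-1)_{r-1}.

starTerm : ∀ {k} → Vec ℕ k → ℕ → ℕ
starTerm ns r =
  Vec.foldr′ _*_ 1 (Vec.map (λ n → (n ∸ 1) P (r ∸ 1)) ns) / (r ∸ 1) !
  where instance _ = (r ∸ 1) !≢0

bound : ∀ {k} → List ℕ → Vec ℕ k → ℕ
bound R ns = sum (List.map (starTerm ns) R)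

{-
Averaging over the group G of all tuples of permutations of the parts, an intersecting family of r-matchings is compared
with systems of r-matchings that cover every edge equally often.  For r < n₁ these are the arcs of length r of a cyclic
order of all N = n₁ ⋯ nₖ edges in which any n₁ - 1 consecutive edges are disjoint, and Katona's cycle argument shows that
at most r of the N arcs belong to the family; for r = n₁ they are the N / n₁ shifted diagonals, of which at most one does.

In case of equality, let S be the set of perfect matchings (those of size n₁, viewed as tuples γ of permutations) that
contain a member of the family.  S is intersecting, and every partition of the edges into perfect matchings given by Latin
squares in the coordinates has a part in S.  If γ, u ∈ S do not agree at the columns a and b, a Latin square with the row
(a b) in which all other rows with a fixed point avoid γ⁻¹u shows that switching γ at a and b in one coordinate stays in S.
Hence if some switch leads from γ ∈ S out of S, then every member of S agrees with γ at a or at b, and in fact all agree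
at the same one of them: S is a star, and its centre lies in all members of the family.

For a set R of sizes the bounds add up.  In case of equality the centre e of the smallest level lies in every larger member
M: otherwise some matching through e in the (full) smallest level would be disjoint from M.
-}
module Submission where

open import Defs
open import Data.Empty using (⊥; ⊥-elim)
open import Data.Fin.Base using (Fin; zero; suc; toℕ; inject≤; punchOut)
open import Data.Fin.Patterns using (0F; 1F; 2F)
open import Data.Fin.Permutation as Perm using (Permutation′; _⟨$⟩ʳ_; permutation)
open import Data.Fin.Permutation.Components using (transpose; transpose-inverse)
open import Data.Fin.Permutation.Transposition.List using (eval; decompose; eval-decompose)
open import Data.Fin.Properties using (_≟_; any?; all?; suc-injective; injective⇒≤; punchOut-injective; toℕ<n; toℕ-injective; toℕ-fromℕ<; toℕ-inject≤; inject≤-injective)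
open import Data.List.Base as List using (List; []; _∷_; _++_; map; length; filter; cartesianProductWith; allFin; applyUpTo; upTo; take)
open import Data.List.Membership.Propositional using (_∈_; _∉_; find; lose)
open import Data.List.Membership.Propositional.Properties using (∈-∃++; ∈-cartesianProductWith⁺; ∈-cartesianProductWith⁻; ∈-filter⁺; ∈-filter⁻; ∈-allFin; ∈-map⁻; ∈-map⁺; ∈-lookup; ∈-applyUpTo⁻)
open import Data.List.Properties using (map-∘; map-++; length-map; length-tabulate; length-applyUpTo; length-take)
open import Data.List.Relation.Binary.BagAndSetEquality using (_∼[_]_; set)
open import Data.List.Relation.Binary.Permutation.Propositional using (_↭_; ↭-refl; ↭-sym; ↭-trans; prep; swap; ↭⇒↭ₛ)
open import Data.List.Relation.Binary.Permutation.Propositional.Properties using (map⁺; shift; ∈-resp-↭; All-resp-↭; ↭-length)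
import Data.List.Relation.Binary.Permutation.Setoid.Properties as Setoid↭
open import Data.List.Relation.Binary.Subset.Propositional using (_⊆_)
open import Data.List.Relation.Unary.All as All using (All; []; _∷_)
import Data.List.Relation.Unary.All.Properties as All
open import Data.List.Relation.Unary.AllPairs as AllPairs using ([]; _∷_)
import Data.List.Relation.Unary.AllPairs.Properties as AllPairs
open import Data.List.Relation.Unary.Any as Any using (Any; here; there)
open import Data.List.Relation.Unary.Linked using ([]; [-]; _∷_) renaming (Linked to Linkedˡ)
open import Data.List.Relation.Unary.Unique.Propositional using (Unique)
open import Data.List.Relation.Unary.Unique.Propositional.Properties as Unique using (cartesianProductWith⁺; filter⁺; allFin⁺; Unique[x∷xs]⇒x∉xs)
open import Data.Nat.Base as ℕ
import Data.Nat.Combinatorics as Comb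
open import Data.Nat.Combinatorics.Specification using (nPk≡n!/[n∸k]!; nP′k≡n!/[n∸k]!; k!∣nP′k)
open import Data.Nat.Divisibility using (_∣_; ∣-refl; ∣-trans; m∣m*n; n∣m*n; m≤n⇒m!∣n!)
open import Data.Nat.DivMod using (_mod_; m%n<n; m<n⇒m%n≡m; m%n%n≡m%n; %-distribˡ-+; n%n≡0; [m+n]%n≡m%n; [m+kn]%n≡m%n; m*n%n≡0; m≡m%n+[m/n]*n; +-distrib-/-∣ˡ; +-distrib-/-∣ʳ; /-monoˡ-≤; n/n≡1; m<n⇒m/n≡0; m*n/n≡m; m/n*n≡m)
open import Data.Nat.ListAction using (sum)
open import Data.Nat.ListAction.Properties using (sum-++; sum-↭)
open import Data.Nat.Properties as ℕ hiding (_≟_; suc-injective)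
open import Data.Product.Base using (_×_; _,_; Σ-syntax; ∃; ∃-syntax; ∃₂; proj₁; proj₂)
open import Data.Sum.Base using (_⊎_; inj₁; inj₂)
open import Data.Vec.Base as Vec using (Vec; []; _∷_; head; lookup; tabulate)
open import Data.Vec.Properties as Vec using (≡-dec; lookup∘tabulate; tabulate∘lookup; tabulate-cong)
open import Data.Vec.Relation.Unary.All as VAll using ([]; _∷_) renaming (All to VAll)
open import Data.Vec.Relation.Unary.All.Properties using (lookup⁺; lookup⁻)
open import Data.Vec.Relation.Unary.Linked using (Linked; _∷_)
open import Data.Vec.Relation.Unary.Linked.Properties using (Linked⇒All)
open import Function.Base using (_∘_; id; case_of_)
open import Function.Bundles using (Equivalence; mk⇔; _⇔_)
open import Relation.Binary.Definitions using (DecidableEquality)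
open import Relation.Binary.PropositionalEquality
open import Relation.Nullary using (¬_; Dec; yes; no; contradiction; ¬?)
open import Relation.Nullary.Decidable using (map′; _×-dec_; _→-dec_; decidable-stable)
open import Relation.Unary using (Decidable)

-- Katona's argument by itself yields only cyclic shifts: in case of equality every tuple has a
-- shift in S, because a maximum family of arcs has a member inside one block of n₁ consecutive
-- edges, that is, on a shifted diagonal. Shifts say nothing about single transpositions. Other
-- Latin squares become available by double counting: the number of pairs (γ, row) with the
-- translate of γ in S is |S| times the number of rows, whatever the squares are, while disjointness
-- of the rows allows each γ at most one of them. The cyclic squares attain this maximum everywhere,
-- hence so do all others.
--
-- A square containing the row (a b) should have few other rows with fixed points. Bordering a
-- cyclic square by the two points a and b leaves just one: the shift by one of the remaining
-- points. These can be arranged on the cycle so that this shift avoids γ⁻¹u, except when there are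
-- five points and γ⁻¹u exchanges two of them; a second application of the square to a modified u
-- settles this case.

private variable
  A B C : Set
  k m n : ℕ
  ns : Vec ℕ k

-- Finite sums

𝟙 : {P : Set} → Dec P → ℕ
𝟙 (yes _) = 1
𝟙 (no _)  = 0

𝟙-yes : {P : Set} (d : Dec P) → P → 𝟙 d ≡ 1
𝟙-yes (yes _) _ = refl
𝟙-yes (no ¬p) p = contradiction p ¬p

𝟙-no : {P : Set} (d : Dec P) → ¬ P → 𝟙 d ≡ 0
𝟙-no (yes p) ¬p = contradiction p ¬p
𝟙-no (no _)  _  = refl

𝟙≤1 : {P : Set} (d : Dec P) → 𝟙 d ≤ 1
𝟙≤1 (yes _) = ≤-refl
𝟙≤1 (no _)  = z≤n

𝟙⇒ : {P : Set} (d : Dec P) → 𝟙 d ≢ 0 → P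
𝟙⇒ (yes p) _  = p
𝟙⇒ (no _)  ≢0 = contradiction refl ≢0

𝟙-cong : {P Q : Set} (d : Dec P) (e : Dec Q) → (P → Q) → (Q → P) → 𝟙 d ≡ 𝟙 e
𝟙-cong (yes p) e f g = sym (𝟙-yes e (f p))
𝟙-cong (no ¬p) e f g = sym (𝟙-no e (¬p ∘ g))

∑ : List A → (A → ℕ) → ℕ
∑ xs f = sum (map f xs)

∑-cong : ∀ (xs : List A) {f g} → (∀ {x} → x ∈ xs → f x ≡ g x) → ∑ xs f ≡ ∑ xs g
∑-cong []       eq = refl
∑-cong (x ∷ xs) eq = cong₂ _+_ (eq (here refl)) (∑-cong xs (eq ∘ there))

∑-mono : ∀ (xs : List A) {f g} → (∀ {x} → x ∈ xs → f x ≤ g x) → ∑ xs f ≤ ∑ xs g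
∑-mono []       le = z≤n
∑-mono (x ∷ xs) le = +-mono-≤ (le (here refl)) (∑-mono xs (le ∘ there))

∑-mono-tight : ∀ (xs : List A) {f g} → (∀ {x} → x ∈ xs → f x ≤ g x) →
               ∑ xs f ≡ ∑ xs g → ∀ {x} → x ∈ xs → f x ≡ g x
∑-mono-tight (y ∷ xs) {f} {g} le eq = λ
  { (here refl) → head≡
  ; (there x∈)  → ∑-mono-tight xs (le ∘ there)
                    (+-cancelˡ-≡ (f y) _ _ (trans eq (cong (_+ ∑ xs g) (sym head≡)))) x∈ }
  where
  head≡ : f y ≡ g y
  head≡ = ≤-antisym (le (here refl)) (+-cancelʳ-≤ (∑ xs g) (g y) (f y)
    (≤-trans (≤-reflexive (sym eq)) (+-monoʳ-≤ (f y) (∑-mono xs (le ∘ there)))))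

∑-const : ∀ (xs : List A) c → ∑ xs (λ _ → c) ≡ length xs * c
∑-const []       c = refl
∑-const (x ∷ xs) c = cong (c +_) (∑-const xs c)

∑-zero : ∀ (xs : List A) {f} → (∀ {x} → x ∈ xs → f x ≡ 0) → ∑ xs f ≡ 0
∑-zero xs eq = trans (∑-cong xs eq) (trans (∑-const xs 0) (*-zeroʳ (length xs)))

∑-+ : ∀ (xs : List A) f g → ∑ xs (λ x → f x + g x) ≡ ∑ xs f + ∑ xs g
∑-+ []       f g = refl
∑-+ (x ∷ xs) f g = trans (cong (f x + g x +_) (∑-+ xs f g)) (+-exchange (f x) (g x) (∑ xs f) (∑ xs g))
  where
  +-exchange : ∀ a b c d → a + b + (c + d) ≡ a + c + (b + d)
  +-exchange a b c d = trans (+-assoc a b (c + d)) (trans (cong (a +_)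
    (trans (sym (+-assoc b c d)) (trans (cong (_+ d) (+-comm b c)) (+-assoc c b d)))) (sym (+-assoc a c (b + d))))

∑-*ˡ : ∀ (xs : List A) c f → ∑ xs (λ x → c * f x) ≡ c * ∑ xs f
∑-*ˡ []       c f = sym (*-zeroʳ c)
∑-*ˡ (x ∷ xs) c f = trans (cong (c * f x +_) (∑-*ˡ xs c f)) (sym (*-distribˡ-+ c (f x) (∑ xs f)))

∑-*ʳ : ∀ (xs : List A) c f → ∑ xs (λ x → f x * c) ≡ ∑ xs f * c
∑-*ʳ xs c f = trans (∑-cong xs λ {x} _ → *-comm (f x) c) (trans (∑-*ˡ xs c f) (*-comm c _))

∑-swap : ∀ (xs : List A) (ys : List B) (f : A → B → ℕ) →
         ∑ xs (λ x → ∑ ys (λ y → f x y)) ≡ ∑ ys (λ y → ∑ xs (λ x → f x y))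
∑-swap []       ys f = sym (∑-zero ys λ _ → refl)
∑-swap (x ∷ xs) ys f = trans (cong (∑ ys (f x) +_) (∑-swap xs ys f)) (sym (∑-+ ys (f x) _))

∑-++ : ∀ (xs ys : List A) f → ∑ (xs ++ ys) f ≡ ∑ xs f + ∑ ys f
∑-++ xs ys f = trans (cong sum (map-++ f xs ys)) (sum-++ (map f xs) (map f ys))

∑-map : ∀ (g : A → B) xs f → ∑ (map g xs) f ≡ ∑ xs (f ∘ g)
∑-map g xs f = cong sum (sym (map-∘ xs))

∑-↭ : ∀ {xs ys : List A} f → xs ↭ ys → ∑ xs f ≡ ∑ ys f
∑-↭ f p = sum-↭ (map⁺ f p)

∑-cartesianProductWith : ∀ (h : A → B → C) xs ys f →
  ∑ (cartesianProductWith h xs ys) f ≡ ∑ xs (λ x → ∑ ys (λ y → f (h x y)))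
∑-cartesianProductWith h []       ys f = refl
∑-cartesianProductWith h (x ∷ xs) ys f =
  trans (∑-++ (map (h x) ys) _ f) (cong₂ _+_ (∑-map (h x) ys f) (∑-cartesianProductWith h xs ys f))

∑-single : ∀ {xs : List A} {x} f → Unique xs → x ∈ xs →
           (∀ {y} → y ∈ xs → y ≢ x → f y ≡ 0) → ∑ xs f ≡ f x
∑-single {xs = x ∷ xs} f u@(_ ∷ _) (here refl) z =
  trans (cong (f x +_) (∑-zero xs λ y∈ → z (there y∈) λ { refl → Unique[x∷xs]⇒x∉xs u y∈ })) (+-identityʳ (f x))
∑-single {xs = y ∷ xs} f u@(_ ∷ uxs) (there x∈) z =
  cong₂ _+_ (z (here refl) λ { refl → Unique[x∷xs]⇒x∉xs u x∈ }) (∑-single f uxs x∈ (z ∘ there))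

∑≢0⇒∃ : ∀ (xs : List A) f → ∑ xs f ≢ 0 → ∃[ x ] (x ∈ xs × f x ≢ 0)
∑≢0⇒∃ []       f ≢0 = contradiction refl ≢0
∑≢0⇒∃ (x ∷ xs) f ≢0 with f x ℕ.≟ 0
... | no fx≢0 = x , here refl , fx≢0
... | yes fx≡0 with ∑≢0⇒∃ xs f (λ eq → ≢0 (cong₂ _+_ fx≡0 eq))
...   | y , y∈ , fy = y , there y∈ , fy

∈⇒≤∑ : ∀ {xs : List A} {x} f → x ∈ xs → f x ≤ ∑ xs f
∈⇒≤∑ f (here refl) = m≤m+n _ _
∈⇒≤∑ f (there x∈)  = ≤-trans (∈⇒≤∑ f x∈) (m≤n+m _ _)

∑≤1 : ∀ {xs : List A} f → Unique xs → (∀ {x} → x ∈ xs → f x ≤ 1) →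
      (∀ {x y} → x ∈ xs → y ∈ xs → f x ≢ 0 → f y ≢ 0 → x ≡ y) → ∑ xs f ≤ 1
∑≤1 {xs = xs} f u le eq with ∑ xs f ℕ.≟ 0
... | yes ≡0 = ≤-trans (≤-reflexive ≡0) z≤n
... | no ≢0 with ∑≢0⇒∃ xs f ≢0
...   | x , x∈ , fx≢0 = ≤-trans (≤-reflexive (∑-single f u x∈ λ {y} y∈ y≢x → zero-off y y∈ y≢x)) (le x∈)
  where
  zero-off : ∀ y → y ∈ xs → y ≢ x → f y ≡ 0
  zero-off y y∈ y≢x with f y ℕ.≟ 0
  ... | yes p = p
  ... | no fy≢0 = contradiction (eq y∈ x∈ fy≢0 fx≢0) y≢x

-- Counting in lists without repetitions

∈⇒↭∷ : ∀ {x : A} {ys} → x ∈ ys → ∃[ zs ] ys ↭ x ∷ zs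
∈⇒↭∷ {x = x} x∈ with ∈-∃++ x∈
... | as , bs , refl = as ++ bs , shift x as bs

Unique-⊆-length : ∀ {xs ys : List A} → Unique xs → xs ⊆ ys → length xs ≤ length ys
Unique-⊆-length []            _  = z≤n
Unique-⊆-length {xs = x ∷ xs} {ys} u@(_ ∷ uxs) xs⊆ys with ∈⇒↭∷ (xs⊆ys (here refl))
... | zs , p = ≤-trans (s≤s (Unique-⊆-length uxs xs⊆zs)) (≤-reflexive (sym (↭-length p)))
  where
  xs⊆zs : xs ⊆ zs
  xs⊆zs y∈ with ∈-resp-↭ p (xs⊆ys (there y∈))
  ... | here refl = contradiction y∈ (Unique[x∷xs]⇒x∉xs u)
  ... | there y∈zs = y∈zs

Unique-⊆⇒↭ : ∀ {xs ys : List A} → Unique xs → xs ⊆ ys → length ys ≤ length xs → xs ↭ ys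
Unique-⊆⇒↭ {xs = []} {[]} _ _ _ = ↭-refl
Unique-⊆⇒↭ {xs = x ∷ xs} {ys} u@(_ ∷ uxs) xs⊆ys le with ∈⇒↭∷ (xs⊆ys (here refl))
... | zs , p = ↭-trans (prep x (Unique-⊆⇒↭ uxs xs⊆zs (s≤s⁻¹ (≤-trans (≤-reflexive (sym (↭-length p))) le)))) (↭-sym p)
  where
  xs⊆zs : xs ⊆ zs
  xs⊆zs y∈ with ∈-resp-↭ p (xs⊆ys (there y∈))
  ... | here refl = contradiction y∈ (Unique[x∷xs]⇒x∉xs u)
  ... | there y∈zs = y∈zs

Unique-⊆-⊇ : ∀ {xs ys : List A} → Unique xs → xs ⊆ ys → length ys ≤ length xs → ys ⊆ xs
Unique-⊆-⊇ u s le = ∈-resp-↭ (↭-sym (Unique-⊆⇒↭ u s le))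

module _ (_≟_ : DecidableEquality A) where
  open import Data.List.Membership.DecPropositional _≟_ using (_∈?_)

  ∑-indicator : ∀ {ms : List A} {y} → Unique ms → y ∈ ms → ∑ ms (λ m → 𝟙 (y ≟ m)) ≡ 1
  ∑-indicator {y = y} u y∈ = trans
    (∑-single _ u y∈ λ _ z≢y → 𝟙-no (y ≟ _) (z≢y ∘ sym)) (𝟙-yes (y ≟ y) refl)

  -- Adding the missing terms back avoids truncated subtraction: each entry of `ms` lacks exactly
  -- one summand `c`. In the counts below `ms` consists of the values that are already taken.
  ∑-off : ∀ {ys ms : List A} (g : A → ℕ) c → Unique ys → Unique ms → ms ⊆ ys →
          (∀ {y} → y ∈ ms → g y ≡ 0) → (∀ {y} → y ∈ ys → y ∉ ms → g y ≡ c) →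
          ∑ ys g + length ms * c ≡ length ys * c
  ∑-off {ys} {ms} g c uys ums ms⊆ys on off = begin
    ∑ ys g + length ms * c
      ≡⟨ cong (∑ ys g +_) (trans (sym (∑-const ms c)) (∑-cong ms λ m∈ → sym (row m∈))) ⟩
    ∑ ys g + ∑ ms (λ m → ∑ ys (λ y → 𝟙 (y ≟ m) * c))
      ≡⟨ cong (∑ ys g +_) (sym (∑-swap ys ms (λ y m → 𝟙 (y ≟ m) * c))) ⟩
    ∑ ys g + ∑ ys (λ y → ∑ ms (λ m → 𝟙 (y ≟ m) * c))
      ≡⟨ sym (∑-+ ys g _) ⟩
    ∑ ys (λ y → g y + ∑ ms (λ m → 𝟙 (y ≟ m) * c))
      ≡⟨ ∑-cong ys col ⟩
    ∑ ys (λ _ → c)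
      ≡⟨ ∑-const ys c ⟩
    length ys * c ∎
    where
    open ≡-Reasoning
    row : ∀ {m} → m ∈ ms → ∑ ys (λ y → 𝟙 (y ≟ m) * c) ≡ c
    row {m} m∈ = trans (∑-single _ uys (ms⊆ys m∈) λ {y} _ y≢m → cong (_* c) (𝟙-no (y ≟ m) y≢m))
                       (trans (cong (_* c) (𝟙-yes (m ≟ m) refl)) (+-identityʳ c))
    col : ∀ {y} → y ∈ ys → g y + ∑ ms (λ m → 𝟙 (y ≟ m) * c) ≡ c
    col {y} y∈ with y ∈? ms
    ... | yes y∈ms = cong₂ _+_ (on y∈ms) (trans (∑-*ʳ ms c _) (trans (cong (_* c) (∑-indicator ums y∈ms)) (+-identityʳ c)))
    ... | no y∉ms = trans (cong₂ _+_ (off y∈ y∉ms)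
                      (∑-zero ms λ {m} m∈ → cong (_* c) (𝟙-no (y ≟ m) λ { refl → y∉ms m∈ }))) (+-identityʳ c)

  -- An injective self-map of a finite set permutes it.
  ∑-reindex : ∀ {xs : List A} (φ : A → A) f → Unique xs → (∀ {x} → x ∈ xs → φ x ∈ xs) →
              (∀ {x y} → x ∈ xs → y ∈ xs → φ x ≡ φ y → x ≡ y) → ∑ xs (f ∘ φ) ≡ ∑ xs f
  ∑-reindex {xs} φ f u into inj = trans (sym (∑-map φ xs f))
    (∑-↭ f (Unique-⊆⇒↭ (umap u inj) sub (≤-reflexive (sym (len xs)))))
    where
    len : ∀ ys → length (map φ ys) ≡ length ys
    len = length-map φ
    sub : map φ xs ⊆ xs
    sub y∈ with ∈-map⁻ φ y∈
    ... | x , x∈ , refl = into x∈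
    umap : ∀ {ys} → Unique ys → (∀ {x y} → x ∈ ys → y ∈ ys → φ x ≡ φ y → x ≡ y) → Unique (map φ ys)
    umap [] _ = []
    umap {y ∷ ys} u@(_ ∷ uys) inj =
      All.tabulate (λ z∈ eq → let (x , x∈ , z≡) = ∈-map⁻ φ z∈ in
        Unique[x∷xs]⇒x∉xs u (subst (_∈ ys) (sym (inj (here refl) (there x∈) (trans eq z≡))) x∈))
      ∷ umap uys (λ a b → inj (there a) (there b))

-- Permutations of Fin n

Inj : (Fin n → Fin k) → Set
Inj f = ∀ {x y} → f x ≡ f y → x ≡ y

inj⇒surj : {f : Fin n → Fin n} → Inj f → ∀ y → ∃[ x ] f x ≡ y
inj⇒surj {suc n} {f} inj y with any? (λ x → f x ≟ y)
... | yes hit = hit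
... | no miss = contradiction (injective⇒≤ {f = λ x → punchOut (y≢ x)} (inj ∘ punchOut-injective (y≢ _) (y≢ _))) 1+n≰n
  where
  y≢ : ∀ x → y ≢ f x
  y≢ x eq = miss (x , sym eq)

transpose-fst : ∀ (a b : Fin n) → transpose a b a ≡ b
transpose-fst a b with a ≟ a
... | yes _  = refl
... | no a≢a = contradiction refl a≢a

transpose-snd : ∀ (a b : Fin n) → transpose a b b ≡ a
transpose-snd a b with b ≟ a
... | yes b≡a = b≡a
... | no _ with b ≟ b
...   | yes _  = refl
...   | no b≢b = contradiction refl b≢b

transpose-other : ∀ {a b x : Fin n} → x ≢ a → x ≢ b → transpose a b x ≡ x
transpose-other {a = a} {b} {x} x≢a x≢b with x ≟ a
... | yes x≡a = contradiction x≡a x≢a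
... | no _ with x ≟ b
...   | yes x≡b = contradiction x≡b x≢b
...   | no _    = refl

transpose-inj : ∀ (a b : Fin n) → Inj (transpose a b)
transpose-inj a b eq = trans (sym (transpose-inverse b a)) (trans (cong (transpose b a) eq) (transpose-inverse b a))

fresh : ∀ (xs : List (Fin n)) → length xs < n → ∃[ x ] x ∉ xs
fresh {n} xs lt with any? (λ x → ¬? (x ∈? xs))
  where open import Data.List.Membership.DecPropositional _≟_ using (_∈?_)
... | yes hit = hit
... | no none = contradiction (≤-trans lt (≤-trans (≤-reflexive (sym (length-tabulate id)))
                  (Unique-⊆-length (allFin⁺ n) all∈))) (<-irrefl refl)
  where
  open import Data.List.Membership.DecPropositional _≟_ using (_∈?_)
  all∈ : allFin n ⊆ xs
  all∈ {x} _ with x ∈? xs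
  ... | yes x∈ = x∈
  ... | no x∉  = contradiction (x , x∉) none

full : ∀ {xs : List (Fin n)} → Unique xs → n ≤ length xs → ∀ x → x ∈ xs
full {n} u le x = Unique-⊆-⊇ u (λ _ → ∈-allFin _) (≤-trans (≤-reflexive (length-tabulate id)) le) (∈-allFin x)

Sends : (Fin n → Fin k) → List (Fin n × Fin k) → Set
Sends f = All (λ xy → f (proj₁ xy) ≡ proj₂ xy)

sends? : ∀ (f : Fin n → Fin k) p → Dec (Sends f p)
sends? f = All.all? (λ xy → f (proj₁ xy) ≟ proj₂ xy)

extend : ∀ (p : List (Fin n × Fin n)) → Unique (map proj₁ p) → Unique (map proj₂ p) →
         ∃[ f ] (Inj f × Sends f p)
extend []            _          _          = id , id , []
extend ((x , y) ∷ p) ux@(_ ∷ uxs) uy@(_ ∷ uys) =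
  let f , f-inj , fp = extend p uxs uys
      t = transpose (f x) y
      keep : ∀ {q} → q ∈ p → t (f (proj₁ q)) ≡ proj₂ q
      keep {q} q∈ = trans (transpose-other
          (λ eq → Unique[x∷xs]⇒x∉xs ux (subst (_∈ map proj₁ p) (f-inj eq) (∈-map⁺ proj₁ q∈)))
          (λ eq → Unique[x∷xs]⇒x∉xs uy (subst (_∈ map proj₂ p) (trans (sym (All.lookup fp q∈)) eq) (∈-map⁺ proj₂ q∈))))
        (All.lookup fp q∈)
  in t ∘ f , f-inj ∘ transpose-inj (f x) y , transpose-fst (f x) y ∷ All.tabulate keep

-- Enumerating and counting permutations

vecs : List A → ∀ k → List (Vec A k)
vecs xs zero    = [] ∷ []
vecs xs (suc k) = cartesianProductWith _∷_ xs (vecs xs k)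

vecs-unique : ∀ {xs : List A} k → Unique xs → Unique (vecs xs k)
vecs-unique zero    u = [] ∷ []
vecs-unique (suc k) u = cartesianProductWith⁺ _∷_ Vec.∷-injective u (vecs-unique k u)

∈-vecs : ∀ (v : Vec (Fin n) k) → v ∈ vecs (allFin n) k
∈-vecs []      = here refl
∈-vecs (x ∷ v) = ∈-cartesianProductWith⁺ _∷_ (∈-allFin x) (∈-vecs v)

InjVec : Vec (Fin n) n → Set
InjVec v = ∀ x y → lookup v x ≡ lookup v y → x ≡ y

injVec? : Decidable (InjVec {n})
injVec? v = all? λ x → all? λ y → (lookup v x ≟ lookup v y) →-dec (x ≟ y)

perms : ∀ n → List (Vec (Fin n) n)
perms n = filter injVec? (vecs (allFin n) n)

perms-unique : ∀ n → Unique (perms n)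
perms-unique n = filter⁺ injVec? (vecs-unique n (allFin⁺ n))

perms-inj : ∀ {σ} → σ ∈ perms n → Inj (lookup σ)
perms-inj {n} σ∈ = proj₂ (∈-filter⁻ injVec? {xs = vecs (allFin n) n} σ∈) _ _

∈-perms : ∀ {σ} → Inj (lookup σ) → σ ∈ perms n
∈-perms {σ = σ} inj = ∈-filter⁺ injVec? (∈-vecs σ) λ _ _ → inj

tabulate∈perms : ∀ {f : Fin n → Fin n} → Inj f → tabulate f ∈ perms n
tabulate∈perms {f = f} inj = ∈-perms λ {x} {y} eq →
  inj (trans (sym (lookup∘tabulate f x)) (trans eq (lookup∘tabulate f y)))

-- Here `k` is the number of free points. Splitting by the value at a fresh point `x`, the values
-- already prescribed contribute nothing and each of the others leaves one free point fewer. With no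
-- free point left, `extend` supplies the only permutation.
count-perms : ∀ k (p : List (Fin n × Fin n)) → Unique (map proj₁ p) → Unique (map proj₂ p) →
              k + length p ≡ n → ∑ (perms n) (λ σ → 𝟙 (sends? (lookup σ) p)) ≡ k !
count-perms {n} zero p ux uy eq with extend p ux uy
... | f , f-inj , fp = trans
  (∑-single _ (perms-unique n) (tabulate∈perms f-inj) (λ {σ} _ σ≢ → 𝟙-no (sends? _ p) (λ sp → σ≢ (determined sp))))
  (𝟙-yes (sends? _ p) (All.map (trans (lookup∘tabulate f _)) fp))
  where
  determined : ∀ {σ} → Sends (lookup σ) p → σ ≡ tabulate f
  determined {σ} sp = trans (sym (tabulate∘lookup σ)) (tabulate-cong agree)
    where
    agree : ∀ x → lookup σ x ≡ f x
    agree x with ∈-map⁻ proj₁ (full ux (≤-reflexive (trans (sym eq) (sym (length-map proj₁ p)))) x)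
    ... | q , q∈ , refl = trans (All.lookup sp q∈) (sym (All.lookup fp q∈))
count-perms {n} (suc k) p ux uy eq
  with fresh (map proj₁ p) (≤-trans (s≤s (≤-trans (≤-reflexive (length-map proj₁ p)) (m≤n+m (length p) k))) (≤-reflexive eq))
... | x , x∉ = +-cancelʳ-≡ (length ms * k !) _ _ (begin
  ∑ (perms n) (λ σ → 𝟙 (sends? (lookup σ) p)) + length ms * k !
    ≡⟨ cong (_+ length ms * k !) (∑-cong (perms n) (λ {σ} _ → sym (split σ))) ⟩
  ∑ (perms n) (λ σ → ∑ (allFin n) (λ y → 𝟙 (sends? (lookup σ) ((x , y) ∷ p)))) + length ms * k !
    ≡⟨ cong (_+ length ms * k !) (∑-swap (perms n) (allFin n) (λ σ y → 𝟙 (sends? (lookup σ) ((x , y) ∷ p)))) ⟩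
  ∑ (allFin n) (λ y → ∑ (perms n) (λ σ → 𝟙 (sends? (lookup σ) ((x , y) ∷ p)))) + length ms * k !
    ≡⟨ ∑-off _≟_ _ (k !) (allFin⁺ n) uy (λ _ → ∈-allFin _) taken free ⟩
  length (allFin n) * k !
    ≡⟨ cong (_* k !) (trans (length-tabulate id) (trans (sym eq) (cong (λ l → suc k + l) (sym (length-map proj₂ p))))) ⟩
  (suc k + length ms) * k !
    ≡⟨ *-distribʳ-+ (k !) (suc k) (length ms) ⟩
  (suc k) ! + length ms * k ! ∎)
  where
  open ≡-Reasoning
  ms = map proj₂ p
  taken : ∀ {y} → y ∈ ms → ∑ (perms n) (λ σ → 𝟙 (sends? (lookup σ) ((x , y) ∷ p))) ≡ 0
  taken {y} y∈ with ∈-map⁻ proj₂ y∈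
  ... | q , q∈ , refl = ∑-zero (perms n) λ {σ} σ∈ → 𝟙-no (sends? _ ((x , y) ∷ p)) λ
    { (σx ∷ sp) → x∉ (subst (_∈ map proj₁ p) (perms-inj σ∈ (trans (All.lookup sp q∈) (sym σx))) (∈-map⁺ proj₁ q∈)) }
  free : ∀ {y} → y ∈ allFin n → y ∉ ms → ∑ (perms n) (λ σ → 𝟙 (sends? (lookup σ) ((x , y) ∷ p))) ≡ k !
  free y∈ y∉ = count-perms k ((_ , _) ∷ p) (All.¬Any⇒All¬ _ x∉ ∷ ux) (All.¬Any⇒All¬ _ y∉ ∷ uy) (trans (+-suc k _) eq)
  split : ∀ σ → ∑ (allFin n) (λ y → 𝟙 (sends? (lookup σ) ((x , y) ∷ p))) ≡ 𝟙 (sends? (lookup σ) p)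
  split σ = trans (∑-single _ (allFin⁺ n) (∈-allFin (lookup σ x))
                    (λ _ y≢ → 𝟙-no (sends? _ (_ ∷ p)) λ { (σx ∷ _) → y≢ (sym σx) }))
                  (𝟙-cong (sends? _ ((x , lookup σ x) ∷ p)) (sends? _ p) (λ { (_ ∷ sp) → sp }) (refl ∷_))

-- Tuples indexed by a vector

alls : {P : A → Set} → (∀ a → List (P a)) → ∀ {k} (xs : Vec A k) → List (VAll P xs)
alls l []       = [] ∷ []
alls l (x ∷ xs) = cartesianProductWith _∷_ (l x) (alls l xs)

module _ {P : A → Set} where

  ∷-injectiveᵃ : ∀ {x} {xs : Vec A k} {p q : P x} {ps qs : VAll P xs} →
                 _≡_ {A = VAll P (x ∷ xs)} (p ∷ ps) (q ∷ qs) → p ≡ q × ps ≡ qs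
  ∷-injectiveᵃ refl = refl , refl

  alls-unique : ∀ {l : ∀ a → List (P a)} → (∀ a → Unique (l a)) → (xs : Vec A k) → Unique (alls l xs)
  alls-unique u []       = [] ∷ []
  alls-unique u (x ∷ xs) = cartesianProductWith⁺ _∷_ ∷-injectiveᵃ (u x) (alls-unique u xs)

  ∈-alls⁺ : ∀ {l : ∀ a → List (P a)} {xs : Vec A k} {p : VAll P xs} →
            (∀ i → lookup⁺ p i ∈ l (lookup xs i)) → p ∈ alls l xs
  ∈-alls⁺ {p = []}    _   = here refl
  ∈-alls⁺ {p = _ ∷ _} all = ∈-cartesianProductWith⁺ _∷_ (all zero) (∈-alls⁺ (all ∘ suc))

  ∈-alls⁻ : ∀ {l : ∀ a → List (P a)} {xs : Vec A k} {p : VAll P xs} →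
            p ∈ alls l xs → ∀ i → lookup⁺ p i ∈ l (lookup xs i)
  ∈-alls⁻ {l = l} {xs = x ∷ xs} p∈ i with ∈-cartesianProductWith⁻ _∷_ (l x) (alls l xs) p∈
  ∈-alls⁻ {l = l} {xs = x ∷ xs} p∈ zero    | _ , _ , a∈ , _ , refl = a∈
  ∈-alls⁻ {l = l} {xs = x ∷ xs} p∈ (suc i) | _ , _ , _ , b∈ , refl = ∈-alls⁻ b∈ i

  lookup⁺-injective : ∀ {xs : Vec A k} {p q : VAll P xs} → (∀ i → lookup⁺ p i ≡ lookup⁺ q i) → p ≡ q
  lookup⁺-injective {p = []}    {[]}    _  = refl
  lookup⁺-injective {p = _ ∷ _} {_ ∷ _} eq = cong₂ _∷_ (eq zero) (lookup⁺-injective (eq ∘ suc))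

  lookup⁺-lookup⁻ : ∀ {xs : Vec A k} (f : ∀ i → P (lookup xs i)) i → lookup⁺ {P = P} {xs = xs} (lookup⁻ {P = P} f) i ≡ f i
  lookup⁺-lookup⁻ {xs = _ ∷ _} f zero    = refl
  lookup⁺-lookup⁻ {xs = _ ∷ xs} f (suc i) = lookup⁺-lookup⁻ {xs = xs} (f ∘ suc) i

  ≡-decᵃ : (∀ {a} → DecidableEquality (P a)) → ∀ {xs : Vec A k} → DecidableEquality (VAll P xs)
  ≡-decᵃ _≟ᴾ_ []       []       = yes refl
  ≡-decᵃ _≟ᴾ_ (p ∷ ps) (q ∷ qs) = map′ (λ (e , es) → cong₂ _∷_ e es) ∷-injectiveᵃ (p ≟ᴾ q ×-dec ≡-decᵃ _≟ᴾ_ ps qs)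

-- Counting the tuples of permutations that carry one matching into another

Perms : Vec ℕ k → Set
Perms = VAll (λ n → Vec (Fin n) n)

group : (ns : Vec ℕ k) → List (Perms ns)
group = alls perms

infix 4 _≟ᵉ_
_≟ᵉ_ : (e f : Edge ns) → Dec (e ≡ f)
_≟ᵉ_ = ≡-decᵃ _≟_

act : Perms ns → Edge ns → Edge ns
act []      []      = []
act (σ ∷ γ) (x ∷ e) = lookup σ x ∷ act γ e

lookup-act : ∀ (γ : Perms ns) e i → lookup⁺ (act γ e) i ≡ lookup (lookup⁺ γ i) (lookup⁺ e i)
lookup-act (σ ∷ γ) (x ∷ e) zero    = refl
lookup-act (σ ∷ γ) (x ∷ e) (suc i) = lookup-act γ e i

group-inj : ∀ {γ : Perms ns} → γ ∈ group ns → ∀ i → Inj (lookup (lookup⁺ γ i))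
group-inj γ∈ i = perms-inj (∈-alls⁻ γ∈ i)

act-injective : ∀ {γ : Perms ns} → γ ∈ group ns → ∀ {e f} → act γ e ≡ act γ f → e ≡ f
act-injective {γ = γ} γ∈ {e} {f} eq = lookup⁺-injective λ i → group-inj γ∈ i
  (trans (sym (lookup-act γ e i)) (trans (cong (λ g → lookup⁺ g i) eq) (lookup-act γ f i)))

act-disjoint : ∀ {γ : Perms ns} → γ ∈ group ns → ∀ {e f} → Disjoint e f → Disjoint (act γ e) (act γ f)
act-disjoint {γ = γ} γ∈ {e} {f} dis i eq = dis i (group-inj γ∈ i
  (trans (sym (lookup-act γ e i)) (trans eq (lookup-act γ f i))))

act-matching : ∀ {γ : Perms ns} → γ ∈ group ns → ∀ {W} → IsMatching W → IsMatching (map (act γ) W)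
act-matching γ∈ m = AllPairs.map⁺ (AllPairs.map (λ {e} {f} → act-disjoint γ∈ {e} {f}) m)

Disjoint-sym : ∀ {ns : Vec ℕ k} (e f : Edge ns) → Disjoint e f → Disjoint f e
Disjoint-sym e f dis i = dis i ∘ sym

Disjoint⇒≢ : ∀ {ns : Vec ℕ (suc k)} {e f : Edge ns} → Disjoint e f → e ≢ f
Disjoint⇒≢ dis refl = dis zero refl

matching-unique : ∀ {ns : Vec ℕ (suc k)} {W : List (Edge ns)} → IsMatching W → Unique W
matching-unique = AllPairs.map λ {e} {f} → Disjoint⇒≢ {e = e} {f}

matching-disjoint : ∀ {M : List (Edge ns)} → IsMatching M → ∀ {e f} → e ∈ M → f ∈ M → e ≢ f → Disjoint e f
matching-disjoint (d ∷ m) (here refl) (here refl) e≢f = contradiction refl e≢f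
matching-disjoint (d ∷ m) (here refl) (there f∈)  _   = All.lookup d f∈
matching-disjoint (d ∷ m) {e} {f} (there e∈)  (here refl) _   = Disjoint-sym f e (All.lookup d e∈)
matching-disjoint (d ∷ m) (there e∈)  (there f∈)  e≢f = matching-disjoint m e∈ f∈ e≢f

∏ : (ℕ → ℕ) → Vec ℕ k → ℕ
∏ f ns = Vec.foldr′ _*_ 1 (Vec.map f ns)

∏-* : ∀ f g (ns : Vec ℕ k) → ∏ (λ n → f n * g n) ns ≡ ∏ f ns * ∏ g ns
∏-* f g []       = refl
∏-* f g (n ∷ ns) = trans (cong (f n * g n *_) (∏-* f g ns)) ([m*n]*[o*p]≡[m*o]*[n*p] (f n) (g n) (∏ f ns) (∏ g ns))

Maps : Perms ns → List (Edge ns × Edge ns) → Set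
Maps γ = All (λ wm → act γ (proj₁ wm) ≡ proj₂ wm)

maps? : ∀ (γ : Perms ns) p → Dec (Maps γ p)
maps? γ = All.all? (λ wm → act γ (proj₁ wm) ≟ᵉ proj₂ wm)

module _ {n : ℕ} {ns : Vec ℕ k} where

  hd : Edge (n ∷ ns) → Fin n
  hd (x ∷ _) = x

  tl : Edge (n ∷ ns) → Edge ns
  tl (_ ∷ e) = e

  matching-hd : ∀ {W : List (Edge (n ∷ ns))} → IsMatching W → Unique (map hd W)
  matching-hd = AllPairs.map⁺ ∘ AllPairs.map λ { {_ ∷ _} {_ ∷ _} dis → dis zero }

  matching-tl : ∀ {W : List (Edge (n ∷ ns))} → IsMatching W → IsMatching (map tl W)
  matching-tl = AllPairs.map⁺ ∘ AllPairs.map λ { {_ ∷ _} {_ ∷ _} dis → dis ∘ suc }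

-- The action is coordinatewise and disjointness means distinctness in every coordinate, so the
-- count is a product of counts of permutations with prescribed values.
count-maps : ∀ (p : List (Edge ns × Edge ns)) → IsMatching (map proj₁ p) → IsMatching (map proj₂ p) →
             VAll (length p ≤_) ns →
             ∑ (group ns) (λ γ → 𝟙 (maps? γ p)) ≡ ∏ (λ n → (n ∸ length p) !) ns
count-maps {ns = []} p _ _ [] = trans (+-identityʳ _) (𝟙-yes (maps? [] p) (All.universal (λ { ([] , []) → refl }) p))
count-maps {ns = n ∷ ns} p m₁ m₂ (le ∷ les) = begin
  ∑ (group (n ∷ ns)) (λ γ → 𝟙 (maps? γ p))
    ≡⟨ ∑-cartesianProductWith _∷_ (perms n) (group ns) _ ⟩
  ∑ (perms n) (λ σ → ∑ (group ns) (λ γ → 𝟙 (maps? (σ ∷ γ) p)))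
    ≡⟨ ∑-cong (perms n) (λ {σ} _ → trans (∑-cong (group ns) (λ {γ} _ → factor σ γ)) (∑-*ˡ (group ns) (𝟙 (sends? (lookup σ) ph)) _)) ⟩
  ∑ (perms n) (λ σ → 𝟙 (sends? (lookup σ) ph) * ∑ (group ns) (λ γ → 𝟙 (maps? γ pt)))
    ≡⟨ ∑-*ʳ (perms n) _ _ ⟩
  ∑ (perms n) (λ σ → 𝟙 (sends? (lookup σ) ph)) * ∑ (group ns) (λ γ → 𝟙 (maps? γ pt))
    ≡⟨ cong₂ _*_ head≡ tail≡ ⟩
  ∏ (λ n → (n ∸ length p) !) (n ∷ ns) ∎
  where
  open ≡-Reasoning
  heads : Edge (n ∷ ns) × Edge (n ∷ ns) → Fin n × Fin n
  heads (w , m) = hd w , hd m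
  tails : Edge (n ∷ ns) × Edge (n ∷ ns) → Edge ns × Edge ns
  tails (w , m) = tl w , tl m
  ph = map heads p
  pt = map tails p
  maps⇒ : ∀ σ γ q → Maps (σ ∷ γ) q → Sends (lookup σ) (map heads q) × Maps γ (map tails q)
  maps⇒ σ γ [] [] = [] , []
  maps⇒ σ γ ((x ∷ w , y ∷ m) ∷ q) (eq ∷ eqs) with maps⇒ σ γ q eqs | ∷-injectiveᵃ eq
  ... | a , b | c , d = c ∷ a , d ∷ b
  maps⇐ : ∀ σ γ q → Sends (lookup σ) (map heads q) → Maps γ (map tails q) → Maps (σ ∷ γ) q
  maps⇐ σ γ [] [] [] = []
  maps⇐ σ γ ((x ∷ w , y ∷ m) ∷ q) (c ∷ a) (d ∷ b) = cong₂ _∷_ c d ∷ maps⇐ σ γ q a b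
  factor : ∀ σ γ → 𝟙 (maps? (σ ∷ γ) p) ≡ 𝟙 (sends? (lookup σ) ph) * 𝟙 (maps? γ pt)
  factor σ γ with sends? (lookup σ) ph | maps? γ pt
  ... | yes a | yes b = 𝟙-yes (maps? (σ ∷ γ) p) (maps⇐ σ γ p a b)
  ... | yes a | no ¬b = 𝟙-no (maps? (σ ∷ γ) p) (¬b ∘ proj₂ ∘ maps⇒ σ γ p)
  ... | no ¬a | _     = 𝟙-no (maps? (σ ∷ γ) p) (¬a ∘ proj₁ ∘ maps⇒ σ γ p)
  head≡ = count-perms (n ∸ length p) ph
    (subst Unique (trans (sym (map-∘ p)) (map-∘ p)) (matching-hd m₁))
    (subst Unique (trans (sym (map-∘ p)) (map-∘ p)) (matching-hd m₂))
    (trans (cong (n ∸ length p +_) (length-map heads p)) (m∸n+n≡m le))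
  tail≡ = trans (count-maps pt
    (subst IsMatching (trans (sym (map-∘ p)) (map-∘ p)) (matching-tl m₁))
    (subst IsMatching (trans (sym (map-∘ p)) (map-∘ p)) (matching-tl m₂))
    (subst (λ l → VAll (l ≤_) ns) (sym (length-map tails p)) les))
    (cong (λ l → ∏ (λ n → (n ∸ l) !) ns) (length-map tails p))

module _ {ns : Vec ℕ (suc k)} where
  open import Data.List.Membership.DecPropositional (_≟ᵉ_ {ns = ns}) using (_∈?_) public

  -- Only inclusion is asked. For `γ` in the group and matchings of equal size it already makes the
  -- image of `W` the same set as `M`.
  Into : List (Edge ns) → Perms ns → List (Edge ns) → Set
  Into M γ W = All (λ w → act γ w ∈ M) W

  into? : ∀ M γ W → Dec (Into M γ W)
  into? M γ = All.all? (λ w → act γ w ∈? M)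

  -- The list `p` records the images chosen so far. The next edge `w` may go to any member of `M`
  -- not yet used; each such choice keeps both sides of `p` matchings, because `M` is one.
  count-into′ : ∀ {M} → IsMatching M → VAll (length M ≤_) ns →
    ∀ W p → IsMatching W → IsMatching (map proj₁ p) → (∀ {w x} → w ∈ W → x ∈ map proj₁ p → Disjoint w x) →
    IsMatching (map proj₂ p) → map proj₂ p ⊆ M → length W + length p ≡ length M →
    ∑ (group ns) (λ γ → 𝟙 (maps? γ p) * 𝟙 (into? M γ W)) ≡ length W ! * ∏ (λ n → (n ∸ length M) !) ns
  count-into′ {M} mM le [] p _ m₁ _ m₂ sub len = begin
    ∑ (group ns) (λ γ → 𝟙 (maps? γ p) * 𝟙 (into? M γ []))
      ≡⟨ ∑-cong (group ns) (λ _ → *-identityʳ _) ⟩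
    ∑ (group ns) (λ γ → 𝟙 (maps? γ p))
      ≡⟨ count-maps p m₁ m₂ (subst (λ l → VAll (l ≤_) ns) (sym len) le) ⟩
    ∏ (λ n → (n ∸ length p) !) ns
      ≡⟨ cong (λ l → ∏ (λ n → (n ∸ l) !) ns) len ⟩
    ∏ (λ n → (n ∸ length M) !) ns
      ≡⟨ sym (*-identityˡ _) ⟩
    1 * ∏ (λ n → (n ∸ length M) !) ns ∎
    where open ≡-Reasoning
  count-into′ {M} mM le (w ∷ W) p (w# ∷ mW) m₁ dis m₂ sub len = +-cancelʳ-≡ (length ms * c) _ _ (begin
    ∑ (group ns) (λ γ → 𝟙 (maps? γ p) * 𝟙 (into? M γ (w ∷ W))) + length ms * c
      ≡⟨ cong (_+ length ms * c) (∑-cong (group ns) (λ {γ} _ → split γ)) ⟩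
    ∑ (group ns) (λ γ → ∑ M (term γ)) + length ms * c
      ≡⟨ cong (_+ length ms * c) (∑-swap (group ns) M term) ⟩
    ∑ M (λ m → ∑ (group ns) (λ γ → term γ m)) + length ms * c
      ≡⟨ ∑-off _≟ᵉ_ _ c (matching-unique mM) (matching-unique m₂) sub taken free ⟩
    length M * c
      ≡⟨ cong (_* c) (sym (trans (cong (suc (length W) +_) (length-map proj₂ p)) len)) ⟩
    (suc (length W) + length ms) * c
      ≡⟨ *-distribʳ-+ c (suc (length W)) (length ms) ⟩
    suc (length W) * c + length ms * c
      ≡⟨ cong (_+ length ms * c) (sym (*-assoc (suc (length W)) (length W !) _)) ⟩
    length (w ∷ W) ! * ∏ (λ n → (n ∸ length M) !) ns + length ms * c ∎)
    where
    open ≡-Reasoning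
    ms = map proj₂ p
    c = length W ! * ∏ (λ n → (n ∸ length M) !) ns
    term : Perms ns → Edge ns → ℕ
    term γ m = 𝟙 (maps? γ ((w , m) ∷ p)) * 𝟙 (into? M γ W)
    taken : ∀ {m} → m ∈ ms → ∑ (group ns) (λ γ → term γ m) ≡ 0
    taken m∈ with ∈-map⁻ proj₂ m∈
    ... | q , q∈ , refl = ∑-zero (group ns) λ {γ} γ∈ → cong (_* _) (𝟙-no (maps? γ ((w , _) ∷ p)) λ
      { (γw ∷ γp) → Disjoint⇒≢ {e = w} {proj₁ q} (dis (here refl) (∈-map⁺ proj₁ q∈)) (act-injective γ∈ (trans γw (sym (All.lookup γp q∈)))) })
    free : ∀ {m} → m ∈ M → m ∉ ms → ∑ (group ns) (λ γ → term γ m) ≡ c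
    free {m} m∈ m∉ = count-into′ mM le W ((w , m) ∷ p) mW
      (All.tabulate (dis (here refl)) ∷ m₁)
      (λ { {v} w∈ (here refl) → Disjoint-sym w v (All.lookup w# w∈) ; w∈ (there x∈) → dis (there w∈) x∈ })
      (All.tabulate (λ x∈ → matching-disjoint mM m∈ (sub x∈) λ { refl → m∉ x∈ }) ∷ m₂)
      (λ { (here refl) → m∈ ; (there x∈) → sub x∈ })
      (trans (+-suc (length W) (length p)) len)
    split : ∀ γ → 𝟙 (maps? γ p) * 𝟙 (into? M γ (w ∷ W)) ≡ ∑ M (term γ)
    split γ = case act γ w ∈? M of λ where
      (no γw∉) → trans (cong (𝟙 (maps? γ p) *_) (𝟙-no (into? M γ (w ∷ W)) λ { (a ∷ _) → γw∉ a })) (trans (*-zeroʳ (𝟙 (maps? γ p)))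
          (sym (∑-zero M λ {m} m∈ → cong (_* _) (𝟙-no (maps? γ ((w , m) ∷ p)) λ { (refl ∷ _) → γw∉ m∈ }))))
      (yes γw∈) → trans (cong₂ _*_
            (𝟙-cong (maps? γ p) (maps? γ ((w , act γ w) ∷ p)) (refl ∷_) (λ { (_ ∷ a) → a }))
            (𝟙-cong (into? M γ (w ∷ W)) (into? M γ W) (λ { (_ ∷ a) → a }) (γw∈ ∷_)))
          (sym (∑-single (term γ) (matching-unique mM) γw∈
             (λ {m} _ m≢ → cong (_* _) (𝟙-no (maps? γ ((w , m) ∷ p)) λ { (eq ∷ _) → m≢ (sym eq) }))))

  count-into : ∀ {M W} → IsMatching M → IsMatching W → length W ≡ length M → VAll (length M ≤_) ns →
    ∑ (group ns) (λ γ → 𝟙 (into? M γ W)) ≡ length M ! * ∏ (λ n → (n ∸ length M) !) ns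
  count-into {M} {W} mM mW len le = trans (∑-cong (group ns) (λ _ → sym (+-identityʳ _)))
    (trans (count-into′ mM le W [] mW [] (λ _ ()) [] (λ ()) (trans (+-identityʳ _) len))
           (cong (λ l → l ! * _) len))

  covers? : ∀ (e : Edge ns) (γ : Perms ns) W → Dec (Any (λ w → act γ w ≡ e) W)
  covers? e γ = Any.any? (λ w → act γ w ≟ᵉ e)

  count-cover : ∀ {W} (e : Edge ns) → IsMatching W → VAll (1 ≤_) ns →
    ∑ (group ns) (λ γ → 𝟙 (covers? e γ W)) ≡ length W * ∏ (λ n → (n ∸ 1) !) ns
  count-cover {W} e mW le = begin
    ∑ (group ns) (λ γ → 𝟙 (covers? e γ W))
      ≡⟨ ∑-cong (group ns) (λ {γ} γ∈ → split γ γ∈) ⟩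
    ∑ (group ns) (λ γ → ∑ W (λ w → 𝟙 (maps? γ ((w , e) ∷ []))))
      ≡⟨ ∑-swap (group ns) W (λ γ w → 𝟙 (maps? γ ((w , e) ∷ []))) ⟩
    ∑ W (λ w → ∑ (group ns) (λ γ → 𝟙 (maps? γ ((w , e) ∷ []))))
      ≡⟨ ∑-cong W (λ {w} _ → count-maps {ns = ns} ((w , e) ∷ []) ([] ∷ []) ([] ∷ []) le) ⟩
    ∑ W (λ _ → ∏ (λ n → (n ∸ 1) !) ns)
      ≡⟨ ∑-const W _ ⟩
    length W * ∏ (λ n → (n ∸ 1) !) ns ∎
    where
    open ≡-Reasoning
    split : ∀ γ → γ ∈ group ns → 𝟙 (covers? e γ W) ≡ ∑ W (λ w → 𝟙 (maps? γ ((w , e) ∷ [])))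
    split γ γ∈ = case covers? e γ W of λ where
      (no ¬c) → trans (𝟙-no (covers? e γ W) ¬c)
        (sym (∑-zero W λ {w} w∈ → 𝟙-no (maps? γ ((w , e) ∷ [])) λ { (eq ∷ []) → ¬c (lose w∈ eq) }))
      (yes c) → let w , w∈ , γw≡e = find c in trans (𝟙-yes (covers? e γ W) c) (sym (trans
        (∑-single _ (matching-unique mW) w∈ (λ {v} _ v≢w → 𝟙-no (maps? γ ((v , e) ∷ []))
          λ { (eq ∷ []) → v≢w (act-injective γ∈ (trans eq (sym γw≡e))) }))
        (𝟙-yes (maps? γ ((w , e) ∷ [])) (γw≡e ∷ []))))

  length-group : length (group ns) ≡ ∏ _! ns
  length-group = trans (sym (trans (∑-const (group ns) 1) (*-identityʳ _)))
    (count-maps {ns = ns} [] [] [] (VAll.universal (λ _ → z≤n) ns))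

-- Arithmetic modulo n

-- With `n = 1 + k`, adding `a * k` completes `a` to the multiple `a * n`; this replaces the
-- subtraction of `a`.
%-cancelˡ : ∀ a {y z} n .{{_ : NonZero n}} → (a + y) % n ≡ (a + z) % n → y % n ≡ z % n
%-cancelˡ a {y} {z} n@(suc k) eq = trans (sym (undo y)) (trans (trans (trans (%-distribˡ-+ (a + y) (a * k) n)
    (cong (λ r → (r + (a * k) % n) % n) eq)) (sym (%-distribˡ-+ (a + z) (a * k) n))) (undo z))
  where
  undo : ∀ y → (a + y + a * k) % n ≡ y % n
  undo y = trans (cong (_% n) (trans (cong (_+ a * k) (+-comm a y))
    (trans (+-assoc y a (a * k)) (cong (y +_) (sym (*-suc a k)))))) ([m+kn]%n≡m%n y a n)

%-cong-+ˡ : ∀ a {y z} n .{{_ : NonZero n}} → y % n ≡ z % n → (a + y) % n ≡ (a + z) % n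
%-cong-+ˡ a {y} {z} n eq = trans (%-distribˡ-+ a y n) (trans (cong (λ r → (a % n + r) % n) eq) (sym (%-distribˡ-+ a z n)))

infixl 6 _⊕_
_⊕_ : Fin n → Fin n → Fin n
_⊕_ {suc n} x y = (toℕ x + toℕ y) mod suc n

toℕ-mod : ∀ m n .{{_ : NonZero n}} → toℕ (m mod n) ≡ m % n
toℕ-mod m n = toℕ-fromℕ< (m%n<n m n)

toℕ-⊕ : ∀ (x y : Fin (suc n)) → toℕ (x ⊕ y) ≡ (toℕ x + toℕ y) % suc n
toℕ-⊕ {n} x y = toℕ-mod (toℕ x + toℕ y) (suc n)

⊕-cancelˡ : ∀ (x : Fin n) {y z} → x ⊕ y ≡ x ⊕ z → y ≡ z
⊕-cancelˡ {suc n} x {y} {z} eq = toℕ-injective (begin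
  toℕ y            ≡⟨ m<n⇒m%n≡m (toℕ<n y) ⟨
  toℕ y % suc n    ≡⟨ %-cancelˡ (toℕ x) {toℕ y} {toℕ z} (suc n) (trans (sym (toℕ-⊕ x y)) (trans (cong toℕ eq) (toℕ-⊕ x z))) ⟩
  toℕ z % suc n    ≡⟨ m<n⇒m%n≡m (toℕ<n z) ⟩
  toℕ z            ∎)
  where open ≡-Reasoning

⊕-comm : ∀ (x y : Fin n) → x ⊕ y ≡ y ⊕ x
⊕-comm {suc n} x y = cong (_mod suc n) (+-comm (toℕ x) (toℕ y))

⊕-cancelʳ : ∀ (x : Fin n) {y z} → y ⊕ x ≡ z ⊕ x → y ≡ z
⊕-cancelʳ x {y} {z} eq = ⊕-cancelˡ x (trans (⊕-comm x y) (trans eq (⊕-comm z x)))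

⊕-solve : ∀ (x y : Fin n) → ∃[ s ] x ⊕ s ≡ y
⊕-solve x = inj⇒surj (⊕-cancelˡ x)

⊕-zeroʳ : ∀ (x : Fin (suc n)) → x ⊕ zero ≡ x
⊕-zeroʳ {n} x = toℕ-injective (trans (toℕ-⊕ x zero) (trans (cong (_% suc n) (+-identityʳ (toℕ x))) (m<n⇒m%n≡m (toℕ<n x))))

-- This rigidity confines a switch to one coordinate: a row of a cyclic square with a fixed point is
-- the identity.
⊕-identity : ∀ {x s : Fin n} → x ⊕ s ≡ x → ∀ y → y ⊕ s ≡ y
⊕-identity {suc n} {x} eq y with refl ← ⊕-cancelˡ x (trans eq (sym (⊕-zeroʳ x))) = ⊕-zeroʳ y

-- Latin squares

record LatinSquare (n : ℕ) : Set where
  field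
    row          : Fin n → Fin n → Fin n
    row-inj      : ∀ s → Inj (row s)
    row-disjoint : ∀ {s t} x → row s x ≡ row t x → s ≡ t

open LatinSquare

cyclic : ∀ n → LatinSquare n
cyclic n .row s x = x ⊕ s
cyclic n .row-inj s = ⊕-cancelʳ s
cyclic n .row-disjoint x = ⊕-cancelˡ x

-- A Latin square used in one coordinate of a tuple γ ∈ S, with v = γ⁻¹u for some u ∈ S: a row of the resulting
-- partition that lies in S meets both γ and u, which leaves only the row (a b).
record Switch {n : ℕ} (a b : Fin n) (v : Fin n → Fin n) : Set where
  field
    square : LatinSquare n
    top    : Fin n
    row-top : ∀ x → row square top x ≡ transpose a b x
    avoids : ∀ s → s ≢ top → ∀ {x} → row square s x ≡ x → ∀ y → row square s y ≡ v y →
             (y ≡ a ⊎ y ≡ b) × row square s y ≡ y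

-- The obstruction to arranging the points other than `a` and `b` on a cycle through `c`: if `d` and
-- `e` are the only further ones and `v` exchanges them, then in either order one is followed by its
-- image.
record Blocked {n : ℕ} (a b c : Fin n) (v : Fin n → Fin n) : Set where
  field
    d e      : Fin n
    distinct : d ≢ a × d ≢ b × d ≢ c × e ≢ a × e ≢ b × e ≢ c × d ≢ e
    vd≡e     : v d ≡ e
    ve≡d     : v e ≡ d
    cover    : ∀ x → x ≡ a ⊎ x ≡ b ⊎ x ≡ c ⊎ x ≡ d ⊎ x ≡ e

-- Cyclic Latin squares bordered by two points

⊕-assoc : ∀ {n} (x y z : Fin n) → (x ⊕ y) ⊕ z ≡ x ⊕ (y ⊕ z)
⊕-assoc {suc n} x y z = toℕ-injective (begin
  toℕ (x ⊕ y ⊕ z)                      ≡⟨ toℕ-⊕ (x ⊕ y) z ⟩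
  (toℕ (x ⊕ y) + toℕ z) % suc n        ≡⟨ cong (λ r → (r + toℕ z) % suc n) (toℕ-⊕ x y) ⟩
  ((toℕ x + toℕ y) % suc n + toℕ z) % suc n ≡⟨ cong (_% suc n) (ℕ.+-comm ((toℕ x + toℕ y) % suc n) (toℕ z)) ⟩
  (toℕ z + (toℕ x + toℕ y) % suc n) % suc n ≡⟨ %-cong-+ˡ (toℕ z) {(toℕ x + toℕ y) % suc n} {toℕ x + toℕ y} (suc n) (m%n%n≡m%n (toℕ x + toℕ y) (suc n)) ⟩
  (toℕ z + (toℕ x + toℕ y)) % suc n    ≡⟨ cong (_% suc n) (trans (ℕ.+-comm (toℕ z) _) (ℕ.+-assoc (toℕ x) (toℕ y) (toℕ z))) ⟩
  (toℕ x + (toℕ y + toℕ z)) % suc n    ≡⟨ %-cong-+ˡ (toℕ x) {(toℕ y + toℕ z) % suc n} {toℕ y + toℕ z} (suc n) (m%n%n≡m%n (toℕ y + toℕ z) (suc n)) ⟨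
  (toℕ x + (toℕ y + toℕ z) % suc n) % suc n ≡⟨ cong (λ r → (toℕ x + r) % suc n) (toℕ-⊕ y z) ⟨
  (toℕ x + toℕ (y ⊕ z)) % suc n        ≡⟨ toℕ-⊕ x (y ⊕ z) ⟨
  toℕ (x ⊕ (y ⊕ z))                    ∎)
  where open ≡-Reasoning

-- With ψ δ = χ δ - δ, this is what is needed to border a cyclic square on ℤ/(2 + m) by two further points ∞₀ and ∞₁:
-- row i is the translate by i of χ, with 0 and κ sent to the new points.
record NearOrthomorphism (m : ℕ) : Set where
  field
    χ     : Fin (2 + m) → Fin (2 + m)
    χ-inj : Inj χ
    κ     : Fin (2 + m)
    κ≢0   : κ ≢ 0F
    ψ     : Fin (2 + m) → Fin (2 + m)
    ψ-eq  : ∀ {δ} → δ ≢ 0F → δ ≢ κ → δ ⊕ ψ δ ≡ χ δ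
    ψ-inj : ∀ {δ ε} → δ ≢ 0F → δ ≢ κ → ε ≢ 0F → ε ≢ κ → ψ δ ≡ ψ ε → δ ≡ ε
    ψ≢0   : ∀ {δ} → δ ≢ 0F → δ ≢ κ → ψ δ ≢ 0F
    ψ≢1   : ∀ {δ} → δ ≢ 0F → δ ≢ κ → ψ δ ≢ 1F

module Bordered {m : ℕ} (O : NearOrthomorphism m) where
  open NearOrthomorphism O

  pattern ∞₀ = zero
  pattern ∞₁ = suc zero
  pattern ↑_ j = suc (suc j)

  _⊖_ : Fin (2 + m) → Fin (2 + m) → Fin (2 + m)
  j ⊖ i = proj₁ (⊕-solve i j)

  ⊕-⊖ : ∀ i j → i ⊕ (j ⊖ i) ≡ j
  ⊕-⊖ i j = proj₂ (⊕-solve i j)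

  data Cell (δ : Fin (2 + m)) : Set where
    first  : δ ≡ 0F → Cell δ
    second : δ ≡ κ → Cell δ
    other  : δ ≢ 0F → δ ≢ κ → Cell δ

  cell : ∀ δ → Cell δ
  cell δ with δ ≟ 0F | δ ≟ κ
  ... | yes δ≡0 | _       = first δ≡0
  ... | no _    | yes δ≡κ = second δ≡κ
  ... | no δ≢0  | no δ≢κ  = other δ≢0 δ≢κ

  entry : ∀ i {δ} → Cell δ → Fin (2 + (2 + m))
  entry i     (first _)   = ∞₀
  entry i     (second _)  = ∞₁
  entry i {δ} (other _ _) = ↑ (i ⊕ χ δ)

  -- Row `∞₀` is the transposition of the new points, row `∞₁` fixes them and shifts the others by
  -- one. In column `↑ j` these rows use up the symbols `j` and `j ⊕ 1F`, which is why `ψ` must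
  -- avoid 0 and 1. Between them they have a fixed point in every column, so no further row has any.
  line : Fin (2 + (2 + m)) → Fin (2 + (2 + m)) → Fin (2 + (2 + m))
  line ∞₀    ∞₀    = ∞₁
  line ∞₀    ∞₁    = ∞₀
  line ∞₀    (↑ j) = ↑ j
  line ∞₁    ∞₀    = ∞₀
  line ∞₁    ∞₁    = ∞₁
  line ∞₁    (↑ j) = ↑ (j ⊕ 1F)
  line (↑ i) ∞₀    = ↑ (i ⊕ χ 0F)
  line (↑ i) ∞₁    = ↑ (i ⊕ χ κ)
  line (↑ i) (↑ j) = entry i (cell (j ⊖ i))

  ↑-inj : ∀ {n} {x y : Fin n} → _≡_ {A = Fin (2 + n)} (↑ x) (↑ y) → x ≡ y
  ↑-inj = suc-injective ∘ suc-injective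

  ⊖-inj : ∀ i {j j′} → j ⊖ i ≡ j′ ⊖ i → j ≡ j′
  ⊖-inj i {j} {j′} eq = trans (sym (⊕-⊖ i j)) (trans (cong (i ⊕_) eq) (⊕-⊖ i j′))

  ⊖-injʳ : ∀ j {i i′} → j ⊖ i ≡ j ⊖ i′ → i ≡ i′
  ⊖-injʳ j {i} {i′} eq = ⊕-cancelʳ (j ⊖ i) (trans (⊕-⊖ i j) (sym (trans (cong (i′ ⊕_) eq) (⊕-⊖ i′ j))))

  entry-inj : ∀ i {δ ε} (c : Cell δ) (c′ : Cell ε) → entry i c ≡ entry i c′ → δ ≡ ε
  entry-inj i (first p)    (first q)    _  = trans p (sym q)
  entry-inj i (second p)   (second q)   _  = trans p (sym q)
  entry-inj i (other _ _)  (other _ _)  eq = χ-inj (⊕-cancelˡ i (↑-inj eq))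

  entry≢χ0 : ∀ i {δ} (c : Cell δ) → entry i c ≢ ↑ (i ⊕ χ 0F)
  entry≢χ0 i (other δ≢0 _) eq = δ≢0 (χ-inj (⊕-cancelˡ i (↑-inj eq)))

  entry≢χk : ∀ i {δ} (c : Cell δ) → entry i c ≢ ↑ (i ⊕ χ κ)
  entry≢χk i (other _ δ≢κ) eq = δ≢κ (χ-inj (⊕-cancelˡ i (↑-inj eq)))

  χ0≢χk : ∀ i → i ⊕ χ 0F ≢ i ⊕ χ κ
  χ0≢χk i eq = κ≢0 (sym (χ-inj (⊕-cancelˡ i eq)))

  line-inj : ∀ s → Inj (line s)
  line-inj ∞₀    {∞₀}  {∞₀}   _  = refl
  line-inj ∞₀    {∞₀}  {∞₁}   ()
  line-inj ∞₀    {∞₀}  {↑ _}  ()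
  line-inj ∞₀    {∞₁}  {∞₁}   _  = refl
  line-inj ∞₀    {↑ _} {↑ _}  eq = eq
  line-inj ∞₁    {∞₀}  {∞₀}   _  = refl
  line-inj ∞₁    {∞₀}  {∞₁}   ()
  line-inj ∞₁    {∞₀}  {↑ _}  ()
  line-inj ∞₁    {∞₁}  {∞₁}   _  = refl
  line-inj ∞₁    {↑ _} {↑ _}  eq = cong ↑_ (⊕-cancelʳ 1F (↑-inj eq))
  line-inj (↑ i) {∞₀}  {∞₀}   _  = refl
  line-inj (↑ i) {∞₀}  {∞₁}   eq = contradiction (↑-inj eq) (χ0≢χk i)
  line-inj (↑ i) {∞₀}  {↑ j}  eq = contradiction (sym eq) (entry≢χ0 i (cell (j ⊖ i)))
  line-inj (↑ i) {∞₁}  {∞₀}   eq = contradiction (↑-inj (sym eq)) (χ0≢χk i)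
  line-inj (↑ i) {∞₁}  {∞₁}   _  = refl
  line-inj (↑ i) {∞₁}  {↑ j}  eq = contradiction (sym eq) (entry≢χk i (cell (j ⊖ i)))
  line-inj (↑ i) {↑ j} {∞₀}   eq = contradiction eq (entry≢χ0 i (cell (j ⊖ i)))
  line-inj (↑ i) {↑ j} {∞₁}   eq = contradiction eq (entry≢χk i (cell (j ⊖ i)))
  line-inj (↑ i) {↑ j} {↑ j′} eq = cong ↑_ (⊖-inj i (entry-inj i (cell (j ⊖ i)) (cell (j′ ⊖ i)) eq))

  -- The passage from the row view to the column view: within a row the entries are kept apart by
  -- `χ`, within a column by `ψ`.
  symbol : ∀ i j → j ⊖ i ≢ 0F → j ⊖ i ≢ κ → i ⊕ χ (j ⊖ i) ≡ j ⊕ ψ (j ⊖ i)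
  symbol i j ≢0 ≢κ = trans (cong (i ⊕_) (sym (ψ-eq ≢0 ≢κ)))
    (trans (sym (⊕-assoc i (j ⊖ i) (ψ (j ⊖ i)))) (cong (_⊕ ψ (j ⊖ i)) (⊕-⊖ i j)))

  entry-disjoint : ∀ j {i i′} (c : Cell (j ⊖ i)) (c′ : Cell (j ⊖ i′)) → entry i c ≡ entry i′ c′ → j ⊖ i ≡ j ⊖ i′
  entry-disjoint j (first p)     (first q)     _  = trans p (sym q)
  entry-disjoint j (second p)    (second q)    _  = trans p (sym q)
  entry-disjoint j {i} {i′} (other ≢0 ≢κ) (other ≢0′ ≢κ′) eq =
    ψ-inj ≢0 ≢κ ≢0′ ≢κ′ (⊕-cancelˡ j (trans (sym (symbol i j ≢0 ≢κ)) (trans (↑-inj eq) (symbol i′ j ≢0′ ≢κ′))))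

  entry≢0 : ∀ i j (c : Cell (j ⊖ i)) → entry i c ≢ ↑ j
  entry≢0 i j (other ≢0 ≢κ) eq = ψ≢0 ≢0 ≢κ (⊕-cancelˡ j (trans (sym (symbol i j ≢0 ≢κ)) (trans (↑-inj eq) (sym (⊕-zeroʳ j)))))

  entry≢1 : ∀ i j (c : Cell (j ⊖ i)) → entry i c ≢ ↑ (j ⊕ 1F)
  entry≢1 i j (other ≢0 ≢κ) eq = ψ≢1 ≢0 ≢κ (⊕-cancelˡ j (trans (sym (symbol i j ≢0 ≢κ)) (↑-inj eq)))

  j≢j⊕1 : ∀ j → j ≢ j ⊕ 1F
  j≢j⊕1 j eq = 0≢1 (⊕-cancelˡ j (trans (⊕-zeroʳ j) eq))
    where
    0≢1 : _≢_ {A = Fin (2 + m)} 0F 1F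
    0≢1 ()

  line-disjoint : ∀ {s t} x → line s x ≡ line t x → s ≡ t
  line-disjoint {∞₀}  {∞₀}  _     _  = refl
  line-disjoint {∞₁}  {∞₁}  _     _  = refl
  line-disjoint {∞₀}  {∞₁}  ∞₀    ()
  line-disjoint {∞₀}  {∞₁}  ∞₁    ()
  line-disjoint {∞₀}  {∞₁}  (↑ j) eq = contradiction (↑-inj {2 + m} eq) (j≢j⊕1 j)
  line-disjoint {∞₁}  {∞₀}  ∞₀    ()
  line-disjoint {∞₁}  {∞₀}  ∞₁    ()
  line-disjoint {∞₁}  {∞₀}  (↑ j) eq = contradiction (↑-inj {2 + m} (sym eq)) (j≢j⊕1 j)
  line-disjoint {∞₀}  {↑ i} ∞₀    ()
  line-disjoint {∞₀}  {↑ i} ∞₁    ()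
  line-disjoint {∞₀}  {↑ i} (↑ j) eq = contradiction (sym eq) (entry≢0 i j (cell (j ⊖ i)))
  line-disjoint {∞₁}  {↑ i} ∞₀    ()
  line-disjoint {∞₁}  {↑ i} ∞₁    ()
  line-disjoint {∞₁}  {↑ i} (↑ j) eq = contradiction (sym eq) (entry≢1 i j (cell (j ⊖ i)))
  line-disjoint {↑ i} {∞₀}  ∞₀    ()
  line-disjoint {↑ i} {∞₀}  ∞₁    ()
  line-disjoint {↑ i} {∞₀}  (↑ j) eq = contradiction eq (entry≢0 i j (cell (j ⊖ i)))
  line-disjoint {↑ i} {∞₁}  ∞₀    ()
  line-disjoint {↑ i} {∞₁}  ∞₁    ()
  line-disjoint {↑ i} {∞₁}  (↑ j) eq = contradiction eq (entry≢1 i j (cell (j ⊖ i)))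
  line-disjoint {↑ i} {↑ i′} ∞₀    eq = cong ↑_ (⊕-cancelʳ (χ 0F) (↑-inj eq))
  line-disjoint {↑ i} {↑ i′} ∞₁    eq = cong ↑_ (⊕-cancelʳ (χ κ) (↑-inj eq))
  line-disjoint {↑ i} {↑ i′} (↑ j) eq = cong ↑_ (⊖-injʳ j (entry-disjoint j (cell (j ⊖ i)) (cell (j ⊖ i′)) eq))

  bordered : LatinSquare (2 + (2 + m))
  bordered = record { row = line ; row-inj = line-inj ; row-disjoint = line-disjoint }

-- A near-orthomorphism for every order

data Halves : ℕ → Set where
  even : ∀ h → Halves (h + h)
  odd  : ∀ h → Halves (suc (h + h))

halves : ∀ m → Halves m
halves zero = even 0
halves (suc m) with halves m
... | even h = odd h
... | odd h  = subst Halves (cong suc (+-suc h h)) (even (suc h))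

double-injective : ∀ a b → a + a ≡ b + b → a ≡ b
double-injective zero    zero    _  = refl
double-injective (suc a) (suc b) eq = cong suc (double-injective a b (ℕ.suc-injective (ℕ.suc-injective
  (trans (cong suc (sym (+-suc a a))) (trans eq (cong suc (+-suc b b)))))))

odd≢even : ∀ a b → suc (a + a) ≢ b + b
odd≢even a       zero    ()
odd≢even zero    (suc b) eq with trans eq (cong suc (+-suc b b))
... | ()
odd≢even (suc a) (suc b) eq = odd≢even a b (ℕ.suc-injective (ℕ.suc-injective
  (trans (cong (λ z → suc (suc z)) (sym (+-suc a a))) (trans eq (cong suc (+-suc b b))))))

-- The perfect shuffle of [0, m) with h = ⌊m/2⌋.
shuffle : ℕ → ℕ → ℕ
shuffle h δ with δ <? h
... | yes _ = suc (δ + δ)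
... | no _  = (δ ∸ h) + (δ ∸ h)

shuffle-inj : ∀ h {δ ε} → shuffle h δ ≡ shuffle h ε → δ ≡ ε
shuffle-inj h {δ} {ε} eq with δ <? h | ε <? h
... | yes _ | yes _ = double-injective δ ε (ℕ.suc-injective eq)
... | yes _ | no _  = contradiction eq (odd≢even δ (ε ∸ h))
... | no _  | yes _ = contradiction (sym eq) (odd≢even ε (δ ∸ h))
... | no δ≮h | no ε≮h = ∸-cancelʳ-≡ (≮⇒≥ δ≮h) (≮⇒≥ ε≮h) (double-injective (δ ∸ h) (ε ∸ h) eq)

shuffle-low : ∀ {h δ} → δ < h → shuffle h δ ≡ suc (δ + δ)
shuffle-low {h} {δ} lt with δ <? h
... | yes _ = refl
... | no ≮  = contradiction lt ≮

shuffle-high : ∀ h t → shuffle h (h + t) ≡ t + t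
shuffle-high h t with (h + t) <? h
... | yes lt = contradiction (≤-trans lt (m≤m+n h t)) (<-irrefl refl)
... | no _   = cong₂ _+_ (ℕ.m+n∸m≡n h t) (ℕ.m+n∸m≡n h t)

low⊎high : ∀ h δ → δ < h ⊎ ∃[ t ] δ ≡ h + t
low⊎high h δ with δ <? h
... | yes lt = inj₁ lt
... | no ≮   = inj₂ (δ ∸ h , sym (m+[n∸m]≡n (≮⇒≥ ≮)))

double< : ∀ {a b} → a < b → suc (a + a) < b + b
double< {a} {b} lt = ≤-trans (s≤s (ℕ.≤-reflexive (sym (+-suc a a)))) (+-mono-≤ lt lt)

interchange : ∀ h t → (h + t) + (h + t) ≡ (t + t) + (h + h)
interchange h t = trans (cong₂ _+_ (+-comm h t) (+-comm h t))
  (trans (ℕ.+-assoc t h (t + h)) (trans (cong (t +_) (trans (cong (h +_) (+-comm t h))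
    (trans (sym (ℕ.+-assoc h h t)) (+-comm (h + h) t)))) (sym (ℕ.+-assoc t t (h + h)))))

-- The differences are given by representatives above 1 and below `2 + m`. Then size alone excludes
-- the residues 0 and 1, and injectivity can be checked in ℕ.
build : ∀ m (h k : ℕ) (ψℕ : ℕ → ℕ) → (∀ {δ} → δ < 2 + m → shuffle h δ < 2 + m) → k < 2 + m → k ≢ 0 →
  (∀ {δ} → δ < 2 + m → δ ≢ 0 → δ ≢ k → (δ + ψℕ δ) % (2 + m) ≡ shuffle h δ × 1 < ψℕ δ × ψℕ δ < 2 + m) →
  (∀ {δ ε} → δ ≢ 0 → δ ≢ k → ε ≢ 0 → ε ≢ k → ψℕ δ ≡ ψℕ ε → δ ≡ ε) →
  NearOrthomorphism m
build m h k ψℕ χ< k< k≢0 ψ-prop ψ-inj = record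
  { χ = χ
  ; χ-inj = λ {x} {y} eq → toℕ-injective (shuffle-inj h (trans (sym (toℕ-χ x)) (trans (cong toℕ eq) (toℕ-χ y))))
  ; κ = k mod (2 + m)
  ; κ≢0 = λ eq → k≢0 (trans (sym toℕ-k) (cong toℕ eq))
  ; ψ = ψ
  ; ψ-eq = λ {δ} ≢0 ≢k → toℕ-injective (trans (toℕ-⊕ δ (ψ δ)) (trans (cong (λ r → (toℕ δ + r) % (2 + m)) (toℕ-ψ ≢0 ≢k))
             (trans (proj₁ (prop ≢0 ≢k)) (sym (toℕ-χ δ)))))
  ; ψ-inj = λ ≢0 ≢k ≢0′ ≢k′ eq → toℕ-injective (ψ-inj (off0 ≢0) (offk ≢k) (off0 ≢0′) (offk ≢k′)
             (trans (sym (toℕ-ψ ≢0 ≢k)) (trans (cong toℕ eq) (toℕ-ψ ≢0′ ≢k′))))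
  ; ψ≢0 = λ ≢0 ≢k eq → <⇒≢ (≤-trans (s≤s z≤n) (proj₁ (proj₂ (prop ≢0 ≢k)))) (sym (trans (sym (toℕ-ψ ≢0 ≢k)) (cong toℕ eq)))
  ; ψ≢1 = λ ≢0 ≢k eq → <⇒≢ (proj₁ (proj₂ (prop ≢0 ≢k))) (sym (trans (sym (toℕ-ψ ≢0 ≢k)) (cong toℕ eq)))
  }
  where
  χ ψ : Fin (2 + m) → Fin (2 + m)
  χ δ = shuffle h (toℕ δ) mod (2 + m)
  ψ δ = ψℕ (toℕ δ) mod (2 + m)
  toℕ-χ : ∀ δ → toℕ (χ δ) ≡ shuffle h (toℕ δ)
  toℕ-χ δ = trans (toℕ-mod (shuffle h (toℕ δ)) (2 + m)) (m<n⇒m%n≡m (χ< (toℕ<n δ)))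
  toℕ-k : toℕ (k mod (2 + m)) ≡ k
  toℕ-k = trans (toℕ-mod k (2 + m)) (m<n⇒m%n≡m k<)
  off0 : ∀ {δ : Fin (2 + m)} → δ ≢ 0F → toℕ δ ≢ 0
  off0 ≢0 eq = ≢0 (toℕ-injective eq)
  offk : ∀ {δ : Fin (2 + m)} → δ ≢ k mod (2 + m) → toℕ δ ≢ k
  offk ≢k eq = ≢k (toℕ-injective (trans eq (sym toℕ-k)))
  prop : ∀ {δ} → δ ≢ 0F → δ ≢ k mod (2 + m) → _
  prop {δ} ≢0 ≢k = ψ-prop (toℕ<n δ) (off0 ≢0) (offk ≢k)
  toℕ-ψ : ∀ {δ} → δ ≢ 0F → δ ≢ k mod (2 + m) → toℕ (ψ δ) ≡ ψℕ (toℕ δ)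
  toℕ-ψ {δ} ≢0 ≢k = trans (toℕ-mod (ψℕ (toℕ δ)) (2 + m)) (m<n⇒m%n≡m (proj₂ (proj₂ (prop ≢0 ≢k))))

-- For order 2h + 1 the shuffle is 2δ + 1, so `ψ` is δ + 1; it takes the forbidden value 1 at 0 and
-- wraps to 0 at 2h, whence `κ` = 2h. For order 2h the shuffle is 2δ + 1 below h and 2δ from h on,
-- so `ψ` is δ + 1 and then δ; the value h occurs both at h - 1 and at h, whence `κ` = h.
nearOrthomorphism : ∀ m → NearOrthomorphism m
nearOrthomorphism m = go (halves (2 + m)) refl
  where
  go : ∀ {n} → Halves n → n ≡ 2 + m → NearOrthomorphism m
  go (odd zero) ()
  go (even zero) ()
  go (odd h@(suc h′)) eq = build m h (h + h) suc χ< k< (λ ()) ψ-prop (λ _ _ _ _ → ℕ.suc-injective)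
    where
    χ< : ∀ {δ} → δ < 2 + m → shuffle h δ < 2 + m
    χ< {δ} lt with low⊎high h δ
    ... | inj₁ δ<h = subst₂ _<_ (sym (shuffle-low δ<h)) eq (ℕ.m<n⇒m<1+n (double< δ<h))
    ... | inj₂ (t , refl) = subst₂ _<_ (sym (shuffle-high h t)) eq (s≤s (+-mono-≤ t≤h t≤h))
      where
      t≤h : t ≤ h
      t≤h = ℕ.+-cancelˡ-≤ h t h (s≤s⁻¹ (≤-trans lt (ℕ.≤-reflexive (sym eq))))
    k< : h + h < 2 + m
    k< = ℕ.≤-reflexive eq
    ψ-prop : ∀ {δ} → δ < 2 + m → δ ≢ 0 → δ ≢ h + h → (δ + suc δ) % (2 + m) ≡ shuffle h δ × 1 < suc δ × suc δ < 2 + m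
    ψ-prop {δ} lt ≢0 ≢k = residue , s≤s (ℕ.n≢0⇒n>0 ≢0) ,
      ≤-trans (s≤s (ℕ.≤∧≢⇒< (s≤s⁻¹ (≤-trans lt (ℕ.≤-reflexive (sym eq)))) ≢k)) (ℕ.≤-reflexive eq)
      where
      residue : (δ + suc δ) % (2 + m) ≡ shuffle h δ
      residue with low⊎high h δ
      ... | inj₁ δ<h = trans (cong (_% (2 + m)) (trans (+-suc δ δ) (sym (shuffle-low δ<h)))) (m<n⇒m%n≡m (χ< lt))
      ... | inj₂ (t , refl) = trans (cong (_% (2 + m)) (trans (+-suc (h + t) (h + t))
              (trans (cong suc (interchange h t)) (trans (sym (+-suc (t + t) (h + h))) (cong₂ _+_ (sym (shuffle-high h t)) eq)))))
              (trans ([m+n]%n≡m%n (shuffle h (h + t)) (2 + m)) (m<n⇒m%n≡m (χ< lt)))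
  go (even h@(suc h′)) eq = build m h h ψℕ χ< k< (λ ()) ψ-prop ψ-inj
    where
    ψℕ : ℕ → ℕ
    ψℕ δ with δ <? h
    ... | yes _ = suc δ
    ... | no _  = δ
    ψ-low : ∀ {δ} → δ < h → ψℕ δ ≡ suc δ
    ψ-low {δ} lt with δ <? h
    ... | yes _ = refl
    ... | no ≮  = contradiction lt ≮
    ψ-high : ∀ t → ψℕ (h + t) ≡ h + t
    ψ-high t with (h + t) <? h
    ... | yes lt = contradiction (≤-trans lt (m≤m+n h t)) (<-irrefl refl)
    ... | no _   = refl
    t<h : ∀ t → h + t < 2 + m → t < h
    t<h t lt = +-cancelˡ-< h t h (≤-trans lt (ℕ.≤-reflexive (sym eq)))
    χ< : ∀ {δ} → δ < 2 + m → shuffle h δ < 2 + m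
    χ< {δ} lt with low⊎high h δ
    ... | inj₁ δ<h = subst₂ _<_ (sym (shuffle-low δ<h)) eq (double< δ<h)
    ... | inj₂ (t , refl) = subst₂ _<_ (sym (shuffle-high h t)) eq (+-mono-< (t<h t lt) (t<h t lt))
    k< : h < 2 + m
    k< = ≤-trans (s≤s (m≤n+m h h′)) (ℕ.≤-reflexive eq)
    ψ-prop : ∀ {δ} → δ < 2 + m → δ ≢ 0 → δ ≢ h → (δ + ψℕ δ) % (2 + m) ≡ shuffle h δ × 1 < ψℕ δ × ψℕ δ < 2 + m
    ψ-prop {δ} lt ≢0 ≢k with low⊎high h δ
    ... | inj₁ δ<h = trans (cong (_% (2 + m)) (trans (cong (δ +_) (ψ-low δ<h)) (trans (+-suc δ δ) (sym (shuffle-low δ<h))))) (m<n⇒m%n≡m (χ< lt))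
        , subst (1 <_) (sym (ψ-low δ<h)) (s≤s (ℕ.n≢0⇒n>0 ≢0))
        , subst (_< 2 + m) (sym (ψ-low δ<h)) (≤-trans (s≤s δ<h) k<)
    ... | inj₂ (t , refl) = trans (cong (_% (2 + m)) (trans (cong (h + t +_) (ψ-high t)) (trans (interchange h t) (cong₂ _+_ (sym (shuffle-high h t)) eq))))
            (trans ([m+n]%n≡m%n (shuffle h (h + t)) (2 + m)) (m<n⇒m%n≡m (χ< lt)))
        , subst (1 <_) (sym (ψ-high t)) (≤-trans (s≤s (ℕ.n≢0⇒n>0 {t} λ { refl → ≢k (+-identityʳ h) })) (ℕ.≤-trans (ℕ.m≤n+m (suc t) h′) (ℕ.≤-reflexive (+-suc h′ t))))
        , subst (_< 2 + m) (sym (ψ-high t)) lt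
    ψ-inj : ∀ {δ ε} → δ ≢ 0 → δ ≢ h → ε ≢ 0 → ε ≢ h → ψℕ δ ≡ ψℕ ε → δ ≡ ε
    ψ-inj {δ} {ε} _ δ≢h _ ε≢h e with low⊎high h δ | low⊎high h ε
    ... | inj₁ δ<h | inj₁ ε<h = ℕ.suc-injective (trans (sym (ψ-low δ<h)) (trans e (ψ-low ε<h)))
    ... | inj₂ (t , refl) | inj₂ (t′ , refl) = trans (sym (ψ-high t)) (trans e (ψ-high t′))
    ... | inj₁ δ<h | inj₂ (t , refl) = contradiction (ℕ.≤-antisym (≤-trans (ℕ.≤-reflexive (trans (sym (ψ-high t)) (trans (sym e) (ψ-low δ<h)))) δ<h) (m≤m+n h t)) ε≢h
    ... | inj₂ (t , refl) | inj₁ ε<h = contradiction (ℕ.≤-antisym (≤-trans (ℕ.≤-reflexive (trans (sym (ψ-high t)) (trans e (ψ-low ε<h)))) ε<h) (m≤m+n h t)) δ≢h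

-- Orders in which no point is followed by its image

lookup-unique : ∀ {xs : List A} → Unique xs → ∀ {i j} → List.lookup xs i ≡ List.lookup xs j → i ≡ j
lookup-unique {xs = x ∷ xs} u         {zero}  {zero}  _  = refl
lookup-unique {xs = x ∷ xs} u         {zero}  {suc j} eq = contradiction (subst (_∈ xs) (sym eq) (∈-lookup j)) (Unique[x∷xs]⇒x∉xs u)
lookup-unique {xs = x ∷ xs} u         {suc i} {zero}  eq = contradiction (subst (_∈ xs) eq (∈-lookup i)) (Unique[x∷xs]⇒x∉xs u)
lookup-unique {xs = x ∷ xs} (_ ∷ uxs) {suc i} {suc j} eq = cong suc (lookup-unique uxs eq)

Unique-resp-↭ : ∀ {xs ys : List A} → xs ↭ ys → Unique xs → Unique ys
Unique-resp-↭ p = Setoid↭.Unique-resp-↭ (setoid _) (↭⇒↭ₛ p)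

lookup-linked : ∀ {R : A → A → Set} {xs} → Linkedˡ R xs → ∀ i j → toℕ j ≡ suc (toℕ i) → R (List.lookup xs i) (List.lookup xs j)
lookup-linked (r ∷ l)  zero    (suc zero) eq = r
lookup-linked (r ∷ l)  (suc i) (suc j)    eq = lookup-linked l i j (ℕ.suc-injective eq)

module _ {n : ℕ} {v : Fin n → Fin n} (v-inj : Inj v) where

  Follows : Fin n → Fin n → Set
  Follows x y = v x ≢ y

  Chain : List (Fin n) → Set
  Chain xs = ∃[ ys ] (ys ↭ xs × Linkedˡ Follows ys)

  -- One of the first three places is always free. If `v z` is `x`, then `z` can be followed by
  -- anything but `x`; if also `v x` is `z`, then injectivity allows `z` to follow `y`. A chain of a
  -- single point is excluded, as `v` might exchange it with `z`.
  insert : ∀ z {xs} → Unique (z ∷ xs) → length xs ≢ 1 → Linkedˡ Follows xs → Chain (z ∷ xs)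
  insert z {[]} _ _ _ = z ∷ [] , ↭-refl , [-]
  insert z {_ ∷ []} _ ≢1 _ = contradiction refl ≢1
  insert z {x ∷ y ∷ t} ((_ ∷ z≢y ∷ z∉t) ∷ (x≢y ∷ x∉t) ∷ (y∉t ∷ _)) _ (xy ∷ l) with v z ≟ x
  ... | no vz≢x = z ∷ x ∷ y ∷ t , ↭-refl , vz≢x ∷ xy ∷ l
  ... | yes vz≡x with v x ≟ z
  ...   | no vx≢z = x ∷ z ∷ y ∷ t , swap x z ↭-refl , vx≢z ∷ (λ vz≡y → x≢y (trans (sym vz≡x) vz≡y)) ∷ l
  ...   | yes vx≡z = x ∷ y ∷ z ∷ t , ↭-trans (prep x (swap y z ↭-refl)) (swap x z ↭-refl)
                   , xy ∷ (λ vy≡z → x≢y (v-inj (trans vx≡z (sym vy≡z)))) ∷ tail x∉t l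
    where
    tail : ∀ {t} → All (x ≢_) t → Linkedˡ Follows (y ∷ t) → Linkedˡ Follows (z ∷ t)
    tail []        _       = [-]
    tail (x≢w ∷ _) (_ ∷ l) = (λ vz≡w → x≢w (trans (sym vz≡x) vz≡w)) ∷ l

  insert-chain : ∀ z {xs} → Unique (z ∷ xs) → length xs ≢ 1 → Chain xs → Chain (z ∷ xs)
  insert-chain z (z∉ ∷ u) ≢1 (ys , p , l) =
    let zs , q , l′ = insert z (All-resp-↭ (↭-sym p) z∉ ∷ Unique-resp-↭ (↭-sym p) u) (≢1 ∘ trans (sym (↭-length p))) l
    in zs , ↭-trans q (prep z p) , l′

  chain : ∀ xs → Unique xs → length xs ≢ 2 → Chain xs
  chain []           _ _ = [] , ↭-refl , []
  chain (x ∷ [])     _ _ = x ∷ [] , ↭-refl , [-]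
  chain (x ∷ y ∷ []) _ ≢2 = contradiction refl ≢2
  chain (x ∷ y ∷ z ∷ []) ((x≢y ∷ x≢z ∷ []) ∷ (y≢z ∷ []) ∷ [] ∷ []) _ with v y ≟ z | v z ≟ y
  ... | no vy≢z  | _ = insert-chain x ((x≢y ∷ x≢z ∷ []) ∷ (y≢z ∷ []) ∷ [] ∷ []) (λ ()) (y ∷ z ∷ [] , ↭-refl , vy≢z ∷ [-])
  ... | yes _    | no vz≢y = insert-chain x ((x≢y ∷ x≢z ∷ []) ∷ (y≢z ∷ []) ∷ [] ∷ []) (λ ()) (z ∷ y ∷ [] , swap z y ↭-refl , vz≢y ∷ [-])
  -- Neither order of `y` and `z` is a chain. But `v z` is `y`, so `v x` is not, and `z` can be
  -- inserted into `x`, `y`.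
  ... | yes vy≡z | yes vz≡y =
    let ys , p , l = insert z {x ∷ y ∷ []} ((x≢z ∘ sym ∷ y≢z ∘ sym ∷ []) ∷ (x≢y ∷ []) ∷ [] ∷ []) (λ ())
                       ((λ vx≡y → x≢z (v-inj (trans vx≡y (sym vz≡y)))) ∷ [-])
    in ys , ↭-trans p (↭-sym (shift z (x ∷ y ∷ []) [])) , l
  chain (x ∷ xs@(_ ∷ _ ∷ _ ∷ _)) u@(_ ∷ uxs) _ = insert-chain x u (λ ()) (chain xs uxs (λ ()))

-- Transport of Latin squares along labellings

module Relabel {N n : ℕ} (N≡n : N ≡ n) (ℓ : Fin N → Fin n) (ℓ-inj : Inj ℓ) where

  ℓ-surj : ∀ x → ∃[ i ] ℓ i ≡ x
  ℓ-surj = surj N≡n ℓ ℓ-inj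
    where
    surj : ∀ {N n} → N ≡ n → (ℓ : Fin N → Fin n) → Inj ℓ → ∀ x → ∃[ i ] ℓ i ≡ x
    surj refl ℓ = inj⇒surj

  ℓ⁻¹ : Fin n → Fin N
  ℓ⁻¹ x = proj₁ (ℓ-surj x)

  ℓℓ⁻¹ : ∀ x → ℓ (ℓ⁻¹ x) ≡ x
  ℓℓ⁻¹ x = proj₂ (ℓ-surj x)

  ℓ⁻¹ℓ : ∀ i → ℓ⁻¹ (ℓ i) ≡ i
  ℓ⁻¹ℓ i = ℓ-inj (ℓℓ⁻¹ (ℓ i))

  ℓ⁻¹-inj : Inj ℓ⁻¹
  ℓ⁻¹-inj {x} {y} eq = trans (sym (ℓℓ⁻¹ x)) (trans (cong ℓ eq) (ℓℓ⁻¹ y))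

  relabel : LatinSquare N → LatinSquare n
  relabel L .row s x          = ℓ (row L (ℓ⁻¹ s) (ℓ⁻¹ x))
  relabel L .row-inj s eq     = ℓ⁻¹-inj (row-inj L (ℓ⁻¹ s) (ℓ-inj eq))
  relabel L .row-disjoint x eq = ℓ⁻¹-inj (row-disjoint L (ℓ⁻¹ x) (ℓ-inj eq))

  relabel-switch : ∀ {v : Fin n → Fin n} (L : LatinSquare N) (t a b : Fin N) →
    (∀ i → row L t i ≡ transpose a b i) →
    (∀ s → s ≢ t → ∀ {i} → row L s i ≡ i → ∀ j → ℓ (row L s j) ≡ v (ℓ j) → (j ≡ a ⊎ j ≡ b) × row L s j ≡ j) →
    Switch (ℓ a) (ℓ b) v
  relabel-switch {v} L t a b row-t avoid = record
    { square = relabel L ; top = ℓ t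
    ; row-top = λ x → trans (cong (λ r → ℓ (row L r (ℓ⁻¹ x))) (ℓ⁻¹ℓ t)) (trans (cong ℓ (row-t (ℓ⁻¹ x))) (ℓ-transpose x))
    ; avoids = λ s s≢t {x} fix y eq →
        let at-a⊎b , fixed = avoid (ℓ⁻¹ s) (λ e → s≢t (trans (sym (ℓℓ⁻¹ s)) (cong ℓ e)))
                               {ℓ⁻¹ x} (ℓ-inj (trans fix (sym (ℓℓ⁻¹ x)))) (ℓ⁻¹ y) (trans eq (cong v (sym (ℓℓ⁻¹ y))))
        in (case at-a⊎b of λ where
              (inj₁ e) → inj₁ (trans (sym (ℓℓ⁻¹ y)) (cong ℓ e))
              (inj₂ e) → inj₂ (trans (sym (ℓℓ⁻¹ y)) (cong ℓ e)))
           , trans (cong ℓ fixed) (ℓℓ⁻¹ y)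
    }
    where
    ℓ-transpose : ∀ x → ℓ (transpose a b (ℓ⁻¹ x)) ≡ transpose (ℓ a) (ℓ b) x
    ℓ-transpose x = subst (λ z → ℓ (transpose a b (ℓ⁻¹ x)) ≡ transpose (ℓ a) (ℓ b) z) (ℓℓ⁻¹ x) (onLabel (ℓ⁻¹ x))
      where
      onLabel : ∀ i → ℓ (transpose a b i) ≡ transpose (ℓ a) (ℓ b) (ℓ i)
      onLabel i = case i ≟ a of λ where
        (yes refl) → trans (cong ℓ (transpose-fst a b)) (sym (transpose-fst (ℓ a) (ℓ b)))
        (no i≢a) → case i ≟ b of λ where
          (yes refl) → trans (cong ℓ (transpose-snd a b)) (sym (transpose-snd (ℓ a) (ℓ b)))
          (no i≢b) → trans (cong ℓ (transpose-other i≢a i≢b)) (sym (transpose-other (i≢a ∘ ℓ-inj) (i≢b ∘ ℓ-inj)))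

-- The Latin square x + row = s of order 3 consists of the three transpositions.
switch₃ : ∀ {n} {v : Fin n → Fin n} → 3 ≡ n → (ℓ : Fin 3 → Fin n) → Inj ℓ → Inj v → v (ℓ 2F) ≡ ℓ 2F → Switch (ℓ 0F) (ℓ 1F) v
switch₃ {v = v} 3≡n ℓ ℓ-inj v-inj v2≡2 = relabel-switch L 1F 0F 1F
  (λ { 0F → refl ; 1F → refl ; 2F → refl })
  λ { 0F _ _ 0F _  → inj₁ refl , refl
    ; 0F _ _ 1F eq → contradiction (ℓ-inj (v-inj (trans v2≡2 eq))) λ ()
    ; 0F _ _ 2F eq → contradiction (ℓ-inj (trans eq v2≡2)) λ ()
    ; 1F ≢1 _ _ _  → contradiction refl ≢1
    ; 2F _ _ 0F eq → contradiction (ℓ-inj (v-inj (trans v2≡2 eq))) λ ()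
    ; 2F _ _ 1F _  → inj₂ refl , refl
    ; 2F _ _ 2F eq → contradiction (ℓ-inj (trans eq v2≡2)) λ () }
  where
  open Relabel 3≡n ℓ ℓ-inj
  L : LatinSquare 3
  L .row s x = proj₁ (⊕-solve x s)
  L .row-inj s {x} {y} eq = ⊕-cancelʳ (proj₁ (⊕-solve x s))
    (trans (proj₂ (⊕-solve x s)) (sym (trans (cong (y ⊕_) eq) (proj₂ (⊕-solve y s)))))
  L .row-disjoint {s} {t} x eq = trans (sym (proj₂ (⊕-solve x s))) (trans (cong (x ⊕_) eq) (proj₂ (⊕-solve x t)))

module _ {m n : ℕ} {v : Fin n → Fin n} (N≡n : 2 + (2 + m) ≡ n) (ℓ : Fin (2 + (2 + m)) → Fin n) (ℓ-inj : Inj ℓ) where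

  open Bordered (nearOrthomorphism m)
  open Relabel N≡n ℓ ℓ-inj

  -- Besides the top row only the shift by one has fixed points. It fixes the two border points,
  -- where `Switch` tolerates an agreement with `v`; elsewhere `off` excludes one.
  switch-bordered : (∀ j → v (ℓ (suc (suc j))) ≢ ℓ (suc (suc (j ⊕ 1F)))) → Switch (ℓ 0F) (ℓ 1F) v
  switch-bordered off = relabel-switch bordered 0F 0F 1F top-row avoid
    where
    top-row : ∀ i → line 0F i ≡ transpose 0F 1F i
    top-row zero          = refl
    top-row (suc zero)    = refl
    top-row (suc (suc _)) = refl
    only-1 : ∀ {s i} → s ≢ 0F → line s i ≡ i → s ≡ 1F
    only-1 {i = zero}        _   fix = line-disjoint 0F fix
    only-1 {i = suc zero}    _   fix = line-disjoint 1F fix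
    only-1 {i = suc (suc j)} s≢0 fix = contradiction (line-disjoint (suc (suc j)) fix) s≢0
    avoid : ∀ s → s ≢ 0F → ∀ {i} → line s i ≡ i → ∀ j → ℓ (line s j) ≡ v (ℓ j) → (j ≡ 0F ⊎ j ≡ 1F) × line s j ≡ j
    avoid s s≢0 fix j eq with only-1 s≢0 fix
    avoid s s≢0 fix zero          eq | refl = inj₁ refl , refl
    avoid s s≢0 fix (suc zero)    eq | refl = inj₂ refl , refl
    avoid s s≢0 fix (suc (suc j)) eq | refl = contradiction (sym eq) (off j)

-- The cycle starts with `c`: since `v` fixes it, neither the step from `c` to its successor nor the
-- return to `c` can violate the condition. It remains to order the points other than `a`, `b` and
-- `c` in a chain, which fails only for two points exchanged by `v`. If there are none, the square
-- of order 3 serves.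
switchLemma : ∀ {n} {a b c : Fin n} {v : Fin n → Fin n} → a ≢ b → c ≢ a → c ≢ b → Inj v → v c ≡ c →
              Switch a b v ⊎ Blocked a b c v
switchLemma {n} {a} {b} {c} {v} a≢b c≢a c≢b v-inj vc≡c = cases (length rest ℕ.≟ 2)
  where
  keep? = λ x → ¬? (x ≟ a) ×-dec ¬? (x ≟ b) ×-dec ¬? (x ≟ c)
  rest = filter keep? (allFin n)
  rest-unique : Unique rest
  rest-unique = filter⁺ keep? (allFin⁺ n)
  outside : ∀ {x} → x ∈ rest → x ≢ a × x ≢ b × x ≢ c
  outside x∈ = proj₂ (∈-filter⁻ keep? {xs = allFin n} x∈)
  cover : ∀ x → x ∈ a ∷ b ∷ c ∷ rest
  cover x with x ≟ a | x ≟ b | x ≟ c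
  ... | yes refl | _ | _ = here refl
  ... | no _ | yes refl | _ = there (here refl)
  ... | no _ | no _ | yes refl = there (there (here refl))
  ... | no x≢a | no x≢b | no x≢c = there (there (there (∈-filter⁺ keep? (∈-allFin x) (x≢a , x≢b , x≢c))))

  labels-unique : ∀ {ys} → ys ↭ rest → Unique (a ∷ b ∷ c ∷ ys)
  labels-unique p = (a≢b ∷ c≢a ∘ sym ∷ All.tabulate (λ x∈ → proj₁ (outside (∈-resp-↭ p x∈)) ∘ sym))
    ∷ (c≢b ∘ sym ∷ All.tabulate (λ x∈ → proj₁ (proj₂ (outside (∈-resp-↭ p x∈))) ∘ sym))
    ∷ All.tabulate (λ x∈ → proj₂ (proj₂ (outside (∈-resp-↭ p x∈))) ∘ sym)
    ∷ Unique-resp-↭ (↭-sym p) rest-unique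

  labels-length : ∀ {ys} → ys ↭ rest → 3 + length ys ≡ n
  labels-length {ys} p = ℕ.≤-antisym
    (ℕ.≤-trans (Unique-⊆-length (labels-unique p) (λ _ → ∈-allFin _)) (ℕ.≤-reflexive (length-tabulate id)))
    (ℕ.≤-trans (ℕ.≤-reflexive (sym (length-tabulate id))) (ℕ.≤-trans (Unique-⊆-length (allFin⁺ n) (λ _ → cover _))
      (ℕ.≤-reflexive (cong (3 +_) (sym (↭-length p))))))

  from-chain : ∀ ys → ys ↭ rest → Linkedˡ (λ x y → v x ≢ y) ys → Switch a b v
  from-chain [] p _ = switch₃ (labels-length p) (List.lookup (a ∷ b ∷ c ∷ [])) (lookup-unique (labels-unique p)) v-inj vc≡c
  from-chain ys@(y ∷ ys′) p lk = switch-bordered (labels-length p) (List.lookup (a ∷ b ∷ c ∷ ys)) (lookup-unique u) off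
    where
    u = labels-unique p
    l = length ys′
    linked : Linkedˡ (λ x y → v x ≢ y) (c ∷ ys)
    linked = (λ vc≡y → proj₂ (proj₂ (outside (∈-resp-↭ p (here refl)))) (trans (sym vc≡y) vc≡c)) ∷ lk
    uc : Unique (c ∷ ys)
    uc = case u of λ { (_ ∷ _ ∷ uc) → uc }
    off : ∀ j → v (List.lookup (c ∷ ys) j) ≢ List.lookup (c ∷ ys) (j ⊕ 1F)
    off j with suc (toℕ j) ℕ.<? 2 + l
    ... | yes lt = lookup-linked linked j (j ⊕ 1F) (trans (toℕ-⊕ j 1F) (trans (cong (_% (2 + l)) (ℕ.+-comm (toℕ j) 1)) (m<n⇒m%n≡m lt)))
    ... | no ≮ = λ eq → last≢0 (lookup-unique uc (v-inj (trans eq (trans (cong (List.lookup (c ∷ ys)) wraps) (sym vc≡c)))))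
      where
      last : suc (toℕ j) ≡ 2 + l
      last = ℕ.≤-antisym (toℕ<n j) (ℕ.≮⇒≥ ≮)
      wraps : j ⊕ 1F ≡ 0F
      wraps = toℕ-injective (trans (toℕ-⊕ j 1F) (trans (cong (_% (2 + l)) (trans (ℕ.+-comm (toℕ j) 1) last)) (n%n≡0 (2 + l))))
      last≢0 : j ≢ 0F
      last≢0 refl = contradiction last λ ()

  from-pair : ∀ d e → rest ≡ d ∷ e ∷ [] → Switch a b v ⊎ Blocked a b c v
  from-pair d e eq with v d ≟ e | v e ≟ d
  ... | no vd≢e | _ = inj₁ (from-chain (d ∷ e ∷ []) (subst (_↭ rest) eq ↭-refl) (vd≢e ∷ [-]))
  ... | yes _ | no ve≢d = inj₁ (from-chain (e ∷ d ∷ []) (subst (e ∷ d ∷ [] ↭_) (sym eq) (swap e d ↭-refl)) (ve≢d ∷ [-]))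
  ... | yes vd≡e | yes ve≡d = inj₂ record
    { d = d ; e = e
    ; distinct = proj₁ (outside d∈) , proj₁ (proj₂ (outside d∈)) , proj₂ (proj₂ (outside d∈))
               , proj₁ (outside e∈) , proj₁ (proj₂ (outside e∈)) , proj₂ (proj₂ (outside e∈))
               , (case subst Unique eq rest-unique of λ { ((d≢e ∷ []) ∷ _) → d≢e })
    ; vd≡e = vd≡e ; ve≡d = ve≡d
    ; cover = λ x → case subst (λ r → x ∈ a ∷ b ∷ c ∷ r) eq (cover x) of λ where
        (here e) → inj₁ e
        (there (here e)) → inj₂ (inj₁ e)
        (there (there (here e))) → inj₂ (inj₂ (inj₁ e))
        (there (there (there (here e)))) → inj₂ (inj₂ (inj₂ (inj₁ e)))
        (there (there (there (there (here e))))) → inj₂ (inj₂ (inj₂ (inj₂ e)))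
    }
    where
    d∈ : d ∈ rest
    d∈ = subst (d ∈_) (sym eq) (here refl)
    e∈ : e ∈ rest
    e∈ = subst (e ∈_) (sym eq) (there (here refl))

  pair : ∀ xs → length xs ≡ 2 → ∃₂ λ d e → xs ≡ d ∷ e ∷ []
  pair (d ∷ e ∷ []) refl = d , e , refl

  cases : Dec (length rest ≡ 2) → Switch a b v ⊎ Blocked a b c v
  cases (yes len) = let d , e , eq = pair rest len in from-pair d e eq
  cases (no ≢2)   = let ys , p , l = chain v-inj rest rest-unique ≢2 in inj₁ (from-chain ys p l)

-- Families of perfect matchings

module _ {A : Fin k → Set} where

  override : (j : Fin k) → A j → (∀ i → A i) → ∀ i → A i
  override j a f i with i ≟ j
  ... | yes refl = a
  ... | no _     = f i

  override-same : ∀ j (a : A j) f → override j a f j ≡ a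
  override-same j a f with j ≟ j
  ... | yes refl = refl
  ... | no j≢j   = contradiction refl j≢j

  override-other : ∀ {j i} (a : A j) f → i ≢ j → override j a f i ≡ f i
  override-other {j} {i} a f i≢j with i ≟ j
  ... | yes i≡j = contradiction i≡j i≢j
  ... | no _    = refl

module Tuples {k : ℕ} (ns : Vec ℕ k) where

  -- Maps of the whole parts, although a matching of size n₁ determines only n₁ values in each:
  -- composition and Latin squares of the order of the part require complete permutations.
  Tuple : Set
  Tuple = ∀ j → Fin (lookup ns j) → Fin (lookup ns j)

  Injs : Tuple → Set
  Injs γ = ∀ j → Inj (γ j)

  infixl 8 _⊙_
  _⊙_ : Tuple → Tuple → Tuple
  (γ ⊙ δ) j = γ j ∘ δ j

  ⊙-injs : ∀ {γ δ} → Injs γ → Injs δ → Injs (γ ⊙ δ)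
  ⊙-injs γ-injs δ-injs j eq = δ-injs j (γ-injs j eq)

  at : (j : Fin k) → (Fin (lookup ns j) → Fin (lookup ns j)) → Tuple
  at j f = override j f (λ _ → id)

  at-same : ∀ j f x → at j f j x ≡ f x
  at-same j f x = cong (λ g → g x) (override-same {A = λ i → Fin (lookup ns i) → Fin (lookup ns i)} j f (λ _ → id))

  at-other : ∀ j f {i} → i ≢ j → ∀ x → at j f i x ≡ x
  at-other j f i≢j x = cong (λ g → g x) (override-other {A = λ i → Fin (lookup ns i) → Fin (lookup ns i)} f (λ _ → id) i≢j)

  at-injs : ∀ j {f} → Inj f → Injs (at j f)
  at-injs j {f} inj i {x} {y} eq = case i ≟ j of λ where
    (yes refl) → inj (trans (sym (at-same j f x)) (trans eq (at-same j f y)))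
    (no i≢j)   → trans (sym (at-other j f i≢j x)) (trans eq (at-other j f i≢j y))

  Family : Set
  Family = ∀ j → LatinSquare (lookup ns j)

  rowᶠ : Family → (∀ j → Fin (lookup ns j)) → Tuple
  rowᶠ Λ s j = row (Λ j) (s j)

  ⟦_⟧ : Perms ns → Tuple
  ⟦ γ ⟧ j = lookup (lookup⁺ γ j)

  toPerms : Tuple → Perms ns
  toPerms γ = lookup⁻ (λ j → tabulate (γ j))

  ⟦toPerms⟧ : ∀ γ j x → ⟦ toPerms γ ⟧ j x ≡ γ j x
  ⟦toPerms⟧ γ j x = trans (cong (λ v → lookup v x) (lookup⁺-lookup⁻ {xs = ns} (λ j → tabulate (γ j)) j)) (lookup∘tabulate (γ j) x)

  toPerms∈group : ∀ {γ} → Injs γ → toPerms γ ∈ group ns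
  toPerms∈group {γ} inj = ∈-alls⁺ λ i → ∈-perms λ {x} {y} eq →
    inj i (trans (sym (⟦toPerms⟧ γ i x)) (trans eq (⟦toPerms⟧ γ i y)))

module Perfect {n₁ : ℕ} {ns : Vec ℕ k} (ι : ∀ j → Fin n₁ → Fin (lookup ns j))
  (ι-inj : ∀ j → Inj (ι j)) where

  open Tuples ns

  Agree : Tuple → Tuple → Fin n₁ → Set
  Agree γ δ x = ∀ j → γ j (ι j x) ≡ δ j (ι j x)

  agree? : ∀ γ δ x → Dec (Agree γ δ x)
  agree? γ δ x = all? λ j → γ j (ι j x) ≟ δ j (ι j x)

  module _ (S : Tuple → Set) (S? : ∀ γ → Dec (S γ))
    (S-ext  : ∀ {γ δ} → (∀ j x → γ j x ≡ δ j x) → S γ → S δ)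
    (S-meet : ∀ {γ δ} → S γ → S δ → ∃ (Agree γ δ))
    (S-hit  : ∀ γ → Injs γ → (Λ : Family) → ∃[ s ] S (γ ⊙ rowᶠ Λ s)) where

    -- The column is named by a point of part `j`, since a transposition of that part may also move
    -- points outside the image of `ι j`. At those points no agreement is possible.
    At : Tuple → Tuple → ∀ j → Fin (lookup ns j) → Set
    At γ δ j a = ∃[ x ] (ι j x ≡ a × Agree γ δ x)

    at? : ∀ γ δ j a → Dec (At γ δ j a)
    at? γ δ j a = any? λ x → ι j x ≟ a ×-dec agree? γ δ x

    module _ {γ u : Tuple} (γ-injs : Injs γ) (u-injs : Injs u) (Sγ : S γ) (Su : S u)
      {j : Fin k} {a b : Fin (lookup ns j)} (a≢b : a ≢ b)
      (¬a : ¬ At γ u j a) (¬b : ¬ At γ u j b) where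

      v : Fin (lookup ns j) → Fin (lookup ns j)
      v y = proj₁ (inj⇒surj (γ-injs j) (u j y))

      γv≡u : ∀ y → γ j (v y) ≡ u j y
      γv≡u y = proj₂ (inj⇒surj (γ-injs j) (u j y))

      v-inj : Inj v
      v-inj {x} {y} eq = u-injs j (trans (sym (γv≡u x)) (trans (cong (γ j) eq) (γv≡u y)))

      v-fix : ∀ {x} → Agree γ u x → v (ι j x) ≡ ι j x
      v-fix {x} ag = γ-injs j (trans (γv≡u (ι j x)) (sym (ag j)))

      switched : Switch a b v → S (γ ⊙ at j (transpose a b))
      switched sw = let s , Ss = S-hit γ γ-injs Λ in S-ext (transport s Ss) Ss
        where
        open Switch sw
        Λ : Family
        Λ = override j square (λ i → cyclic (lookup ns i))
        Λ-same : Λ j ≡ square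
        Λ-same = override-same j square _
        Λ-other : ∀ {i} → i ≢ j → Λ i ≡ cyclic (lookup ns i)
        Λ-other = override-other square _
        transport : ∀ s → S (γ ⊙ rowᶠ Λ s) → ∀ i y → (γ ⊙ rowᶠ Λ s) i y ≡ (γ ⊙ at j (transpose a b)) i y
        transport s Ss with S-meet Ss Sγ | S-meet Ss Su
        ... | x , agx | y , agy = result
          where
          fixes : ∀ i → row (Λ i) (s i) (ι i x) ≡ ι i x
          fixes i = γ-injs i (agx i)
          -- The translate meets `γ`, so each of its rows has a fixed point; for the cyclic squares
          -- this makes the row trivial and leaves only coordinate `j` open.
          others : ∀ {i} → i ≢ j → ∀ z → row (Λ i) (s i) z ≡ z
          others {i} i≢j z = subst (λ L → row L (s i) z ≡ z) (sym (Λ-other i≢j))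
            (⊕-identity (subst (λ L → row L (s i) (ι i x) ≡ ι i x) (Λ-other i≢j) (fixes i)) z)
          fix-j : row square (s j) (ι j x) ≡ ι j x
          fix-j = subst (λ L → row L (s j) (ι j x) ≡ ι j x) Λ-same (fixes j)
          meets-u : row square (s j) (ι j y) ≡ v (ι j y)
          meets-u = γ-injs j (trans (subst (λ L → γ j (row L (s j) (ι j y)) ≡ u j (ι j y)) Λ-same (agy j)) (sym (γv≡u (ι j y))))
          top-row : s j ≡ top
          -- In any other row the meeting point with `u` would be a fixed point at `a` or `b`, so
          -- that `γ` and `u` would agree there.
          top-row = decidable-stable (s j ≟ top) λ s≢top → let y∈ab , fix-y = avoids (s j) s≢top fix-j (ι j y) meets-u in
            let ag : Agree γ u y
                ag i = case i ≟ j of λ where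
                  (yes refl) → trans (cong (γ j) (trans (sym fix-y) meets-u)) (γv≡u (ι j y))
                  (no i≢j) → trans (cong (γ i) (sym (others i≢j (ι i y)))) (agy i)
            in case y∈ab of λ where
              (inj₁ y≡a) → ¬a (y , y≡a , ag)
              (inj₂ y≡b) → ¬b (y , y≡b , ag)
          result : ∀ i z → (γ ⊙ rowᶠ Λ s) i z ≡ (γ ⊙ at j (transpose a b)) i z
          result i z = case i ≟ j of λ where
            (yes refl) → cong (γ j) (trans (cong (λ L → row L (s j) z) Λ-same) (trans (cong (λ t → row square t z) top-row)
                           (trans (row-top z) (sym (at-same j (transpose a b) z)))))
            (no i≢j) → cong (γ i) (trans (others i≢j z) (sym (at-other j (transpose a b) i≢j z)))

      column : ∃[ x ] (Agree γ u x × ι j x ≢ a × ι j x ≢ b)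
      column with S-meet Sγ Su
      ... | x , ag = x , ag , (λ eq → ¬a (x , eq , ag)) , (λ eq → ¬b (x , eq , ag))

      switched⊎blocked : ∀ {x} → Agree γ u x → S (γ ⊙ at j (transpose a b)) ⊎ Blocked a b (ι j x) v
      switched⊎blocked {x} ag with switchLemma a≢b (λ eq → ¬a (x , eq , ag)) (λ eq → ¬b (x , eq , ag)) v-inj (v-fix ag)
      ... | inj₁ sw = inj₁ (switched sw)
      ... | inj₂ bl = inj₂ bl

    Agree-sym : ∀ {γ u x} → Agree γ u x → Agree u γ x
    Agree-sym ag j = sym (ag j)

    At-sym : ∀ {γ u j a} → At γ u j a → At u γ j a
    At-sym {γ} {u} (x , eq , ag) = x , eq , Agree-sym {γ} {u} ag

    -- In the blocked case (five points, γ⁻¹u fixes c and exchanges d and e) first replace u by u (a d).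
    switch-closed : ∀ {γ u} → Injs γ → Injs u → S γ → S u → ∀ {j a b} → a ≢ b →
      ¬ At γ u j a → ¬ At γ u j b → S (γ ⊙ at j (transpose a b))
    switch-closed {γ} {u} γi ui Sγ Su {j} {a} {b} a≢b ¬a ¬b with column γi ui Sγ Su a≢b ¬a ¬b
    ... | x , ag , x≢a , x≢b with switched⊎blocked γi ui Sγ Su a≢b ¬a ¬b ag
    ...   | inj₁ S′ = S′
    ...   | inj₂ bl = second
      where
      open Blocked bl
      c = ι j x
      d≢a = proj₁ distinct
      d≢b = proj₁ (proj₂ distinct)
      d≢c = proj₁ (proj₂ (proj₂ distinct))
      e≢a = proj₁ (proj₂ (proj₂ (proj₂ distinct)))
      e≢c = proj₁ (proj₂ (proj₂ (proj₂ (proj₂ (proj₂ distinct)))))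
      d≢e = proj₂ (proj₂ (proj₂ (proj₂ (proj₂ (proj₂ distinct)))))
      V = v γi ui Sγ Su a≢b ¬a ¬b
      γV≡u = γv≡u γi ui Sγ Su a≢b ¬a ¬b
      ¬d : ¬ At γ u j d
      ¬d (z , refl , agz) = d≢e (trans (sym (v-fix γi ui Sγ Su a≢b ¬a ¬b agz)) vd≡e)
      u₂ = u ⊙ at j (transpose a d)
      u₂i : Injs u₂
      u₂i = ⊙-injs ui (at-injs j (transpose-inj a d))
      u₂-ad : ∀ z → u₂ j z ≡ u j (transpose a d z)
      u₂-ad z = cong (u j) (at-same j (transpose a d) z)
      ¬a′ = ¬a ∘ At-sym {u} {γ} {j} {a}
      ¬d′ = ¬d ∘ At-sym {u} {γ} {j} {d}
      Su₂ : S u₂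
      Su₂ with switched⊎blocked ui γi Su Sγ (d≢a ∘ sym) ¬a′ ¬d′ (Agree-sym {γ} {u} ag)
      ... | inj₁ S′ = S′
      ... | inj₂ bl′ = ⊥-elim impossible
        where
        module B = Blocked bl′
        W = v ui γi Su Sγ (d≢a ∘ sym) ¬a′ ¬d′
        We≡d : W e ≡ d
        We≡d = ui j (trans (γv≡u ui γi Su Sγ (d≢a ∘ sym) ¬a′ ¬d′ e) (trans (cong (γ j) (sym vd≡e)) (γV≡u d)))
        -- e is one of the two exchanged points, so W e is not d.
        impossible : ⊥
        impossible with B.cover e
        ... | inj₁ e≡a = e≢a e≡a
        ... | inj₂ (inj₁ e≡d) = d≢e (sym e≡d)
        ... | inj₂ (inj₂ (inj₁ e≡c)) = e≢c e≡c
        ... | inj₂ (inj₂ (inj₂ (inj₁ e≡d′))) =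
                proj₁ (proj₂ (proj₂ (proj₂ (proj₂ B.distinct)))) (trans (sym B.vd≡e) (trans (cong W (sym e≡d′)) We≡d))
        ... | inj₂ (inj₂ (inj₂ (inj₂ e≡e′))) =
                proj₁ (proj₂ B.distinct) (trans (sym B.ve≡d) (trans (cong W (sym e≡e′)) We≡d))
      u₂a : u₂ j a ≡ γ j e
      u₂a = trans (u₂-ad a) (trans (cong (u j) (transpose-fst a d)) (trans (sym (γV≡u d)) (cong (γ j) vd≡e)))
      ¬a₂ : ¬ At γ u₂ j a
      ¬a₂ (z , refl , agz) = e≢a (γi j (trans (sym u₂a) (sym (agz j))))
      u₂-keep : ∀ {z} → ι j z ≢ a → ι j z ≢ d → ∀ i → u₂ i (ι i z) ≡ u i (ι i z)
      u₂-keep {z} ≢a ≢d i = case i ≟ j of λ where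
        (yes refl) → trans (u₂-ad (ι j z)) (cong (u j) (transpose-other ≢a ≢d))
        (no i≢j)   → cong (u i) (at-other j (transpose a d) i≢j (ι i z))
      ¬b₂ : ¬ At γ u₂ j b
      ¬b₂ (z , refl , agz) = ¬b (z , refl , λ i → trans (agz i) (u₂-keep (a≢b ∘ sym) (d≢b ∘ sym) i))
      ag₂ : Agree γ u₂ x
      ag₂ i = trans (ag i) (sym (u₂-keep x≢a (d≢c ∘ sym) i))
      second : S (γ ⊙ at j (transpose a b))
      second with switched⊎blocked γi u₂i Sγ Su₂ a≢b ¬a₂ ¬b₂ ag₂
      ... | inj₁ S′ = S′
      ... | inj₂ bl′ = ⊥-elim impossible
        where
        module B = Blocked bl′
        W = v γi u₂i Sγ Su₂ a≢b ¬a₂ ¬b₂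
        -- If the switch were blocked again, `d` would have to be one of the two exchanged points,
        -- and `W d` would lie outside `a`, `b`, `c`. But `W d` is `V a`, which is neither `d` nor
        -- `e`, as `V` takes these values at `e` and `d`.
        Wd≡Va : W d ≡ V a
        Wd≡Va = γi j (trans (γv≡u γi u₂i Sγ Su₂ a≢b ¬a₂ ¬b₂ d)
          (trans (u₂-ad d) (trans (cong (u j) (transpose-snd a d)) (sym (γV≡u a)))))
        Wd∉abc : W d ≢ a × W d ≢ b × W d ≢ c
        Wd∉abc with B.cover d
        ... | inj₁ d≡a = contradiction d≡a d≢a
        ... | inj₂ (inj₁ d≡b) = contradiction d≡b d≢b
        ... | inj₂ (inj₂ (inj₁ d≡c)) = contradiction d≡c d≢c
        ... | inj₂ (inj₂ (inj₂ (inj₁ refl))) = let _ , _ , _ , e₁ , e₂ , e₃ , _ = B.distinct in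
                e₁ ∘ trans (sym B.vd≡e) , e₂ ∘ trans (sym B.vd≡e) , e₃ ∘ trans (sym B.vd≡e)
        ... | inj₂ (inj₂ (inj₂ (inj₂ refl))) = let e₁ , e₂ , e₃ , _ = B.distinct in
                e₁ ∘ trans (sym B.ve≡d) , e₂ ∘ trans (sym B.ve≡d) , e₃ ∘ trans (sym B.ve≡d)
        V-inj = v-inj γi ui Sγ Su a≢b ¬a ¬b
        impossible : ⊥
        impossible with cover (V a)
        ... | inj₁ eq = proj₁ Wd∉abc (trans Wd≡Va eq)
        ... | inj₂ (inj₁ eq) = proj₁ (proj₂ Wd∉abc) (trans Wd≡Va eq)
        ... | inj₂ (inj₂ (inj₁ eq)) = proj₂ (proj₂ Wd∉abc) (trans Wd≡Va eq)
        ... | inj₂ (inj₂ (inj₂ (inj₁ eq))) = e≢a (V-inj (trans ve≡d (sym eq)))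
        ... | inj₂ (inj₂ (inj₂ (inj₂ eq))) = d≢a (V-inj (trans vd≡e (sym eq)))

    record Boundary (j : Fin k) : Set where
      field
        γ     : Tuple
        injs  : Injs γ
        S-in  : S γ
        a b   : Fin (lookup ns j)
        a≢b   : a ≢ b
        S-out : ¬ S (γ ⊙ at j (transpose a b))

    -- The partial products form a walk from inside S to outside, so some step leaves S. As `eval`
    -- applies the head of its list first, that head is the last factor on the right of the tuple. A
    -- step with `a` equal to `b` would not move.
    boundary : ∀ {γ} j → Injs γ → S γ → ∀ ts → ¬ S (γ ⊙ at j (eval ts ⟨$⟩ʳ_)) → Boundary j
    boundary {γ} j γi Sγ [] ¬S = contradiction (S-ext pointwise Sγ) ¬S
      where
      pointwise : ∀ i x → γ i x ≡ (γ ⊙ at j id) i x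
      pointwise i x = case i ≟ j of λ where
        (yes refl) → cong (γ i) (sym (at-same i id x))
        (no i≢j)   → cong (γ i) (sym (at-other j id i≢j x))
    boundary {γ} j γi Sγ ((a , b) ∷ ts) ¬S with S? (γ ⊙ at j (eval ts ⟨$⟩ʳ_))
    ... | no ¬S′ = boundary j γi Sγ ts ¬S′
    ... | yes S′ = record
      { γ = γ′ ; injs = ⊙-injs γi (at-injs j π-inj) ; S-in = S′ ; a = a ; b = b
      ; a≢b = λ { refl → ¬S (S-ext (λ i x → trans (same-point i x) (pointwise i x)) S′) }
      ; S-out = λ S″ → ¬S (S-ext pointwise S″) }
      where
      π = eval ts
      γ′ = γ ⊙ at j (π ⟨$⟩ʳ_)
      π-inj : Inj (π ⟨$⟩ʳ_)
      π-inj eq = trans (sym (Perm.inverseˡ π)) (trans (cong (π Perm.⟨$⟩ˡ_) eq) (Perm.inverseˡ π))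
      pointwise : ∀ i x → (γ′ ⊙ at j (transpose a b)) i x ≡ (γ ⊙ at j (eval ((a , b) ∷ ts) ⟨$⟩ʳ_)) i x
      pointwise i x = case i ≟ j of λ where
        (yes refl) → cong (γ i) (trans (at-same i _ _) (trans (cong (π ⟨$⟩ʳ_) (at-same i _ x)) (sym (at-same i _ x))))
        (no i≢j)   → cong (γ i) (trans (at-other j _ i≢j _) (trans (at-other j _ i≢j x) (sym (at-other j _ i≢j x))))
      transpose-self : ∀ {n} (a x : Fin n) → transpose a a x ≡ x
      transpose-self a x = case x ≟ a of λ where
        (yes refl) → transpose-fst a a
        (no x≢a)   → transpose-other x≢a x≢a
      same-point : ∀ {a} i x → γ′ i x ≡ (γ′ ⊙ at j (transpose a a)) i x
      same-point {a} i x = case i ≟ j of λ where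
        (yes refl) → cong (γ′ i) (sym (trans (at-same i _ x) (transpose-self a x)))
        (no i≢j)   → cong (γ′ i) (sym (at-other j _ i≢j x))

    Concentrated : Set
    Concentrated = ∃₂ λ γ x → Injs γ × S γ × (∀ u → Injs u → S u → Agree γ u x)

    module _ {j : Fin k} where

      a-or-b : (B : Boundary j) → ∀ {u} → Injs u → S u → ¬ At (Boundary.γ B) u j (Boundary.a B) → At (Boundary.γ B) u j (Boundary.b B)
      a-or-b B {u} ui Su ¬a = decidable-stable (at? γ u j b) λ ¬b → S-out (switch-closed injs ui S-in Su a≢b ¬a ¬b)
        where open Boundary B

      -- If h ∈ S leaves γ at a, then (h, b, a) is a boundary too, which forces everything through b.
      concentrated : Boundary j → Concentrated
      concentrated B with Any.any? (λ A → S? ⟦ A ⟧ ×-dec ¬? (at? γ ⟦ A ⟧ j a)) (group ns)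
        where open Boundary B
      ... | no none = γ , proj₁ here-a , injs , S-in , through
        where
        open Boundary B
        all-a : ∀ u → Injs u → S u → At γ u j a
        all-a u ui Su = decidable-stable (at? γ u j a) λ ¬a → none (lose (toPerms∈group ui)
          (S-ext (λ i x → sym (⟦toPerms⟧ u i x)) Su
          , λ (x , eq , ag) → ¬a (x , eq , λ i → trans (ag i) (⟦toPerms⟧ u i (ι i x)))))
        here-a = all-a γ injs S-in
        through : ∀ u → Injs u → S u → Agree γ u (proj₁ here-a)
        through u ui Su with all-a u ui Su
        ... | y , eq , ag = subst (Agree γ u) (ι-inj j (trans eq (sym (proj₁ (proj₂ here-a))))) ag
      ... | yes some with find some
      ...   | A , A∈ , Sh , ¬ha = γ , proj₁ hb , injs , S-in , through
        where
        open Boundary B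
        h = ⟦ A ⟧
        hi : Injs h
        hi = group-inj A∈
        hb : At γ h j b
        hb = a-or-b B hi Sh ¬ha
        h-b : h j b ≡ γ j b
        h-b with hb
        ... | z , refl , ag = sym (ag j)
        h′ = h ⊙ at j (transpose a b)
        h′-ab : ∀ z → h′ j z ≡ h j (transpose a b z)
        h′-ab z = cong (h j) (at-same j _ z)
        -- A member of S agrees with `γ` at `a` or at `b`. But `h′` takes at `a` the value `h b`,
        -- which is `γ b`, and at `b` the value `h a`, which differs from `h b`.
        h′∉ : ¬ S h′
        h′∉ Sh′ with at? γ h′ j a
        ... | yes (z , refl , ag) = a≢b (injs j (trans (ag j) (trans (h′-ab a) (trans (cong (h j) (transpose-fst a b)) h-b))))
        ... | no ¬h′a with a-or-b B (⊙-injs hi (at-injs j (transpose-inj a b))) Sh′ ¬h′a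
        ...   | z , refl , ag = a≢b (hi j (trans (cong (h j) (sym (transpose-snd a b))) (trans (sym (h′-ab b)) (trans (sym (ag j)) (sym h-b)))))
        B′ : Boundary j
        B′ = record { γ = h ; injs = hi ; S-in = Sh ; a = a ; b = b ; a≢b = a≢b ; S-out = h′∉ }
        -- If `u` agrees with `γ` at `a`, it cannot agree with `h` there; the boundary at `h` then
        -- makes it agree with `h`, and so with `γ`, at `b`.
        all-b : ∀ u → Injs u → S u → At γ u j b
        all-b u ui Su with at? γ u j a
        ... | no ¬a = a-or-b B ui Su ¬a
        ... | yes (z , z≡a , ag) = case a-or-b B′ ui Su (λ (z′ , z′≡a , ag′) → ¬ha (z , z≡a , λ i →
                    trans (ag i) (sym (subst (Agree h u) (ι-inj j (trans z′≡a (sym z≡a))) ag′ i)))) of λ where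
              (y , y≡b , ag′) → y , y≡b , λ i → trans (subst (Agree γ h) (ι-inj j (trans (proj₁ (proj₂ hb)) (sym y≡b))) (proj₂ (proj₂ hb)) i) (ag′ i)
        through : ∀ u → Injs u → S u → Agree γ u (proj₁ hb)
        through u ui Su with all-b u ui Su
        ... | y , eq , ag = subst (Agree γ u) (ι-inj j (trans eq (sym (proj₁ (proj₂ hb))))) ag

    concentration : ∀ {γ} j → Injs γ → S γ → (π : Permutation′ (lookup ns j)) → ¬ S (γ ⊙ at j (π ⟨$⟩ʳ_)) → Concentrated
    concentration {γ} j γi Sγ π ¬S = concentrated (boundary j γi Sγ (decompose π) (¬S ∘ S-ext pointwise))
      where
      pointwise : ∀ i x → (γ ⊙ at j (eval (decompose π) ⟨$⟩ʳ_)) i x ≡ (γ ⊙ at j (π ⟨$⟩ʳ_)) i x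
      pointwise i x = case i ≟ j of λ where
        (yes refl) → cong (γ i) (trans (at-same i _ x) (trans (eval-decompose π x) (sym (at-same i _ x))))
        (no i≢j)   → cong (γ i) (trans (at-other j _ i≢j x) (sym (at-other j _ i≢j x)))

-- A cyclic order of the edges

infix 4 _≈_[mod_]
_≈_[mod_] : ℕ → ℕ → ℕ → Set
t ≈ u [mod N ] = ∃₂ λ a b → t + a * N ≡ u + b * N

-- The mixed-radix expansion of `q`, lowest digit first and cut off after the last part. From `q` to
-- `q + 1` each digit stays or grows by one modulo its radix.
digits : {ns : Vec ℕ k} → VAll NonZero ns → ℕ → Edge ns
digits                []         q = []
digits {ns = n ∷ ns} (nz ∷ nzs) q = (q mod n) {{nz}} ∷ digits nzs ((q / n) {{nz}})

size : Vec ℕ k → ℕ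
size = ∏ id

[n*m]/n≡m : ∀ n m .{{_ : NonZero n}} → n * m / n ≡ m
[n*m]/n≡m n m = trans (cong (_/ n) (*-comm n m)) (m*n/n≡m m n)

digits-periodic : {ns : Vec ℕ k} (nz : VAll NonZero ns) → ∀ q → digits nz (q + size ns) ≡ digits nz q
digits-periodic []         q = refl
digits-periodic {ns = n ∷ ns} (nz ∷ nzs) q = cong₂ _∷_
  (toℕ-injective (trans (toℕ-mod (q + n * size ns) n) (trans
    (trans (cong (λ z → (q + z) % n) (*-comm n (size ns))) ([m+kn]%n≡m%n q (size ns) n)) (sym (toℕ-mod q n)))))
  (trans (cong (digits nzs) (trans (+-distrib-/-∣ʳ q {n * size ns} (m∣m*n (size ns)))
                                   (cong (q / n +_) ([n*m]/n≡m n (size ns))))) (digits-periodic nzs (q / n)))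
  where instance _ = nz

digits-inj : {ns : Vec ℕ k} (nz : VAll NonZero ns) → ∀ {q q′} → digits nz q ≡ digits nz q′ → q ≈ q′ [mod size ns ]
-- Modulo the empty product 1 everything is congruent; the multiples `q′` and `q` balance the two
-- sides.
digits-inj [] {q} {q′} _ = q′ , q , trans (cong (q +_) (*-identityʳ q′)) (trans (+-comm q q′) (cong (q′ +_) (sym (*-identityʳ q))))
digits-inj {ns = n ∷ ns} (nz ∷ nzs) {q} {q′} eq with ∷-injectiveᵃ eq
... | eq₀ , eqs with digits-inj nzs eqs
...   | a , b , eq₁ = a , b , trans (split q a) (trans (cong₂ (λ x y → x + n * y) eq₂ eq₁) (sym (split q′ b)))
  where
  instance _ = nz
  eq₂ : q % n ≡ q′ % n
  eq₂ = trans (sym (toℕ-mod q n)) (trans (cong toℕ eq₀) (toℕ-mod q′ n))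
  split : ∀ q a → q + a * (n * size ns) ≡ q % n + n * (q / n + a * size ns)
  split q a = begin
    q + a * (n * size ns)                      ≡⟨ cong₂ _+_ (m≡m%n+[m/n]*n q n) (trans (sym (*-assoc a n _)) (trans (cong (_* size ns) (*-comm a n)) (*-assoc n a _))) ⟩
    q % n + q / n * n + n * (a * size ns)      ≡⟨ +-assoc (q % n) _ _ ⟩
    q % n + (q / n * n + n * (a * size ns))    ≡⟨ cong (λ z → q % n + (z + n * (a * size ns))) (*-comm (q / n) n) ⟩
    q % n + (n * (q / n) + n * (a * size ns))  ≡⟨ cong (q % n +_) (sym (*-distribˡ-+ n (q / n) (a * size ns))) ⟩
    q % n + n * (q / n + a * size ns)          ∎
    where open ≡-Reasoning

-- The invariant handed on from digit to digit. After a step to the next block a digit may or may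
-- not have grown, so the columns must satisfy both x ≠ x′ and x ≠ x′ + 1; a drop by at least 2
-- gives both, even modulo a radix n ≥ n₁.
Near : ℕ → ℕ → ℕ → ℕ → Set
Near x x′ q q′ = (q′ ≡ q × x ≢ x′) ⊎ (q′ ≡ suc q × suc x′ < x)

suc-/ : ∀ q n .{{_ : NonZero n}} → suc q / n ≡ q / n ⊎ suc q / n ≡ suc (q / n)
suc-/ q n with m≤n⇒m<n∨m≡n (/-monoˡ-≤ n (n≤1+n q))
... | inj₂ eq = inj₁ (sym eq)
... | inj₁ lt = inj₂ (≤-antisym (≤-trans (/-monoˡ-≤ n (+-monoˡ-≤ q (>-nonZero⁻¹ n)))
                  (≤-reflexive (trans (+-distrib-/-∣ˡ q {n} ∣-refl) (cong (_+ q / n) (n/n≡1 n))))) lt)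

Near-/ : ∀ {x x′ q q′} n .{{_ : NonZero n}} → Near x x′ q q′ → Near x x′ (q / n) (q′ / n)
Near-/ n (inj₁ (refl , x≢)) = inj₁ (refl , x≢)
Near-/ {x} {x′} {q} n (inj₂ (refl , lt)) with suc-/ q n
... | inj₁ eq = inj₁ (eq , λ { refl → <-irrefl refl (<-trans lt ≤-refl) })
... | inj₂ eq = inj₂ (eq , lt)

module Order {n₁ : ℕ} {ns : Vec ℕ k} {{nz₁ : NonZero n₁}} (le : VAll (n₁ ≤_) ns) where

  ι : ∀ j → Fin n₁ → Fin (lookup ns j)
  ι j x = inject≤ x (lookup⁺ le j)

  ι-inj : ∀ j → Inj (ι j)
  ι-inj j = inject≤-injective _ _ _ _

  nonZeros : VAll NonZero ns
  nonZeros = VAll.map (λ n₁≤n → >-nonZero (≤-trans (>-nonZero⁻¹ n₁) n₁≤n)) le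

  N : ℕ
  N = n₁ * size ns

  cell : Fin n₁ → Edge ns → Edge (n₁ ∷ ns)
  cell x s = x ∷ lookup⁻ (λ j → ι j x ⊕ lookup⁺ s j)

  lookup-cell : ∀ x s j → lookup⁺ (tl (cell x s)) j ≡ ι j x ⊕ lookup⁺ s j
  lookup-cell x s = lookup⁺-lookup⁻ {xs = ns} (λ j → ι j x ⊕ lookup⁺ s j)

  cell-inj : ∀ x s x′ s′ → cell x s ≡ cell x′ s′ → x ≡ x′ × s ≡ s′
  cell-inj x s x′ s′ eq with ∷-injectiveᵃ eq
  ... | refl , eqs = refl , lookup⁺-injective λ j → ⊕-cancelˡ (ι j x)
    (trans (sym (lookup-cell x s j)) (trans (cong (λ e → lookup⁺ e j) eqs) (lookup-cell x s′ j)))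

  cell-disjoint : ∀ {x x′} s → x ≢ x′ → Disjoint (cell x s) (cell x′ s)
  cell-disjoint s x≢ zero eq = x≢ eq
  cell-disjoint {x} {x′} s x≢ (suc j) eq = x≢ (ι-inj j (⊕-cancelʳ (lookup⁺ s j)
    (trans (sym (lookup-cell x s j)) (trans eq (lookup-cell x′ s j)))))

  -- A cyclic order of all edges in which any n₁ - 1 consecutive ones are disjoint: within a block of length n₁ the shifts are
  -- constant, and from one block to the next each of them grows by 0 or 1.
  order : ℕ → Edge (n₁ ∷ ns)
  order t = cell (t mod n₁) (digits nonZeros (t / n₁))

  order-periodic : ∀ t → order (t + N) ≡ order t
  order-periodic t = cong₂ cell
    (toℕ-injective (trans (toℕ-mod (t + N) n₁) (trans
      (trans (cong (λ z → (t + z) % n₁) (*-comm n₁ (size ns))) ([m+kn]%n≡m%n t (size ns) n₁)) (sym (toℕ-mod t n₁)))))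
    (trans (cong (digits nonZeros) (trans (+-distrib-/-∣ʳ t {N} (m∣m*n (size ns))) (cong (t / n₁ +_) ([n*m]/n≡m n₁ (size ns)))))
           (digits-periodic nonZeros (t / n₁)))

  order-inj : ∀ {t t′} → order t ≡ order t′ → t ≈ t′ [mod N ]
  order-inj {t} {t′} eq = digits-inj (nz₁ ∷ nonZeros) (cong₂ _∷_ (proj₁ eqs) (proj₂ eqs))
    where eqs = cell-inj (t mod n₁) (digits nonZeros (t / n₁)) (t′ mod n₁) (digits nonZeros (t′ / n₁)) eq

  shifted-apart : ∀ {l} {ns : Vec ℕ l} (nz : VAll NonZero ns) (le : VAll (n₁ ≤_) ns) {x x′ : Fin n₁} {q q′} →
    Near (toℕ x) (toℕ x′) q q′ → ∀ j →
    inject≤ x (lookup⁺ le j) ⊕ lookup⁺ (digits nz q) j ≢ inject≤ x′ (lookup⁺ le j) ⊕ lookup⁺ (digits nz q′) j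
  shifted-apart {ns = suc n ∷ ns} (nz ∷ nzs) (n₁≤n ∷ les) {x} {x′} {q} {q′} near (suc j) =
    shifted-apart nzs les (Near-/ (suc n) {{nz}} near) j
  shifted-apart {ns = suc n ∷ ns} (nz ∷ nzs) (n₁≤n ∷ les) {x} {x′} {q} {q′} near zero eq = apart near
    where
    value : ∀ (z : Fin n₁) p → toℕ (inject≤ z n₁≤n ⊕ (p mod suc n)) ≡ (p + toℕ z) % suc n
    value z p = begin
      toℕ (inject≤ z n₁≤n ⊕ (p mod suc n))                 ≡⟨ toℕ-⊕ (inject≤ z n₁≤n) (p mod suc n) ⟩
      (toℕ (inject≤ z n₁≤n) + toℕ (p mod suc n)) % suc n   ≡⟨ cong₂ (λ a b → (a + b) % suc n) (toℕ-inject≤ z n₁≤n) (toℕ-mod p (suc n)) ⟩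
      (toℕ z + p % suc n) % suc n                          ≡⟨ %-cong-+ˡ (toℕ z) {p % suc n} {p} (suc n) (m%n%n≡m%n p (suc n)) ⟩
      (toℕ z + p) % suc n                                  ≡⟨ cong (_% suc n) (+-comm (toℕ z) p) ⟩
      (p + toℕ z) % suc n                                  ∎
      where open ≡-Reasoning
    eqℕ : (q + toℕ x) % suc n ≡ (q′ + toℕ x′) % suc n
    eqℕ = trans (sym (value x q)) (trans (cong toℕ eq) (value x′ q′))
    small : ∀ {a b} → a < n₁ → b < n₁ → a % suc n ≡ b % suc n → a ≡ b
    small a< b< e = trans (sym (m<n⇒m%n≡m (<-≤-trans a< n₁≤n))) (trans e (m<n⇒m%n≡m (<-≤-trans b< n₁≤n)))
    apart : Near (toℕ x) (toℕ x′) q q′ → _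
    apart (inj₁ (refl , x≢)) = x≢ (small (toℕ<n x) (toℕ<n x′) (%-cancelˡ q {toℕ x} {toℕ x′} (suc n) eqℕ))
    apart (inj₂ (refl , lt)) = <⇒≢ lt (sym (small (toℕ<n x) (<-trans lt (toℕ<n x))
      (%-cancelˡ q {toℕ x} {suc (toℕ x′)} (suc n) (trans eqℕ (cong (_% suc n) (sym (+-suc q (toℕ x′))))))))

  -- A distance of at most n₁ - 2 crosses at most one block boundary, and in crossing it the column
  -- drops by n₁ - d ≥ 2. This is where windows of length n₁ would fail.
  near : ∀ t d → 0 < d → suc d < n₁ → Near (t % n₁) ((t + d) % n₁) (t / n₁) ((t + d) / n₁)
  near t d 0<d d< with t % n₁ + d <? n₁
  ... | yes lt = inj₁ (quot , λ eq → <⇒≢ 0<d (sym (+-cancelˡ-≡ (t % n₁) d 0 (trans (sym rem) (trans (sym eq) (sym (+-identityʳ _)))))))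
    where
    shape : t + d ≡ t % n₁ + d + t / n₁ * n₁
    shape = trans (cong (_+ d) (m≡m%n+[m/n]*n t n₁)) (trans (+-assoc (t % n₁) _ d) (trans (cong (t % n₁ +_) (+-comm _ d)) (sym (+-assoc (t % n₁) d _))))
    rem : (t + d) % n₁ ≡ t % n₁ + d
    rem = trans (cong (_% n₁) shape) (trans ([m+kn]%n≡m%n (t % n₁ + d) (t / n₁) n₁) (m<n⇒m%n≡m lt))
    quot : (t + d) / n₁ ≡ t / n₁
    quot = trans (cong (_/ n₁) shape) (trans (+-distrib-/-∣ʳ (t % n₁ + d) (n∣m*n (t / n₁)))
             (cong₂ _+_ (m<n⇒m/n≡0 lt) (m*n/n≡m (t / n₁) n₁)))
  ... | no ≮ = inj₂ (quot , x<)
    where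
    y = t % n₁ + d ∸ n₁
    y+n : y + n₁ ≡ t % n₁ + d
    y+n = m∸n+n≡m (≮⇒≥ ≮)
    y< : suc y < t % n₁
    y< = +-cancelʳ-< n₁ (suc y) (t % n₁) (<-≤-trans (≤-reflexive (cong (λ z → suc (suc z)) y+n))
           (≤-trans (≤-reflexive (trans (cong suc (sym (+-suc (t % n₁) d))) (sym (+-suc (t % n₁) (suc d))))) (+-monoʳ-≤ (t % n₁) d<)))
    y<n : y < n₁
    y<n = <-trans (<-trans ≤-refl y<) (m%n<n t n₁)
    shape : t + d ≡ y + suc (t / n₁) * n₁
    shape = trans (cong (_+ d) (m≡m%n+[m/n]*n t n₁)) (trans (+-assoc (t % n₁) _ d) (trans (cong (t % n₁ +_) (+-comm _ d))
      (trans (sym (+-assoc (t % n₁) d _)) (trans (cong (_+ t / n₁ * n₁) (sym y+n)) (+-assoc y n₁ _)))))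
    rem : (t + d) % n₁ ≡ y
    rem = trans (cong (_% n₁) shape) (trans ([m+kn]%n≡m%n y (suc (t / n₁)) n₁) (m<n⇒m%n≡m y<n))
    quot : (t + d) / n₁ ≡ suc (t / n₁)
    quot = trans (cong (_/ n₁) shape) (trans (+-distrib-/-∣ʳ y (n∣m*n (suc (t / n₁))))
             (cong₂ _+_ (m<n⇒m/n≡0 y<n) (m*n/n≡m (suc (t / n₁)) n₁)))
    x< : suc ((t + d) % n₁) < t % n₁
    x< = subst (λ z → suc z < t % n₁) (sym rem) y<

  order-disjoint : ∀ t d → 0 < d → suc d < n₁ → Disjoint (order t) (order (t + d))
  order-disjoint t d 0<d d< zero eq = x≢ (near t d 0<d d<)
    where
    eq′ : t % n₁ ≡ (t + d) % n₁
    eq′ = trans (sym (toℕ-mod t n₁)) (trans (cong toℕ eq) (toℕ-mod (t + d) n₁))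
    x≢ : Near (t % n₁) ((t + d) % n₁) (t / n₁) ((t + d) / n₁) → _
    x≢ (inj₁ (_ , ne)) = ne eq′
    x≢ (inj₂ (_ , lt)) = <-irrefl (sym eq′) (<-trans (n<1+n _) lt)
  order-disjoint t d 0<d d< (suc j) eq = shifted-apart nonZeros le
    (subst₂ (λ a b → Near a b (t / n₁) ((t + d) / n₁)) (sym (toℕ-mod t n₁)) (sym (toℕ-mod (t + d) n₁)) (near t d 0<d d<)) j
    (trans (sym (lookup-cell (t mod n₁) (digits nonZeros (t / n₁)) j)) (trans eq (lookup-cell ((t + d) mod n₁) (digits nonZeros ((t + d) / n₁)) j)))

  window : ℕ → ℕ → List (Edge (n₁ ∷ ns))
  window r t = applyUpTo (λ i → order (t + i)) r

  window-matching : ∀ {r} t → r < n₁ → IsMatching (window r t)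
  window-matching {r} t r<n₁ = AllPairs.applyUpTo⁺₁ _ r λ {i} {j} i<j j<r →
    subst (λ z → Disjoint (order (t + i)) (order z)) (trans (+-assoc t i (j ∸ i)) (cong (t +_) (m+[n∸m]≡n (<⇒≤ i<j))))
      (order-disjoint (t + i) (j ∸ i) (m<n⇒0<n∸m i<j) (≤-trans (s≤s (≤-trans (s≤s (m∸n≤m j i)) j<r)) r<n₁))

-- Katona's cycle lemma

∑< : ℕ → (ℕ → ℕ) → ℕ
∑< zero    f = 0
∑< (suc n) f = f 0 + ∑< n (f ∘ suc)

∑-applyUpTo : ∀ {A : Set} (h : ℕ → A) n f → ∑ (applyUpTo h n) f ≡ ∑< n (f ∘ h)
∑-applyUpTo h zero    f = refl
∑-applyUpTo h (suc n) f = cong (f (h 0) +_) (∑-applyUpTo (h ∘ suc) n f)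

∑<-cong : ∀ n {f g} → (∀ i → i < n → f i ≡ g i) → ∑< n f ≡ ∑< n g
∑<-cong zero    eq = refl
∑<-cong (suc n) eq = cong₂ _+_ (eq 0 z<s) (∑<-cong n λ i i<n → eq (suc i) (s<s i<n))

∑<-zero : ∀ n {f} → (∀ i → i < n → f i ≡ 0) → ∑< n f ≡ 0
∑<-zero zero    eq = refl
∑<-zero (suc n) eq = cong₂ _+_ (eq 0 z<s) (∑<-zero n λ i i<n → eq (suc i) (s<s i<n))

∑<-split : ∀ a b f → ∑< (a + b) f ≡ ∑< a f + ∑< b (λ i → f (a + i))
∑<-split zero    b f = refl
∑<-split (suc a) b f = trans (cong (f 0 +_) (∑<-split a b (f ∘ suc))) (sym (+-assoc (f 0) _ _))

∑<-+ : ∀ n f g → ∑< n (λ i → f i + g i) ≡ ∑< n f + ∑< n g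
∑<-+ zero    f g = refl
∑<-+ (suc n) f g = trans (cong (f 0 + g 0 +_) (∑<-+ n (f ∘ suc) (g ∘ suc)))
  (trans (+-assoc (f 0) _ _) (trans (cong (f 0 +_) (trans (sym (+-assoc (g 0) F G)) (trans (cong (_+ G) (+-comm (g 0) F)) (+-assoc F (g 0) G))))
    (sym (+-assoc (f 0) F _))))
  where
  F = ∑< n (f ∘ suc)
  G = ∑< n (g ∘ suc)

∑<-≤ : ∀ n {f} → (∀ i → i < n → f i ≤ 1) → ∑< n f ≤ n
∑<-≤ zero    le = z≤n
∑<-≤ (suc n) le = +-mono-≤ (le 0 z<s) (∑<-≤ n λ i i<n → le (suc i) (s<s i<n))

∑<-tight : ∀ n {f} → (∀ i → i < n → f i ≤ 1) → ∑< n f ≡ n → ∀ i → i < n → f i ≢ 0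
∑<-tight (suc n) {f} le eq i i<n f≡0 = <-irrefl eq (lt i i<n f≡0)
  where
  lt : ∀ i → i < suc n → f i ≡ 0 → f 0 + ∑< n (f ∘ suc) < suc n
  lt zero    _         f≡0 = s≤s (≤-trans (≤-reflexive (cong (_+ ∑< n (f ∘ suc)) f≡0)) (∑<-≤ n λ i i<n → le (suc i) (s<s i<n)))
  lt (suc i) (s≤s i<n) f≡0 = +-mono-≤-< (le 0 z<s) (≤∧≢⇒< (∑<-≤ n λ i i<n → le (suc i) (s<s i<n))
    λ eq′ → ∑<-tight n (λ i i<n → le (suc i) (s<s i<n)) eq′ i i<n f≡0)

∑<-rotate : ∀ N {f} → (∀ t → f (t + N) ≡ f t) → ∀ s → ∑< N (λ i → f (s + i)) ≡ ∑< N f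
∑<-rotate N periodic zero = refl
∑<-rotate N {f} periodic (suc s) = trans (∑<-cong N λ i _ → cong f (sym (+-suc s i))) (trans (+-cancelˡ-≡ (h 0) _ _ (begin
  h 0 + ∑< N (h ∘ suc)     ≡⟨ cong (λ n → ∑< n h) (+-comm 1 N) ⟩
  ∑< (N + 1) h             ≡⟨ ∑<-split N 1 h ⟩
  ∑< N h + (h (N + 0) + 0) ≡⟨ cong (∑< N h +_) (trans (+-identityʳ _) (cong h (+-identityʳ N))) ⟩
  ∑< N h + h N             ≡⟨ +-comm (∑< N h) (h N) ⟩
  h N + ∑< N h             ≡⟨ cong (_+ ∑< N h) (trans (periodic s) (cong f (sym (+-identityʳ s)))) ⟩
  h 0 + ∑< N h             ∎)) (∑<-rotate N periodic s))
  where
  open ≡-Reasoning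
  h : ℕ → ℕ
  h i = f (s + i)

-- g marks the starting points of a family of arcs of length 1 + r′ on a cycle of length N.
module Katona {N r′ : ℕ} (2r≤N : suc r′ + suc r′ ≤ N) (g : ℕ → ℕ) (g≤1 : ∀ t → g t ≤ 1)
  (periodic : ∀ t → g (t + N) ≡ g t)
  (close : ∀ t u → g t ≢ 0 → g u ≢ 0 → ∃₂ λ i j → i ≤ r′ × j ≤ r′ × t + i ≈ u + j [mod N ]) where

  r = suc r′

  instance
    N≢0 : NonZero N
    N≢0 = >-nonZero (≤-trans (s≤s z≤n) 2r≤N)

  no-multiple : ∀ {D} a b → 0 < D → D < N → D + a * N ≢ b * N
  no-multiple {D} a b 0<D D<N eq = <⇒≢ 0<D (sym (begin
    D               ≡⟨ m<n⇒m%n≡m D<N ⟨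
    D % N           ≡⟨ [m+kn]%n≡m%n D a N ⟨
    (D + a * N) % N ≡⟨ cong (_% N) eq ⟩
    (b * N) % N     ≡⟨ m*n%n≡0 b N ⟩
    0               ∎))
    where open ≡-Reasoning

  -- A common point of the two arcs would make d + j - i a multiple of N, while r ≤ d ≤ N - r puts
  -- it strictly between 0 and N.
  apart : ∀ t d → r ≤ d → d + r ≤ N → g t ≢ 0 → g (t + d) ≡ 0
  apart t d r≤d d+r≤N gt≢0 = decidable-stable (g (t + d) ℕ.≟ 0) λ gu≢0 →
    let i , j , i≤ , j≤ , a , b , eq = close t (t + d) gt≢0 gu≢0
        i≤d+j : i ≤ d + j
        i≤d+j = ≤-trans i≤ (≤-trans (≤-trans (n≤1+n r′) r≤d) (m≤m+n d j))
        D = d + j ∸ i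
        D+i : D + i ≡ d + j
        D+i = m∸n+n≡m i≤d+j
        eq′ : t + (i + a * N) ≡ t + (i + (D + b * N))
        eq′ = trans (sym (+-assoc t i (a * N))) (trans eq (trans (cong (_+ b * N) (trans (+-assoc t d j) (cong (t +_) (trans (sym D+i) (+-comm D i)))))
                (trans (+-assoc t (i + D) (b * N)) (cong (t +_) (+-assoc i D (b * N))))))
    in no-multiple {D} b a (m<n⇒0<n∸m (≤-trans (s≤s i≤) (≤-trans r≤d (m≤m+n d j))))
         (≤-trans (s≤s (≤-trans (m∸n≤m (d + j) i) (+-monoʳ-≤ d j≤))) (≤-trans (≤-reflexive (sym (+-suc d r′))) d+r≤N))
         (sym (+-cancelˡ-≡ i _ _ (+-cancelˡ-≡ t _ _ eq′)))

  module _ {t₀ : ℕ} (gt₀≢0 : g t₀ ≢ 0) where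

    r′≤N : r′ ≤ N
    r′≤N = ≤-trans (≤-trans (n≤1+n r′) (m≤m+n r r)) 2r≤N

    -- This is t₀ - r′ modulo N, lifted by one period to stay in ℕ; the marked arc sits at offset
    -- `r′`.
    s = t₀ + (N ∸ r′)

    s+r′ : s + r′ ≡ t₀ + N
    s+r′ = trans (+-assoc t₀ (N ∸ r′) r′) (cong (t₀ +_) (m∸n+n≡m r′≤N))

    h : ℕ → ℕ
    h k = g (s + k)

    h-mid : h r′ ≢ 0
    h-mid eq = gt₀≢0 (trans (sym (periodic t₀)) (trans (cong g (sym s+r′)) eq))

    rest = N ∸ (r + r′)

    N-split : r′ + (1 + (r′ + rest)) ≡ N
    N-split = trans (+-suc r′ (r′ + rest)) (trans (cong suc (sym (+-assoc r′ r′ rest)))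
      (m+[n∸m]≡n (≤-trans (+-monoʳ-≤ r (n≤1+n r′)) 2r≤N)))

    -- The other arcs that meet the one at t₀ fall into `r′` pairs with starts at distance `r`.
    -- Since 2r ≤ N, the two arcs of a pair are disjoint and at most one is marked.
    pair : ℕ → ℕ
    pair i = h i + h (r + i)

    pair≤1 : ∀ i → i < r′ → pair i ≤ 1
    pair≤1 i _ with h i ℕ.≟ 0
    ... | yes ≡0 = ≤-trans (≤-reflexive (cong (_+ h (r + i)) ≡0)) (g≤1 _)
    ... | no ≢0 = ≤-trans (≤-reflexive (trans (cong (h i +_) (trans (cong g (trans (cong (s +_) (+-comm r i)) (sym (+-assoc s i r))))
                    (apart (s + i) r ≤-refl 2r≤N ≢0))) (+-identityʳ (h i)))) (g≤1 _)

    far≡0 : ∀ i → i < rest → h (r + (r′ + i)) ≡ 0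
    far≡0 i i<rest = trans (cong g place) (apart (s + r′) (r + i) (m≤m+n r i) fits h-mid)
      where
      place : s + (r + (r′ + i)) ≡ s + r′ + (r + i)
      place = trans (cong (s +_) (trans (sym (+-assoc r r′ i)) (trans (cong (_+ i) (+-comm r r′)) (+-assoc r′ r i)))) (sym (+-assoc s r′ (r + i)))
      fits : r + i + r ≤ N
      fits = ≤-trans (≤-reflexive (trans (+-assoc r i r) (cong (r +_) (trans (+-suc i r′) (trans (cong suc (+-comm i r′)) (sym (+-suc r′ i)))))))
        (≤-trans (≤-reflexive (sym (+-assoc r r′ (suc i)))) (≤-trans (+-monoʳ-≤ (r + r′) i<rest)
          (≤-reflexive (m+[n∸m]≡n (≤-trans (+-monoʳ-≤ r (n≤1+n r′)) 2r≤N)))))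

    total : ∑< N g ≡ ∑< r′ pair + h r′
    total = begin
      ∑< N g                       ≡⟨ ∑<-rotate N periodic s ⟨
      ∑< N h                       ≡⟨ cong (λ n → ∑< n h) N-split ⟨
      ∑< (r′ + (1 + (r′ + rest))) h ≡⟨ ∑<-split r′ (1 + (r′ + rest)) h ⟩
      left + (h (r′ + 0) + ∑< (r′ + rest) (λ i → h (r′ + suc i)))
        ≡⟨ cong (left +_) (cong₂ _+_ (cong h (+-identityʳ r′)) (∑<-cong (r′ + rest) λ i _ → cong h (+-suc r′ i))) ⟩
      left + (h r′ + ∑< (r′ + rest) (λ i → h (r + i)))
        ≡⟨ cong (λ z → left + (h r′ + z)) (trans (∑<-split r′ rest _) (cong (right +_) (∑<-zero rest far≡0))) ⟩
      left + (h r′ + (right + 0))         ≡⟨ cong (λ z → left + (h r′ + z)) (+-identityʳ right) ⟩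
      left + (h r′ + right)               ≡⟨ cong (left +_) (+-comm (h r′) right) ⟩
      left + (right + h r′)               ≡⟨ +-assoc left right (h r′) ⟨
      left + right + h r′                 ≡⟨ cong (_+ h r′) (∑<-+ r′ h (λ i → h (r + i))) ⟨
      ∑< r′ pair + h r′            ∎
      where
      open ≡-Reasoning
      left = ∑< r′ h
      right = ∑< r′ (λ i → h (r + i))

    bound-at : ∑< N g ≤ r
    bound-at = ≤-trans (≤-reflexive total) (≤-trans (+-mono-≤ (∑<-≤ r′ pair≤1) (g≤1 (s + r′))) (≤-reflexive (+-comm r′ 1)))

    -- In case of equality no pair may be empty. The start `u` is t₀ - i modulo N, and the other arc
    -- of its pair begins `r` later.
    partner : ∑< N g ≡ r → ∀ i → 1 ≤ i → i ≤ r′ → ∃[ u ] (u + i ≡ t₀ + N × (g u ≢ 0 ⊎ g (u + r) ≢ 0))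
    partner tight i 1≤i i≤r′ = s + (r′ ∸ i) , trans (+-assoc s (r′ ∸ i) i) (trans (cong (s +_) (m∸n+n≡m i≤r′)) s+r′) , split
      where
      pairs : ∑< r′ pair ≡ r′
      pairs = ≤-antisym (∑<-≤ r′ pair≤1) (+-cancelʳ-≤ 1 r′ _ (≤-trans (≤-reflexive (trans (+-comm r′ 1) (trans (sym tight) total)))
                (+-monoʳ-≤ (∑< r′ pair) (g≤1 (s + r′)))))
      p = r′ ∸ i
      both : pair p ≢ 0
      both = ∑<-tight r′ pair≤1 pairs p (m∸n<r′ 1≤i i≤r′)
        where
        m∸n<r′ : ∀ {a b} → 1 ≤ a → a ≤ b → b ∸ a < b
        m∸n<r′ {suc a} {suc b} _ _ = s≤s (m∸n≤m b a)
      split : g (s + p) ≢ 0 ⊎ g (s + p + r) ≢ 0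
      split with g (s + p) ℕ.≟ 0
      ... | no ≢0  = inj₁ ≢0
      ... | yes ≡0 = inj₂ λ ≡0′ → both (cong₂ _+_ ≡0 (trans (cong g (trans (cong (s +_) (+-comm r p)) (sym (+-assoc s p r)))) ≡0′))

  start : ∑< N g ≢ 0 → ∃[ t ] g t ≢ 0
  start ≢0 = let t , _ , gt = ∑≢0⇒∃ (upTo N) g (≢0 ∘ trans (sym (∑-applyUpTo id N g))) in t , gt

  arcs≤r : ∑< N g ≤ r
  arcs≤r with ∑< N g ℕ.≟ 0
  ... | yes ≡0 = ≤-trans (≤-reflexive ≡0) z≤n
  ... | no ≢0  = bound-at (proj₂ (start ≢0))

  -- If the arc at t₀ crosses a multiple of n₁, then take i such that one of the two arcs starting at t₀ - i and t₀ - i + r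
  -- (of which a maximum family contains exactly one) ends at that multiple and the other one begins there.
  inside-block : ∀ n₁ .{{_ : NonZero n₁}} → r ≤ n₁ → ∃[ q ] N ≡ q * n₁ → ∑< N g ≡ r → ∃[ t ] (g t ≢ 0 × t % n₁ + r ≤ n₁)
  inside-block n₁ r≤n₁ (q , N≡) tight with start (λ ≡0 → contradiction (trans (sym tight) ≡0) λ ())
  ... | t₀ , gt₀ with t₀ % n₁ + r ≤? n₁
  ...   | yes le = t₀ , gt₀ , le
  ...   | no ≰ = case (partner gt₀ tight i 1≤i i≤r′)
    where
    x = t₀ % n₁
    i = x + r ∸ n₁
    i+n : i + n₁ ≡ x + r
    i+n = m∸n+n≡m (<⇒≤ (≰⇒> ≰))
    1≤i : 1 ≤ i
    1≤i = m<n⇒0<n∸m (≰⇒> ≰)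
    i≤r′ : i ≤ r′
    i≤r′ = +-cancelʳ-≤ n₁ i r′ (≤-trans (≤-reflexive (trans i+n (trans (+-suc x r′) (+-comm (suc x) r′)))) (+-monoʳ-≤ r′ (m%n<n t₀ n₁)))
    y = n₁ ∸ r
    y+r : y + r ≡ n₁
    y+r = m∸n+n≡m r≤n₁
    p = t₀ / n₁ + q
    t₀+N : t₀ + N ≡ x + p * n₁
    t₀+N = trans (cong₂ _+_ (m≡m%n+[m/n]*n t₀ n₁) N≡) (trans (+-assoc x _ _) (cong (x +_) (sym (*-distribʳ-+ n₁ (t₀ / n₁) q))))
    y+i : y + i ≡ x
    y+i = +-cancelʳ-≡ n₁ _ _ (trans (+-assoc y i n₁) (trans (cong (y +_) i+n) (trans (cong (y +_) (+-comm x r)) (trans (sym (+-assoc y r x)) (trans (cong (_+ x) y+r) (+-comm n₁ x))))))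
    case : ∃[ u ] (u + i ≡ t₀ + N × (g u ≢ 0 ⊎ g (u + r) ≢ 0)) → ∃[ t ] (g t ≢ 0 × t % n₁ + r ≤ n₁)
    case (u , u+i , marks) = choose marks
      where
      u≡ : u ≡ y + p * n₁
      u≡ = +-cancelʳ-≡ i _ _ (trans u+i (trans t₀+N (trans (cong (_+ p * n₁) (sym y+i)) (trans (+-assoc y i _) (trans (cong (y +_) (+-comm i _)) (sym (+-assoc y _ i)))))))
      choose : g u ≢ 0 ⊎ g (u + r) ≢ 0 → _
      choose (inj₁ gu) = u , gu , ≤-reflexive (trans (cong (_+ r) (trans (cong (_% n₁) u≡) (trans ([m+kn]%n≡m%n y p n₁) (m<n⇒m%n≡m y<n)))) y+r)
        where
        y<n : y < n₁
        y<n = ≤-trans (≤-trans (s≤s (m≤m+n y r′)) (≤-reflexive (sym (+-suc y r′)))) (≤-reflexive y+r)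
      choose (inj₂ gu) = u + r , gu , ≤-trans (≤-reflexive (cong (_+ r) (trans (cong (_% n₁) shape) (m*n%n≡0 (suc p) n₁)))) r≤n₁
        where
        shape : u + r ≡ suc p * n₁
        shape = trans (cong (_+ r) u≡) (trans (+-assoc y _ r) (trans (cong (y +_) (+-comm _ r)) (trans (sym (+-assoc y r _)) (cong (_+ p * n₁) y+r))))

-- Matchings as partial graphs of tuples of permutations

length-alls : ∀ {A : Set} {P : A → Set} {l : ∀ a → List (P a)} (f : A → ℕ) → (∀ a → length (l a) ≡ f a) →
              ∀ (xs : Vec A k) → length (alls l xs) ≡ Vec.foldr′ _*_ 1 (Vec.map f xs)
length-alls f eq [] = refl
length-alls {l = l} f eq (x ∷ xs) = begin
  length (alls l (x ∷ xs))                        ≡⟨ ones (alls l (x ∷ xs)) ⟩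
  ∑ (alls l (x ∷ xs)) (λ _ → 1)                   ≡⟨ ∑-cartesianProductWith _∷_ (l x) (alls l xs) (λ _ → 1) ⟩
  ∑ (l x) (λ _ → ∑ (alls l xs) (λ _ → 1))         ≡⟨ ∑-const (l x) _ ⟩
  length (l x) * ∑ (alls l xs) (λ _ → 1)          ≡⟨ cong₂ _*_ (eq x) (trans (sym (ones (alls l xs))) (length-alls f eq xs)) ⟩
  f x * Vec.foldr′ _*_ 1 (Vec.map f xs)           ∎
  where
  open ≡-Reasoning
  ones : ∀ {B : Set} (ys : List B) → length ys ≡ ∑ ys (λ _ → 1)
  ones ys = sym (trans (∑-const ys 1) (ℕ.*-identityʳ _))

edges : (ns : Vec ℕ k) → List (Edge ns)
edges = alls allFin

edges-unique : (ns : Vec ℕ k) → Unique (edges ns)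
edges-unique = alls-unique allFin⁺

∈-edges : {ns : Vec ℕ k} (e : Edge ns) → e ∈ edges ns
∈-edges e = ∈-alls⁺ λ i → ∈-allFin _

length-edges : (ns : Vec ℕ k) → length (edges ns) ≡ size ns
length-edges = length-alls id (λ n → length-tabulate id)

-- If `p x` differs from `y`, a non-trivial shift of the argument gives `x` the value `y` and agrees
-- with `p` nowhere. If `p x` is `y`, then `p` is composed with a permutation whose only fixed point
-- is `x`, a rotation of the other points; for this there must be at least two of them.
detour : ∀ {n} → 3 ≤ n → {p : Fin n → Fin n} → Inj p → ∀ x y →
         ∃[ q ] (Inj q × q x ≡ y × (∀ z → q z ≡ p z → z ≡ x))
detour {suc n} (s≤s 2≤n) {p} p-inj x y with p x ≟ y
... | no px≢y = (λ z → p (z ⊕ s)) , (⊕-cancelʳ s ∘ p-inj) , trans (cong p xs) py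
              , λ z eq → contradiction (trans (sym (cong p (⊕-identity (p-inj eq) x))) (trans (cong p xs) py)) px≢y
  where
  y′ = proj₁ (inj⇒surj p-inj y)
  py = proj₂ (inj⇒surj p-inj y)
  s  = proj₁ (⊕-solve x y′)
  xs = proj₂ (⊕-solve x y′)
... | yes px≡y = p ∘ κ , (κ-inj ∘ p-inj) , trans (cong p κx) px≡y , λ z eq → κ-fix (p-inj eq)
  where
  rotate : ∀ {n} → 2 ≤ n → ∃[ f ] (Inj f × (∀ (i : Fin n) → f i ≢ i))
  rotate {suc (suc n)} _ = (_⊕ 1F) , ⊕-cancelʳ 1F , λ i eq → contradiction (⊕-cancelˡ i {1F} {0F} (trans eq (sym (⊕-zeroʳ i)))) λ ()
  rotate {suc zero} (s≤s ())
  ρ = proj₁ (rotate 2≤n)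
  t = transpose x zero
  κ₀ : Fin (suc n) → Fin (suc n)
  κ₀ zero    = zero
  κ₀ (suc i) = suc (ρ i)
  κ₀-inj : Inj κ₀
  κ₀-inj {zero}  {zero}  _  = refl
  κ₀-inj {suc i} {suc j} eq = cong suc (proj₁ (proj₂ (rotate 2≤n)) (suc-injective eq))
  κ₀-fix : ∀ z → κ₀ z ≡ z → z ≡ zero
  κ₀-fix zero    _  = refl
  κ₀-fix (suc i) eq = contradiction (suc-injective eq) (proj₂ (proj₂ (rotate 2≤n)) i)
  κ : Fin (suc n) → Fin (suc n)
  κ = transpose zero x ∘ κ₀ ∘ t
  κ-inj : Inj κ
  κ-inj = transpose-inj x zero ∘ κ₀-inj ∘ transpose-inj zero x
  κx : κ x ≡ x
  κx = trans (cong (transpose zero x ∘ κ₀) (transpose-fst x zero)) (transpose-fst zero x)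
  κ-fix : ∀ {z} → κ z ≡ z → z ≡ x
  κ-fix {z} eq = transpose-inj x zero (trans (κ₀-fix (t z) (trans (sym (transpose-inverse x zero)) (cong t eq))) (sym (transpose-fst x zero)))

module _ {ns : Vec ℕ k} where
  open Tuples ns

  -- Right multiplication by `δ` permutes the group. With a row of a Latin square as `δ`, this makes
  -- the number of translates in S the same for all rows and all squares.
  ∑-translate : ∀ {δ} → Injs δ → (h : Tuple → ℕ) → (∀ {γ γ′} → (∀ j x → γ j x ≡ γ′ j x) → h γ ≡ h γ′) →
                ∑ (group ns) (λ A → h (⟦ A ⟧ ⊙ δ)) ≡ ∑ (group ns) (λ A → h ⟦ A ⟧)
  ∑-translate {δ} δi h h-ext = trans
    (∑-cong (group ns) λ {A} _ → h-ext λ j x → sym (⟦toPerms⟧ (⟦ A ⟧ ⊙ δ) j x))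
    (∑-reindex (≡-decᵃ (≡-dec _≟_)) (λ A → toPerms (⟦ A ⟧ ⊙ δ)) (λ A → h ⟦ A ⟧) (alls-unique perms-unique ns)
      (λ A∈ → toPerms∈group (⊙-injs (group-inj A∈) δi))
      λ {A} {B} _ _ eq → lookup⁺-injective λ j → lookup-ext λ x →
        let y , δy≡x = inj⇒surj (δi j) x in
        subst (λ z → ⟦ A ⟧ j z ≡ ⟦ B ⟧ j z) δy≡x
          (trans (sym (⟦toPerms⟧ (⟦ A ⟧ ⊙ δ) j y)) (trans (cong (λ C → ⟦ C ⟧ j y) eq) (⟦toPerms⟧ (⟦ B ⟧ ⊙ δ) j y))))
    where
    lookup-ext : ∀ {m n} {u v : Vec (Fin m) n} → (∀ x → lookup u x ≡ lookup v x) → u ≡ v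
    lookup-ext {u = u} {v} eq = trans (sym (tabulate∘lookup u)) (trans (tabulate-cong eq) (tabulate∘lookup v))

module Graphs {n₁ : ℕ} {ns : Vec ℕ k} {{nz₁ : NonZero n₁}} (le : VAll (n₁ ≤_) ns) where
  open Order le
  open Tuples ns

  -- e is an edge of the matching {(x, γ(x))} of size n₁.
  On : Tuple → Edge (n₁ ∷ ns) → Set
  On γ e = ∀ j → γ j (ι j (hd e)) ≡ lookup⁺ (tl e) j

  on? : ∀ γ e → Dec (On γ e)
  on? γ e = all? λ j → γ j (ι j (hd e)) ≟ lookup⁺ (tl e) j

  On-unique : ∀ {γ e f} → On γ e → On γ f → hd e ≡ hd f → e ≡ f
  On-unique {γ} {x ∷ e} {_ ∷ f} on-e on-f refl = cong (x ∷_) (lookup⁺-injective λ j → trans (sym (on-e j)) (on-f j))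

  extend-matching : ∀ {M} → IsMatching M → ∃[ γ ] (Injs γ × All (On γ) M)
  extend-matching {M} mM = (λ j → proj₁ (f j)) , (λ j → proj₁ (proj₂ (f j)))
    , All.tabulate λ {e} e∈ j → All.lookup (All.map⁻ (proj₂ (proj₂ (f j)))) e∈
    where
    arcs : ∀ j → Edge (n₁ ∷ ns) → Fin (lookup ns j) × Fin (lookup ns j)
    arcs j e = ι j (hd e) , lookup⁺ (tl e) j
    sources : ∀ j → Unique (map proj₁ (map (arcs j) M))
    sources j = AllPairs.map⁺ (AllPairs.map⁺ (AllPairs.map (λ { {_ ∷ _} {_ ∷ _} dis eq → dis zero (ι-inj j eq) }) mM))
    targets : ∀ j → Unique (map proj₂ (map (arcs j) M))
    targets j = AllPairs.map⁺ (AllPairs.map⁺ (AllPairs.map (λ { {_ ∷ _} {_ ∷ _} dis eq → dis (suc j) eq }) mM))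
    f = λ j → extend (map (arcs j) M) (sources j) (targets j)

  -- A single coordinate suffices to avoid `M`. In coordinate `j₀` the new permutation agrees with
  -- an extension of `M` only in the column of `e`, and an edge of `M` on `h` in that column would
  -- be `e` itself.
  evade : Fin k → 3 ≤ n₁ → ∀ {M e} → IsMatching M → e ∉ M →
          ∃[ γ ] (Injs γ × On γ e × (∀ {f} → f ∈ M → ¬ On γ f))
  evade j₀ 3≤n₁ {M} {e} mM e∉M = h , h-injs , on-e , misses
    where
    p = proj₁ (extend-matching mM)
    p-injs = proj₁ (proj₂ (extend-matching mM))
    p-on = proj₂ (proj₂ (extend-matching mM))
    found = detour (ℕ.≤-trans 3≤n₁ (lookup⁺ le j₀)) (p-injs j₀) (ι j₀ (hd e)) (lookup⁺ (tl e) j₀)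
    q = proj₁ found
    through : Tuple
    through j = transpose (ι j (hd e)) (lookup⁺ (tl e) j)
    h : Tuple
    h = override j₀ q through
    h-same : ∀ x → h j₀ x ≡ q x
    h-same x = cong (λ g → g x) (override-same {A = λ i → Fin (lookup ns i) → Fin (lookup ns i)} j₀ q through)
    h-other : ∀ {j} → j ≢ j₀ → ∀ x → h j x ≡ through j x
    h-other j≢ x = cong (λ g → g x) (override-other {A = λ i → Fin (lookup ns i) → Fin (lookup ns i)} q through j≢)
    h-injs : Injs h
    h-injs j {x} {y} eq = case j ≟ j₀ of λ where
      (yes refl) → proj₁ (proj₂ found) (trans (sym (h-same x)) (trans eq (h-same y)))
      (no j≢)    → transpose-inj _ _ (trans (sym (h-other j≢ x)) (trans eq (h-other j≢ y)))
    on-e : On h e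
    on-e j = case j ≟ j₀ of λ where
      (yes refl) → trans (h-same _) (proj₁ (proj₂ (proj₂ found)))
      (no j≢)    → trans (h-other j≢ _) (transpose-fst (ι j (hd e)) (lookup⁺ (tl e) j))
    misses : ∀ {f} → f ∈ M → ¬ On h f
    misses {f} f∈ on-f = e∉M (subst (_∈ M) (On-unique {h} on-f on-e same-head) f∈)
      where
      same-head : hd f ≡ hd e
      same-head = ι-inj j₀ (proj₂ (proj₂ (proj₂ found)) (ι j₀ (hd f))
        (trans (sym (h-same _)) (trans (on-f j₀) (sym (All.lookup p-on f∈ j₀)))))

-- Families of r-matchings for a fixed r

∏-cong : ∀ {k} (f g : ℕ → ℕ) {ns : Vec ℕ k} → VAll (λ n → f n ≡ g n) ns → ∏ f ns ≡ ∏ g ns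
∏-cong f g []         = refl
∏-cong f g (eq ∷ eqs) = cong₂ _*_ eq (∏-cong f g eqs)

∏>0 : ∀ {k} (f : ℕ → ℕ) {ns : Vec ℕ k} → VAll (λ n → 0 < f n) ns → 0 < ∏ f ns
∏>0 f []       = s≤s z≤n
∏>0 f (p ∷ ps) = ℕ.*-mono-≤ p (∏>0 f ps)

Distinct-≡ : ∀ {ns : Vec ℕ m} {F : List (List (Edge ns))} → Distinct F → ∀ {M M′} → M ∈ F → M′ ∈ F →
             (∀ {e} → e ∈ M → e ∈ M′) → (∀ {e} → e ∈ M′ → e ∈ M) → M ≡ M′
Distinct-≡ (d ∷ ds) (here refl) (here refl) _ _ = refl
Distinct-≡ (d ∷ ds) (here refl) (there M′∈) to from = ⊥-elim (All.lookup d M′∈ (mk⇔ to from))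
Distinct-≡ (d ∷ ds) (there M∈)  (here refl) to from = ⊥-elim (All.lookup d M∈ (mk⇔ from to))
Distinct-≡ (d ∷ ds) (there M∈)  (there M′∈) to from = Distinct-≡ ds M∈ M′∈ to from

Distinct⇒Unique : ∀ {ns : Vec ℕ m} {F : List (List (Edge ns))} → Distinct F → Unique F
Distinct⇒Unique = AllPairs.map λ { ≉ refl → ≉ (mk⇔ id id) }

module Level {n₁ : ℕ} {ns : Vec ℕ (suc m)} {{nz₁ : NonZero n₁}} (le : VAll (n₁ ≤_) ns) {r : ℕ} (1≤r : 1 ≤ r) (r≤n₁ : r ≤ n₁) where

  open Order le
  open Graphs le
  open Tuples ns

  -- `volume` counts the tuples of permutations that carry one given r-matching onto another, `P₁`
  -- those that carry one given edge to another.
  volume P₁ : ℕ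
  volume = r ! * ∏ (λ n → (n ∸ r) !) (n₁ ∷ ns)
  P₁ = ∏ (λ n → (n ∸ 1) !) (n₁ ∷ ns)

  1≤ns : VAll (1 ≤_) (n₁ ∷ ns)
  1≤ns = ℕ.>-nonZero⁻¹ n₁ ∷ VAll.map (ℕ.≤-trans (ℕ.>-nonZero⁻¹ n₁)) le

  r≤ns : VAll (r ≤_) (n₁ ∷ ns)
  r≤ns = r≤n₁ ∷ VAll.map (ℕ.≤-trans r≤n₁) le

  group-size : length (group (n₁ ∷ ns)) ≡ N * P₁
  group-size = trans (length-group {ns = n₁ ∷ ns}) (trans (∏-cong _! (λ n → n * (n ∸ 1) !) (VAll.map factor 1≤ns)) (∏-* id (λ n → (n ∸ 1) !) (n₁ ∷ ns)))
    where
    factor : ∀ {n} → 1 ≤ n → n ! ≡ n * (n ∸ 1) !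
    factor {suc n} _ = refl

  prefix : List (Edge (n₁ ∷ ns))
  prefix = map (λ x → cell x (digits nonZeros 0)) (take r (allFin n₁))

  prefix-matching : IsMatching prefix
  prefix-matching = AllPairs.map⁺ (AllPairs.map (λ {x} {y} → cell-disjoint {x} {y} (digits nonZeros 0)) (Unique.take⁺ r (allFin⁺ n₁)))

  prefix-length : length prefix ≡ r
  prefix-length = trans (length-map _ (take r (allFin n₁))) (trans (length-take r (allFin n₁))
    (trans (cong (r ℕ.⊓_) (length-tabulate id)) (ℕ.m≤n⇒m⊓n≡m r≤n₁)))

  module Family (F : List (List (Edge (n₁ ∷ ns)))) (distinct : Distinct F)
    (matchings : ∀ {M} → M ∈ F → IsMatching M × length M ≡ r) where

    hits : Perms (n₁ ∷ ns) → List (Edge (n₁ ∷ ns)) → ℕ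
    hits γ W = ∑ F (λ M → 𝟙 (into? M γ W))

    total-hits : ∀ {W} → IsMatching W → length W ≡ r → ∑ (group (n₁ ∷ ns)) (λ γ → hits γ W) ≡ length F * volume
    total-hits {W} mW lW = trans (∑-swap (group (n₁ ∷ ns)) F (λ γ M → 𝟙 (into? M γ W)))
      (trans (∑-cong F λ {M} M∈ → let mM , lM = matchings M∈ in
                trans (count-into mM mW (trans lW (sym lM)) (subst (λ l → VAll (l ≤_) (n₁ ∷ ns)) (sym lM) r≤ns))
                      (cong (λ l → l ! * ∏ (λ n → (n ∸ l) !) (n₁ ∷ ns)) lM))
             (∑-const F volume))

    module _ {γ : Perms (n₁ ∷ ns)} (γ∈ : γ ∈ group (n₁ ∷ ns)) {W : List (Edge (n₁ ∷ ns))} (mW : IsMatching W) (lW : length W ≡ r) where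

      onto : ∀ {M} → M ∈ F → Into M γ W → ∀ {e} → e ∈ M → ∃[ w ] (w ∈ W × e ≡ act γ w)
      onto {M} M∈ into e∈ = ∈-map⁻ (act γ) (Unique-⊆-⊇ (matching-unique (act-matching γ∈ mW))
        (λ e∈ → let w , w∈ , eq = ∈-map⁻ (act γ) e∈ in subst (_∈ M) (sym eq) (All.lookup into w∈))
        (ℕ.≤-reflexive (trans (proj₂ (matchings M∈)) (sym (trans (length-map (act γ) W) lW)))) e∈)

      hits≤1 : hits γ W ≤ 1
      hits≤1 = ∑≤1 (λ M → 𝟙 (into? M γ W)) (Distinct⇒Unique distinct) (λ {M} _ → 𝟙≤1 (into? M γ W)) λ {M} {M′} M∈ M′∈ h h′ →
        let i  = 𝟙⇒ (into? M γ W) h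
            i′ = 𝟙⇒ (into? M′ γ W) h′
            transfer : ∀ {A B} → A ∈ F → Into A γ W → Into B γ W → ∀ {e} → e ∈ A → e ∈ B
            transfer {_} {B} A∈ a b e∈ = let w , w∈ , eq = onto A∈ a e∈ in subst (_∈ B) (sym eq) (All.lookup b w∈)
        in Distinct-≡ distinct M∈ M′∈ (transfer M∈ i i′) (transfer M′∈ i′ i)

      hit : hits γ W ≢ 0 → ∃[ M ] (M ∈ F × Into M γ W)
      hit ≢0 = let M , M∈ , h = ∑≢0⇒∃ F (λ M → 𝟙 (into? M γ W)) ≢0 in M , M∈ , 𝟙⇒ (into? M γ W) h

    -- A tuple that carries `prefix` onto a matching through `e` hits exactly one member, any other
    -- tuple none. So both totals over the group are known.
    star-count : ∀ e → (∀ M → IsMatching M → length M ≡ r → (M ∈ᶠ F ⇔ e ∈ M)) → length F * volume ≡ r * P₁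
    star-count e star = trans (sym (total-hits prefix-matching prefix-length))
      (trans (∑-cong (group (n₁ ∷ ns)) λ {γ} γ∈ → per γ γ∈)
        (trans (count-cover e prefix-matching 1≤ns) (cong (_* P₁) prefix-length)))
      where
      per : ∀ γ → γ ∈ group (n₁ ∷ ns) → hits γ prefix ≡ 𝟙 (covers? e γ prefix)
      per γ γ∈ = case covers? e γ prefix of λ where
          (yes c) → trans (ℕ.≤-antisym (hits≤1 γ∈ prefix-matching prefix-length) (present c)) (sym (𝟙-yes (covers? e γ prefix) c))
          (no ¬c) → trans (decidable-stable (hits γ prefix ℕ.≟ 0) (¬c ∘ absent)) (sym (𝟙-no (covers? e γ prefix) ¬c))
        where
        image = map (act γ) prefix
        present : Any (λ w → act γ w ≡ e) prefix → 1 ≤ hits γ prefix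
        present c with Equivalence.from (star image (act-matching γ∈ prefix-matching) (trans (length-map (act γ) prefix) prefix-length))
                         (let w , w∈ , eq = find c in subst (_∈ image) eq (∈-map⁺ (act γ) w∈))
        ... | image∈F with find image∈F
        ...   | M , M∈ , image≈M = ℕ.≤-trans (ℕ.≤-reflexive (sym (𝟙-yes (into? M γ prefix)
                (All.tabulate λ w∈ → Equivalence.to image≈M (∈-map⁺ (act γ) w∈))))) (∈⇒≤∑ (λ M → 𝟙 (into? M γ prefix)) M∈)
        absent : hits γ prefix ≢ 0 → Any (λ w → act γ w ≡ e) prefix
        absent ≢0 = let M , M∈ , into = hit γ∈ prefix-matching prefix-length ≢0
                        mM , lM = matchings M∈
                        e∈M = Equivalence.to (star M mM lM) (lose M∈ (mk⇔ id id))
                        w , w∈ , eq = onto γ∈ prefix-matching prefix-length M∈ into e∈M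
                    in lose w∈ (sym eq)

    module Meeting (intersecting : Intersecting F) where

      common : ∀ {γ} (γ∈ : γ ∈ group (n₁ ∷ ns)) {V W} (mV : IsMatching V) (lV : length V ≡ r) (mW : IsMatching W) (lW : length W ≡ r) →
               hits γ V ≢ 0 → hits γ W ≢ 0 → ∃[ e ] (e ∈ V × e ∈ W)
      common γ∈ {V} mV lV mW lW hV hW =
        let M , M∈ , i   = hit γ∈ mV lV hV
            M′ , M′∈ , i′ = hit γ∈ mW lW hW
            e , e∈ , e∈′  = intersecting M∈ M′∈
            v , v∈ , eq   = onto γ∈ mV lV M∈ i e∈
            w , w∈ , eq′  = onto γ∈ mW lW M′∈ i′ e∈′
            w≡v = act-injective γ∈ (trans (sym eq′) eq)
        in w , subst (_∈ V) (sym w≡v) v∈ , w∈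

      S : Tuple → Set
      S γ = Any (All (On γ)) F

      S? : ∀ γ → Dec (S γ)
      S? γ = Any.any? (All.all? (on? γ)) F

      S-ext : ∀ γ δ → (∀ j x → γ j x ≡ δ j x) → S γ → S δ
      S-ext γ δ eq = Any.map (All.map λ on j → trans (sym (eq j _)) (on j))

      S-meet : ∀ γ δ → S γ → S δ → ∃[ x ] (∀ j → γ j (ι j x) ≡ δ j (ι j x))
      S-meet γ δ Sγ Sδ =
                     let M , M∈ , on = find Sγ
                         M′ , M′∈ , on′ = find Sδ
                         e , e∈ , e∈′ = intersecting M∈ M′∈
                     in hd e , λ j → trans (All.lookup on e∈ j) (sym (All.lookup on′ e∈′ j))

      cyclics : Tuples.Family ns
      cyclics j = cyclic (lookup ns j)

      -- The first coordinate is normalised to the identity, because the perfect matchings in S are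
      -- written as graphs over the first part.
      lift : Tuple → Perms (n₁ ∷ ns)
      lift γ = tabulate id ∷ toPerms γ

      lift∈ : ∀ {γ} → Injs γ → lift γ ∈ group (n₁ ∷ ns)
      lift∈ {γ} γi = ∈-alls⁺ {p = lift γ} λ where
        zero    → tabulate∈perms id
        (suc i) → ∈-alls⁻ (toPerms∈group γi) i

      lift-cell : ∀ {γ} x s → On (γ ⊙ rowᶠ cyclics (lookup⁺ s)) (act (lift γ) (cell x s))
      lift-cell {γ} x s j = begin
        γ j (ι j (lookup (tabulate id) x) ⊕ lookup⁺ s j)     ≡⟨ cong (λ z → γ j (ι j z ⊕ lookup⁺ s j)) (lookup∘tabulate id x) ⟩
        γ j (ι j x ⊕ lookup⁺ s j)                            ≡⟨ cong (γ j) (lookup-cell x s j) ⟨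
        γ j (lookup⁺ (tl (cell x s)) j)                      ≡⟨ ⟦toPerms⟧ γ j _ ⟨
        ⟦ toPerms γ ⟧ j (lookup⁺ (tl (cell x s)) j)          ≡⟨ lookup-act (toPerms γ) (tl (cell x s)) j ⟨
        lookup⁺ (act (toPerms γ) (tl (cell x s))) j          ∎
        where open ≡-Reasoning

      -- What the arcs and the diagonals have in common. Each edge lies in `b` windows, which
      -- `scale` records in total, and `b` is also the largest number of windows that can be hit;
      -- `tight` converts this maximum into a member of the family on a shifted diagonal.
      record Windows : Set where
        field
          windows  : List (List (Edge (n₁ ∷ ns)))
          b        : ℕ
          0<b      : 0 < b
          shape    : ∀ {W} → W ∈ windows → IsMatching W × length W ≡ r
          scale    : b * N ≡ r * length windows
          bounded  : ∀ {γ} → γ ∈ group (n₁ ∷ ns) → ∑ windows (hits γ) ≤ b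
          tight    : ∀ γ → Injs γ → ∑ windows (hits (lift γ)) ≡ b → Σ[ s ∈ Edge ns ] S (γ ⊙ rowᶠ cyclics (lookup⁺ s))

      diagonal : Edge ns → List (Edge (n₁ ∷ ns))
      diagonal s = map (λ x → cell x s) (allFin n₁)

      onDiagonal : ∀ {γ} → Injs γ → ∀ {W} s → IsMatching W → length W ≡ r → (∀ {w} → w ∈ W → ∃[ x ] w ≡ cell x s) →
                   hits (lift γ) W ≢ 0 → S (γ ⊙ rowᶠ cyclics (lookup⁺ s))
      onDiagonal {γ} γi {W} s mW lW cells ≢0 =
        let M , M∈ , into = hit (lift∈ γi) mW lW ≢0
        in lose M∈ (All.tabulate λ e∈ → let w , w∈ , eq = onto (lift∈ γi) mW lW M∈ into e∈
                                            x , w≡ = cells w∈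
             in subst (On (γ ⊙ rowᶠ cyclics (lookup⁺ s))) (sym (trans eq (cong (act (lift γ)) w≡))) (lift-cell {γ} x s))

      fullWindows : r ≡ n₁ → Windows
      fullWindows r≡n₁ = record
        { windows = map diagonal (edges ns)
        ; b = 1
        ; 0<b = s≤s z≤n
        ; shape = λ W∈ → let s , _ , eq = ∈-map⁻ diagonal W∈ in subst (λ W → IsMatching W × length W ≡ r) (sym eq) (diag-shape s)
        ; scale = trans (ℕ.*-identityˡ N) (cong₂ _*_ (sym r≡n₁) (sym (trans (length-map diagonal (edges ns)) (length-edges ns))))
        ; bounded = λ {γ} γ∈ → ℕ.≤-trans (ℕ.≤-reflexive (∑-map diagonal (edges ns) (hits γ)))
            (∑≤1 _ (edges-unique ns) (λ {s} _ → hits≤1 γ∈ (proj₁ (diag-shape s)) (proj₂ (diag-shape s)))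
              λ {s} {s′} _ _ h h′ → let e , e∈ , e∈′ = common γ∈ (proj₁ (diag-shape s)) (proj₂ (diag-shape s)) (proj₁ (diag-shape s′)) (proj₂ (diag-shape s′)) h h′
                                        x , _ , eq = ∈-map⁻ (λ x → cell x s) e∈
                                        x′ , _ , eq′ = ∈-map⁻ (λ x → cell x s′) e∈′
                                    in proj₂ (cell-inj x s x′ s′ (trans (sym eq) eq′)))
        ; tight = λ γ γi eq → let s , _ , h = ∑≢0⇒∃ (edges ns) (hits (lift γ) ∘ diagonal)
                                                (λ ≡0 → contradiction (trans (sym eq) (trans (∑-map diagonal (edges ns) (hits (lift γ))) ≡0)) λ ())
                              in s , onDiagonal γi s (proj₁ (diag-shape s)) (proj₂ (diag-shape s))
                                       (λ w∈ → let x , _ , w≡ = ∈-map⁻ (λ x → cell x s) w∈ in x , w≡) h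
        }
        where
        diag-shape : ∀ s → IsMatching (diagonal s) × length (diagonal s) ≡ r
        diag-shape s = AllPairs.map⁺ (AllPairs.map (λ {x} {y} → cell-disjoint {x} {y} s) (allFin⁺ n₁))
                     , trans (length-map _ (allFin n₁)) (trans (length-tabulate id) (sym r≡n₁))

      -- Arcs of length n₁ need not be matchings, hence the separate treatment of r = n₁ above.
      arcWindows : ∀ r′ → r ≡ suc r′ → r < n₁ → Windows
      arcWindows r′ refl r<n₁ = record
        { windows = applyUpTo (window r) N
        ; b = r
        ; 0<b = s≤s z≤n
        ; shape = λ W∈ → let t , _ , eq = ∈-applyUpTo⁻ (window r) W∈ in subst (λ W → IsMatching W × length W ≡ r) (sym eq) (arc-shape t)
        ; scale = cong (r *_) (sym (length-applyUpTo (window r) N))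
        ; bounded = λ {γ} γ∈ → ℕ.≤-trans (ℕ.≤-reflexive (∑-applyUpTo (window r) N (hits γ))) (K.arcs≤r γ∈)
        ; tight = λ γ γi eq → let t , h , fits = K.inside-block (lift∈ γi) n₁ r≤n₁ (size ns , ℕ.*-comm n₁ (size ns))
                                                    (trans (sym (∑-applyUpTo (window r) N (hits (lift γ)))) eq)
                              in digits nonZeros (t / n₁) , onDiagonal γi (digits nonZeros (t / n₁)) (proj₁ (arc-shape t)) (proj₂ (arc-shape t)) (in-block t fits) h
        }
        where
        arc-shape : ∀ t → IsMatching (window r t) × length (window r t) ≡ r
        arc-shape t = window-matching t r<n₁ , length-applyUpTo (λ i → order (t + i)) r
        -- Here `r < n₁` forces n₁ ≥ 2, so the product of the other parts is at least 2 and r + r ≤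
        -- n₁ * 2 ≤ N.
        2r≤N : r + r ≤ N
        2r≤N = ℕ.≤-trans (ℕ.+-mono-≤ (ℕ.<⇒≤ r<n₁) (ℕ.<⇒≤ r<n₁)) (ℕ.≤-trans (ℕ.≤-reflexive (trans (cong (n₁ +_) (sym (ℕ.+-identityʳ n₁))) (ℕ.*-comm 2 n₁)))
                 (ℕ.*-monoʳ-≤ n₁ (2≤size le)))
          where
          2≤size : ∀ {ns : Vec ℕ (suc m)} → VAll (n₁ ≤_) ns → 2 ≤ size ns
          2≤size (n₁≤n ∷ les) = ℕ.*-mono-≤ {2} {_} {1} (ℕ.≤-trans (s≤s (s≤s z≤n)) (ℕ.≤-trans r<n₁ n₁≤n))
            (∏>0 id (VAll.map (ℕ.≤-trans (ℕ.>-nonZero⁻¹ n₁)) les))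
        window-periodic : ∀ t → window r (t + N) ≡ window r t
        window-periodic t = applyUpTo-cong r λ i → trans
          (cong order (trans (ℕ.+-assoc t N i) (trans (cong (t +_) (ℕ.+-comm N i)) (sym (ℕ.+-assoc t i N))))) (order-periodic (t + i))
          where
          applyUpTo-cong : ∀ {A : Set} {f g : ℕ → A} n → (∀ i → f i ≡ g i) → applyUpTo f n ≡ applyUpTo g n
          applyUpTo-cong zero    eq = refl
          applyUpTo-cong (suc n) eq = cong₂ _∷_ (eq 0) (applyUpTo-cong n (eq ∘ suc))
        close : ∀ {γ} → γ ∈ group (n₁ ∷ ns) → ∀ t u → hits γ (window r t) ≢ 0 → hits γ (window r u) ≢ 0 →
                ∃₂ λ i j → i ≤ r′ × j ≤ r′ × t + i ≈ u + j [mod N ]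
        close γ∈ t u ht hu =
          let e , e∈t , e∈u = common γ∈ (proj₁ (arc-shape t)) (proj₂ (arc-shape t)) (proj₁ (arc-shape u)) (proj₂ (arc-shape u)) ht hu
              i , i< , eq  = ∈-applyUpTo⁻ (λ i → order (t + i)) e∈t
              j , j< , eq′ = ∈-applyUpTo⁻ (λ i → order (u + i)) e∈u
          in i , j , s≤s⁻¹ i< , s≤s⁻¹ j< , order-inj (trans (sym eq) eq′)
        module K {γ : Perms (n₁ ∷ ns)} (γ∈ : γ ∈ group (n₁ ∷ ns)) = Katona 2r≤N (hits γ ∘ window r)
          (λ t → hits≤1 γ∈ (proj₁ (arc-shape t)) (proj₂ (arc-shape t)))
          (λ t → cong (hits γ) (window-periodic t)) (close γ∈)
        in-block : ∀ t → t % n₁ + r ≤ n₁ → ∀ {w} → w ∈ window r t → ∃[ x ] w ≡ cell x (digits nonZeros (t / n₁))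
        in-block t fits w∈ with ∈-applyUpTo⁻ (λ i → order (t + i)) w∈
        ... | i , i<r , refl = (t + i) mod n₁ , cong (λ q → cell ((t + i) mod n₁) (digits nonZeros q)) quot
          where
          quot : (t + i) / n₁ ≡ t / n₁
          quot = trans (cong (_/ n₁) (trans (cong (_+ i) (m≡m%n+[m/n]*n t n₁)) (trans (ℕ.+-assoc (t % n₁) _ i)
              (trans (cong (t % n₁ +_) (ℕ.+-comm _ i)) (sym (ℕ.+-assoc (t % n₁) i _))))))
            (trans (+-distrib-/-∣ʳ (t % n₁ + i) (n∣m*n (t / n₁)))
              (cong₂ _+_ (m<n⇒m/n≡0 (ℕ.<-≤-trans (ℕ.+-monoʳ-< (t % n₁) i<r) fits)) (m*n/n≡m (t / n₁) n₁)))

      someWindows : Windows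
      someWindows with r ℕ.≟ n₁
      ... | yes r≡n₁ = fullWindows r≡n₁
      ... | no r≢n₁  = arcWindows (ℕ.pred r) (sym (ℕ.suc-pred r {{ℕ.>-nonZero 1≤r}})) (ℕ.≤∧≢⇒< r≤n₁ r≢n₁)

      open Windows someWindows

      Φ : ℕ
      Φ = length F * volume

      count-windows : ∑ (group (n₁ ∷ ns)) (λ γ → ∑ windows (hits γ)) ≡ length windows * Φ
      count-windows = trans (∑-swap (group (n₁ ∷ ns)) windows hits)
        (trans (∑-cong windows λ W∈ → total-hits (proj₁ (shape W∈)) (proj₂ (shape W∈))) (∑-const windows Φ))

      rescale : ∀ x → b * (N * x) ≡ r * (length windows * x)
      rescale x = trans (sym (ℕ.*-assoc b N x)) (trans (cong (_* x) scale) (ℕ.*-assoc r (length windows) x))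

      b*N>0 : NonZero (b * N)
      b*N>0 = ℕ.>-nonZero (ℕ.*-mono-≤ 0<b (∏>0 id 1≤ns))

      regroup : b * (N * (r * P₁)) ≡ r * (length (group (n₁ ∷ ns)) * b)
      regroup = begin
        b * (N * (r * P₁))   ≡⟨ cong (b *_) (trans (sym (ℕ.*-assoc N r P₁)) (trans (cong (_* P₁) (ℕ.*-comm N r)) (ℕ.*-assoc r N P₁))) ⟩
        b * (r * (N * P₁))   ≡⟨ ℕ.*-comm b _ ⟩
        r * (N * P₁) * b     ≡⟨ ℕ.*-assoc r (N * P₁) b ⟩
        r * (N * P₁ * b)     ≡⟨ cong (λ z → r * (z * b)) group-size ⟨
        r * (length (group (n₁ ∷ ns)) * b) ∎
        where open ≡-Reasoning

      -- The hits of all windows, summed over the group, are |windows| * Φ exactly and at most |G| *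
      -- b. With |G| = N * P₁ and `scale`, the common factor cancels.
      level-bound : Φ ≤ r * P₁
      level-bound = ℕ.*-cancelˡ-≤ (b * N) {{b*N>0}} (≤-begin
        (ℕ.≤-reflexive (trans (ℕ.*-assoc b N Φ) (rescale Φ)))
        (ℕ.*-monoʳ-≤ r (ℕ.≤-trans (ℕ.≤-reflexive (sym count-windows))
          (ℕ.≤-trans (∑-mono (group (n₁ ∷ ns)) bounded) (ℕ.≤-reflexive (∑-const (group (n₁ ∷ ns)) b)))))
        (ℕ.≤-reflexive (trans (sym regroup) (sym (ℕ.*-assoc b N (r * P₁))))))
        where
        ≤-begin : ∀ {w x y z} → w ≤ x → x ≤ y → y ≤ z → w ≤ z
        ≤-begin p q s = ℕ.≤-trans p (ℕ.≤-trans q s)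

      module _ (maximum : Φ ≡ r * P₁) where

        saturated : ∑ (group (n₁ ∷ ns)) (λ γ → ∑ windows (hits γ)) ≡ ∑ (group (n₁ ∷ ns)) (λ _ → b)
        saturated = trans count-windows (trans (ℕ.*-cancelˡ-≡ _ _ r {{ℕ.>-nonZero 1≤r}}
            (trans (sym (rescale Φ)) (trans (cong (λ z → b * (N * z)) maximum) regroup)))
          (sym (∑-const (group (n₁ ∷ ns)) b)))

        S-cyclic : ∀ γ → Injs γ → Σ[ s ∈ Edge ns ] S (γ ⊙ rowᶠ cyclics (lookup⁺ s))
        S-cyclic γ γi = tight γ γi (∑-mono-tight (group (n₁ ∷ ns)) bounded saturated (lift∈ γi))

        rowCount : Tuples.Family ns → Perms ns → ℕ
        rowCount Λ A = ∑ (edges ns) (λ s → 𝟙 (S? (⟦ A ⟧ ⊙ rowᶠ Λ (lookup⁺ s))))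

        row-injs : ∀ Λ s → Injs (rowᶠ Λ s)
        row-injs Λ s j = LatinSquare.row-inj (Λ j) (s j)

        rowCount≤1 : ∀ Λ {A} → A ∈ group ns → rowCount Λ A ≤ 1
        rowCount≤1 Λ {A} A∈ = ∑≤1 _ (edges-unique ns) (λ {s} _ → 𝟙≤1 (S? (⟦ A ⟧ ⊙ rowᶠ Λ (lookup⁺ s)))) λ {s} {s′} _ _ h h′ →
          let x , ag = S-meet (⟦ A ⟧ ⊙ rowᶠ Λ (lookup⁺ s)) (⟦ A ⟧ ⊙ rowᶠ Λ (lookup⁺ s′)) (𝟙⇒ (S? (⟦ A ⟧ ⊙ rowᶠ Λ (lookup⁺ s))) h) (𝟙⇒ (S? (⟦ A ⟧ ⊙ rowᶠ Λ (lookup⁺ s′))) h′)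
          in lookup⁺-injective λ j → LatinSquare.row-disjoint (Λ j) (ι j x) (group-inj A∈ j (ag j))

        -- Since this does not depend on Λ, what is known for the cyclic family holds for every Latin family.
        rowCount-total : ∀ Λ → ∑ (group ns) (rowCount Λ) ≡ length (edges ns) * ∑ (group ns) (λ A → 𝟙 (S? ⟦ A ⟧))
        rowCount-total Λ = trans (∑-swap (group ns) (edges ns) (λ A s → 𝟙 (S? (⟦ A ⟧ ⊙ rowᶠ Λ (lookup⁺ s)))))
          (trans (∑-cong (edges ns) λ {s} _ → ∑-translate {ns = ns} (row-injs Λ (lookup⁺ s)) (𝟙 ∘ S?)
                    (λ {γ} {γ′} eq → 𝟙-cong (S? γ) (S? γ′) (S-ext γ γ′ eq) (S-ext γ′ γ λ j x → sym (eq j x))))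
                 (∑-const (edges ns) _))

        -- The average of `rowCount Λ` is 1, as for the cyclic squares, and no value exceeds 1.
        S-hit : ∀ γ → Injs γ → (Λ : Tuples.Family ns) → ∃[ s ] S (γ ⊙ rowᶠ Λ s)
        S-hit γ γi Λ =
          let s , _ , h = ∑≢0⇒∃ (edges ns) (λ s → 𝟙 (S? (⟦ toPerms γ ⟧ ⊙ rowᶠ Λ (lookup⁺ s)))) (λ ≡0 → contradiction (trans (sym one) ≡0) λ ())
          in lookup⁺ s , S-ext (⟦ toPerms γ ⟧ ⊙ rowᶠ Λ (lookup⁺ s)) (γ ⊙ rowᶠ Λ (lookup⁺ s)) (λ j x → ⟦toPerms⟧ γ j (rowᶠ Λ (lookup⁺ s) j x)) (𝟙⇒ (S? (⟦ toPerms γ ⟧ ⊙ rowᶠ Λ (lookup⁺ s))) h)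
          where
          cyclic-one : ∀ {A} → A ∈ group ns → rowCount cyclics A ≡ 1
          cyclic-one {A} A∈ = let s , Ss = S-cyclic ⟦ A ⟧ (group-inj A∈) in ℕ.≤-antisym (rowCount≤1 cyclics A∈)
            (ℕ.≤-trans (ℕ.≤-reflexive (sym (𝟙-yes (S? (⟦ A ⟧ ⊙ rowᶠ cyclics (lookup⁺ s))) Ss)))
                       (∈⇒≤∑ (λ s → 𝟙 (S? (⟦ A ⟧ ⊙ rowᶠ cyclics (lookup⁺ s)))) (∈-edges s)))
          one : rowCount Λ (toPerms γ) ≡ 1
          one = ∑-mono-tight (group ns) (rowCount≤1 Λ)
            (trans (rowCount-total Λ) (trans (sym (rowCount-total cyclics)) (∑-cong (group ns) cyclic-one))) (toPerms∈group γi)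

        module _ (2≤r : 2 ≤ r) where

          module Con = Perfect {ns = ns} ι ι-inj

          id∈ : Σ[ γ ∈ Tuple ] (Injs γ × S γ)
          id∈ = let s , Ss = S-hit (λ _ → id) (λ _ → id) cyclics in rowᶠ cyclics s , row-injs cyclics s , Ss

          -- A shift without fixed points leads out of S.
          concentrated : Con.Concentrated S S? (λ {γ} {δ} → S-ext γ δ) (λ {γ} {δ} → S-meet γ δ) S-hit
          concentrated = Con.concentration S S? (λ {γ} {δ} → S-ext γ δ) (λ {γ} {δ} → S-meet γ δ) S-hit zero γ-injs Sγ π leaves
            where
            γ = proj₁ id∈
            γ-injs = proj₁ (proj₂ id∈)
            Sγ = proj₂ (proj₂ id∈)
            two : ∀ {n} → 2 ≤ n → ∃₂ λ (x y : Fin n) → x ≢ y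
            two {suc (suc n)} _ = zero , suc zero , λ ()
            two {suc zero} (s≤s ())
            pair = two (ℕ.≤-trans 2≤r (ℕ.≤-trans r≤n₁ (lookup⁺ le zero)))
            x = proj₁ pair
            y = proj₁ (proj₂ pair)
            t = proj₁ (⊕-solve x y)
            t-inj : Inj (_⊕ t)
            t-inj = ⊕-cancelʳ t
            π = permutation (_⊕ t) (λ z → proj₁ (inj⇒surj t-inj z)) (λ z → proj₂ (inj⇒surj t-inj z))
                  (λ z → t-inj (proj₂ (inj⇒surj t-inj (z ⊕ t))))
            leaves : ¬ S (γ ⊙ at zero (_⊕ t))
            leaves Sγ′ = let z , ag = S-meet γ (γ ⊙ at zero (_⊕ t)) Sγ Sγ′
                             fixed = trans (sym (at-same zero (_⊕ t) (ι zero z))) (sym (γ-injs zero (ag zero)))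
                         in proj₂ (proj₂ pair) (trans (sym (⊕-identity fixed x)) (proj₂ (⊕-solve x y)))

          γ₀ = proj₁ concentrated
          x₀ = proj₁ (proj₂ concentrated)
          S-through = proj₂ (proj₂ (proj₂ (proj₂ concentrated)))

          centre : Edge (n₁ ∷ ns)
          centre = x₀ ∷ lookup⁻ (λ j → γ₀ j (ι j x₀))

          lookup-centre : ∀ j → lookup⁺ (tl centre) j ≡ γ₀ j (ι j x₀)
          lookup-centre = lookup⁺-lookup⁻ {xs = ns} (λ j → γ₀ j (ι j x₀))

          -- Some cyclic shift of `γ` lies in S and therefore passes through the centre, as `γ`
          -- does. Then the shift has a fixed point in every coordinate and is trivial.
          through⇒S : ∀ γ → Injs γ → On γ centre → S γ
          through⇒S γ γi on = let s , Ss = S-hit γ γi cyclics in S-ext (γ ⊙ rowᶠ cyclics s) γ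
            (λ j z → cong (γ j) (⊕-identity (γi j (trans (sym (S-through _ (⊙-injs γi (row-injs cyclics s)) Ss j))
              (trans (sym (lookup-centre j)) (sym (on j))))) z)) Ss

          -- The extension of `M` to a perfect matching passes through the centre, so if `M` misses
          -- it, the column `x₀` is free. Then r < n₁, hence n₁ ≥ 3, and `evade` gives a perfect
          -- matching through the centre without edges of `M`. It contains a member of the family,
          -- which cannot meet `M`.
          centre∈ : ∀ {M} → M ∈ F → centre ∈ M
          centre∈ {M} M∈ = decidable-stable (centre ∈? M) λ c∉ →
            let mM , lM = matchings M∈
                γ , γi , on = extend-matching mM
                γ-centre : On γ centre
                γ-centre j = trans (sym (S-through γ γi (lose M∈ on) j)) (sym (lookup-centre j))
                x₀∉ : All (x₀ ≢_) (map hd M)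
                x₀∉ = All.map⁺ (All.tabulate λ {e} e∈ eq → c∉ (subst (_∈ M) (sym (On-unique {γ} γ-centre (All.lookup on e∈) eq)) e∈))
                r<n₁ : r < n₁
                r<n₁ = ℕ.≤-trans (ℕ.≤-reflexive (cong suc (trans (sym lM) (sym (length-map hd M)))))
                  (ℕ.≤-trans (Unique-⊆-length (x₀∉ ∷ matching-hd mM) (λ _ → ∈-allFin _)) (ℕ.≤-reflexive (length-tabulate id)))
                δ , δi , δ-on , δ-miss = evade zero (ℕ.≤-trans (s≤s 2≤r) r<n₁) mM c∉
                M′ , M′∈ , on′ = find (through⇒S δ δi δ-on)
                e , e∈ , e∈′ = intersecting M∈ M′∈
            in δ-miss e∈ (All.lookup on′ e∈′)

        level-star : ∃[ e ] (∀ {M} → M ∈ F → e ∈ M)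
        level-star with 2 ℕ.≤? r
        ... | yes 2≤r = centre 2≤r , centre∈ 2≤r
        ... | no 2≰r = singleton F refl
          where
          r≡1 : r ≡ 1
          r≡1 = ℕ.≤-antisym (s≤s⁻¹ (ℕ.≰⇒> 2≰r)) 1≤r
          only : ∀ {M e} → length M ≡ 1 → e ∈ M → ∀ {f} → f ∈ M → f ≡ e
          only {_ ∷ []} _ (here refl) (here refl) = refl
          singleton : ∀ G → F ≡ G → ∃[ e ] (∀ {M} → M ∈ F → e ∈ M)
          singleton [] eq = contradiction (trans (cong (λ G → length G * volume) (sym eq)) maximum)
            (ℕ.<⇒≢ (ℕ.*-mono-≤ 1≤r (∏>0 (λ n → (n ∸ 1) !) (VAll.universal (λ n → ℕ.>-nonZero⁻¹ _ {{(n ∸ 1) ℕ.!≢0}}) (n₁ ∷ ns)))))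
          singleton (M ∷ G) eq = let M∈ = subst (M ∈_) (sym eq) (here refl)
                                     e , e∈ , _ = intersecting M∈ M∈
            in e , λ {M′} M′∈ → let f , f∈ , f∈′ = intersecting M∈ M′∈
                                in subst (_∈ M′) (only (trans (proj₂ (matchings M∈)) r≡1) e∈ f∈) f∈′

-- Assembling the levels

∏-∣ : ∀ (f : ℕ → ℕ) {d n} {ns : Vec ℕ k} → d ∣ f n → d ∣ ∏ f (n ∷ ns)
∏-∣ f {ns = ns} d∣ = ∣-trans d∣ (m∣m*n (∏ f ns))

falling-factorial : ∀ {n k} → k ≤ n → (n Comb.P k) * (n ∸ k) ! ≡ n !
falling-factorial {n} {k} k≤n = trans (cong (_* (n ∸ k) !) (nPk≡n!/[n∸k]! k≤n)) (m/n*n≡m {{(n ∸ k) ℕ.!≢0}} (m≤n⇒m!∣n! (ℕ.m∸n≤m n k)))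

k!∣nPk : ∀ {n k} → k ≤ n → k ! ∣ n Comb.P k
k!∣nPk {n} {k} k≤n = subst (k ! ∣_) (trans (nP′k≡n!/[n∸k]! k≤n) (sym (nPk≡n!/[n∸k]! k≤n))) (k!∣nP′k k≤n)

least : ∀ (R : List ℕ) → R ≢ [] → ∃[ r ] (r ∈ R × (∀ {s} → s ∈ R → r ≤ s))
least [] ≢[] = contradiction refl ≢[]
least (r ∷ []) _ = r , here refl , λ { (here refl) → ℕ.≤-refl }
least (r ∷ R@(_ ∷ _)) _ with least R (λ ())
... | r′ , r′∈ , le with ℕ.≤-total r r′
...   | inj₁ r≤r′ = r , here refl , λ { (here refl) → ℕ.≤-refl ; (there s∈) → ℕ.≤-trans r≤r′ (le s∈) }
...   | inj₂ r′≤r = r′ , there r′∈ , λ { (here refl) → r′≤r ; (there s∈) → le s∈ }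

length-filter : ∀ {A : Set} {Q : A → Set} (Q? : ∀ x → Dec (Q x)) xs → length (filter Q? xs) ≡ ∑ xs (𝟙 ∘ Q?)
length-filter Q? []       = refl
length-filter Q? (x ∷ xs) with Q? x
... | yes _ = cong suc (length-filter Q? xs)
... | no _  = length-filter Q? xs

module Main {n₁ : ℕ} {ns : Vec ℕ (suc m)} {{nz₁ : NonZero n₁}} (le : VAll (n₁ ≤_) ns) where

  private
    E = Edge (n₁ ∷ ns)

  sameSet? : ∀ (M N : List E) → Dec (M ∼[ set ] N)
  sameSet? M N = map′ (λ (to , from) {_} → mk⇔ (All.lookup to) (All.lookup from))
    (λ M≈N → All.tabulate (Equivalence.to M≈N) , All.tabulate (Equivalence.from M≈N))
    (All.all? (_∈? N) M ×-dec All.all? (_∈? M) N)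

  _∈ᶠ?_ : ∀ M (F : List (List E)) → Dec (M ∈ᶠ F)
  M ∈ᶠ? F = Any.any? (sameSet? M) F

  module _ {r : ℕ} (1≤r : 1 ≤ r) (r≤n₁ : r ≤ n₁) where

    open Level le 1≤r r≤n₁ using (volume; P₁; r≤ns; 1≤ns; module Family)

    falling : ℕ
    falling = ∏ (λ n → (n ∸ 1) Comb.P (r ∸ 1)) (n₁ ∷ ns)

    private
      Q = ∏ (λ n → (n ∸ r) !) (n₁ ∷ ns)
      instance
        r≢0 : NonZero r
        r≢0 = ℕ.>-nonZero 1≤r
        Q≢0 : NonZero Q
        Q≢0 = ℕ.>-nonZero (∏>0 (λ n → (n ∸ r) !) (VAll.universal (λ n → ℕ.>-nonZero⁻¹ _ {{(n ∸ r) ℕ.!≢0}}) (n₁ ∷ ns)))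
        r!≢0 : NonZero ((r ∸ 1) !)
        r!≢0 = (r ∸ 1) ℕ.!≢0
        rQ≢0 : NonZero (r * Q)
        rQ≢0 = ℕ.m*n≢0 r Q

      P₁-split : P₁ ≡ falling * Q
      P₁-split = trans (∏-cong (λ n → (n ∸ 1) !) (λ n → ((n ∸ 1) Comb.P (r ∸ 1)) * (n ∸ r) !) (VAll.map split r≤ns))
                       (∏-* (λ n → (n ∸ 1) Comb.P (r ∸ 1)) (λ n → (n ∸ r) !) (n₁ ∷ ns))
        where
        split : ∀ {n} → r ≤ n → (n ∸ 1) ! ≡ ((n ∸ 1) Comb.P (r ∸ 1)) * (n ∸ r) !
        split {n} r≤n = sym (trans (cong (λ z → ((n ∸ 1) Comb.P (r ∸ 1)) * z !) (trans (cong (n ∸_) (sym (ℕ.m+[n∸m]≡n 1≤r))) (sym (ℕ.∸-+-assoc n 1 (r ∸ 1)))))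
                                   (falling-factorial (ℕ.∸-monoˡ-≤ 1 r≤n)))

      -- After this rewriting and that of `rhs`, cancelling `r * Q` turns the level bound into l *
      -- (r - 1)! ≤ `falling`.
      lhs : ∀ l → l * volume ≡ r * Q * (l * (r ∸ 1) !)
      lhs l = begin
        l * (r ! * Q)                  ≡⟨ cong (λ z → l * (z * Q)) (factorial r) ⟩
        l * (r * (r ∸ 1) ! * Q)        ≡⟨ cong (l *_) (trans (ℕ.*-assoc r ((r ∸ 1) !) Q) (trans (cong (r *_) (ℕ.*-comm ((r ∸ 1) !) Q)) (sym (ℕ.*-assoc r Q _)))) ⟩
        l * (r * Q * (r ∸ 1) !)        ≡⟨ trans (sym (ℕ.*-assoc l (r * Q) _)) (trans (cong (_* (r ∸ 1) !) (ℕ.*-comm l (r * Q))) (ℕ.*-assoc (r * Q) l _)) ⟩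
        r * Q * (l * (r ∸ 1) !)        ∎
        where
        open ≡-Reasoning
        factorial : ∀ r .{{_ : NonZero r}} → r ! ≡ r * (r ∸ 1) !
        factorial (suc r) = refl

      rhs : r * P₁ ≡ r * Q * falling
      rhs = trans (cong (r *_) (trans P₁-split (ℕ.*-comm falling Q))) (sym (ℕ.*-assoc r Q falling))

      divisible : (r ∸ 1) ! ∣ falling
      divisible = ∏-∣ (λ n → (n ∸ 1) Comb.P (r ∸ 1)) {n = n₁} {ns} (k!∣nPk (ℕ.∸-monoˡ-≤ 1 r≤n₁))

    ≤-starTerm : ∀ {l} → l * volume ≤ r * P₁ → l ≤ starTerm (n₁ ∷ ns) r
    ≤-starTerm {l} l≤ = ℕ.≤-trans (ℕ.≤-reflexive (sym (m*n/n≡m l ((r ∸ 1) !))))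
      (/-monoˡ-≤ ((r ∸ 1) !) (ℕ.*-cancelˡ-≤ (r * Q) (ℕ.≤-trans (ℕ.≤-reflexive (sym (lhs l))) (ℕ.≤-trans l≤ (ℕ.≤-reflexive rhs)))))

    ≡-starTerm : ∀ {l} → l * volume ≡ r * P₁ → l ≡ starTerm (n₁ ∷ ns) r
    ≡-starTerm {l} eq = trans (sym (m*n/n≡m l ((r ∸ 1) !)))
      (cong (_/ (r ∸ 1) !) (ℕ.*-cancelˡ-≡ _ _ (r * Q) (trans (sym (lhs l)) (trans eq rhs))))

    starTerm-≡ : ∀ {l} → l ≡ starTerm (n₁ ∷ ns) r → l * volume ≡ r * P₁
    starTerm-≡ {l} refl = trans (lhs l) (trans (cong (r * Q *_) (m/n*n≡m divisible)) (sym rhs))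

  level : List (List E) → ℕ → List (List E)
  level F r = filter (λ M → length M ℕ.≟ r) F

  module _ {R : List ℕ} (R-unique : Unique R) (R-range : All (λ r → 1 ≤ r × r ≤ n₁) R) where

    module Levels (F : List (List E)) (distinct : Distinct F) (F⊆K : All (𝒦 R (n₁ ∷ ns)) F) (intersecting : Intersecting F) where

      ∈-level⁻ : ∀ {r M} → M ∈ level F r → M ∈ F × length M ≡ r
      ∈-level⁻ {r} = ∈-filter⁻ (λ M → length M ℕ.≟ r)

      level-distinct : ∀ r → Distinct (level F r)
      level-distinct r = AllPairs.filter⁺ (λ M → length M ℕ.≟ r) distinct

      level-matchings : ∀ r {M} → M ∈ level F r → IsMatching M × length M ≡ r
      level-matchings r M∈ = let M∈F , len = ∈-level⁻ M∈ in proj₁ (All.lookup F⊆K M∈F) , len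

      level-intersecting : ∀ r → Intersecting (level F r)
      level-intersecting r M∈ N∈ = intersecting (proj₁ (∈-level⁻ {r} M∈)) (proj₁ (∈-level⁻ {r} N∈))

      module At {r : ℕ} (r∈ : r ∈ R) where
        1≤r = proj₁ (All.lookup R-range r∈)
        r≤n₁ = proj₂ (All.lookup R-range r∈)
        open Level.Family le 1≤r r≤n₁ (level F r) (level-distinct r) (level-matchings r) public
        open Meeting (level-intersecting r) public using (level-bound; level-star)

      length-levels : length F ≡ ∑ R (λ r → length (level F r))
      length-levels = sym (begin
        ∑ R (λ r → length (level F r))                  ≡⟨ ∑-cong R (λ {r} _ → length-filter (λ M → length M ℕ.≟ r) F) ⟩
        ∑ R (λ r → ∑ F (λ M → 𝟙 (length M ℕ.≟ r)))      ≡⟨ ∑-swap R F (λ r M → 𝟙 (length M ℕ.≟ r)) ⟩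
        ∑ F (λ M → ∑ R (λ r → 𝟙 (length M ℕ.≟ r)))      ≡⟨ ∑-cong F (λ M∈ → ∑-indicator ℕ._≟_ R-unique (proj₂ (All.lookup F⊆K M∈))) ⟩
        ∑ F (λ _ → 1)                                   ≡⟨ trans (∑-const F 1) (ℕ.*-identityʳ (length F)) ⟩
        length F                                        ∎)
        where open ≡-Reasoning

      level≤ : ∀ {r} → r ∈ R → length (level F r) ≤ starTerm (n₁ ∷ ns) r
      level≤ r∈ = ≤-starTerm (At.1≤r r∈) (At.r≤n₁ r∈) (At.level-bound r∈)

      upper : length F ≤ bound R (n₁ ∷ ns)
      upper = ℕ.≤-trans (ℕ.≤-reflexive length-levels) (∑-mono R level≤)

    -- The enlarged family still has the common edge `e`, so the upper bound applies to it. A family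
    -- of maximum size with a common edge must therefore be the whole star.
    star-extension : ∀ {F e M} → Distinct F → All (𝒦 R (n₁ ∷ ns)) F → (∀ {N} → N ∈ F → e ∈ N) →
                    𝒦 R (n₁ ∷ ns) M → e ∈ M → ¬ M ∈ᶠ F → suc (length F) ≤ bound R (n₁ ∷ ns)
    star-extension {F} {e} {M} distinct F⊆K through M∈K e∈M M∉F = Levels.upper (M ∷ F)
      (All.¬Any⇒All¬ F M∉F ∷ distinct) (M∈K ∷ F⊆K) λ N∈ N′∈ → e , through′ N∈ , through′ N′∈
      where
      through′ : ∀ {N} → N ∈ M ∷ F → e ∈ N
      through′ (here refl) = e∈M
      through′ (there N∈)  = through N∈

  -- For r ≥ 2 the hypothesis r < |M| ≤ n₁ provides the three columns that evade needs.
  avoiding : ∀ {r} {M : List E} {e} → 1 ≤ r → r < length M → IsMatching M → e ∉ M →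
             ∃[ N ] (IsMatching N × length N ≡ r × e ∈ N × (∀ {f} → f ∈ N → f ∉ M))
  avoiding {suc zero} {e = e} _ _ _ e∉M = e ∷ [] , [] ∷ [] , refl , here refl , λ { (here refl) → e∉M }
  avoiding {suc (suc r)} {M} {e} _ r<M mM e∉M =
    map edge columns , AllPairs.map⁺ (AllPairs.map (λ {x} {y} → apart {x} {y}) columns-unique)
    , trans (length-map edge columns) (cong suc (trans (length-take (suc r) others) (ℕ.m≤n⇒m⊓n≡m enough)))
    , here (On-unique {γ} γ-e (on-edge (hd e)) refl)
    , λ f∈ f∈M → let x , _ , eq = ∈-map⁻ edge f∈ in γ-misses f∈M (subst (On γ) (sym eq) (on-edge x))
    where
    open Order le
    open Graphs le
    open Tuples ns
    M≤n₁ : length M ≤ n₁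
    M≤n₁ = ℕ.≤-trans (ℕ.≤-reflexive (sym (length-map hd M))) (ℕ.≤-trans (Unique-⊆-length (matching-hd mM) (λ _ → ∈-allFin _)) (ℕ.≤-reflexive (length-tabulate id)))
    evading = evade zero (ℕ.≤-trans (s≤s (s≤s (s≤s z≤n))) (ℕ.≤-trans r<M M≤n₁)) mM e∉M
    γ = proj₁ evading
    γ-injs = proj₁ (proj₂ evading)
    γ-e = proj₁ (proj₂ (proj₂ evading))
    γ-misses = proj₂ (proj₂ (proj₂ evading))
    edge : Fin n₁ → E
    edge x = x ∷ lookup⁻ (λ j → γ j (ι j x))
    lookup-edge : ∀ x j → lookup⁺ (tl (edge x)) j ≡ γ j (ι j x)
    lookup-edge x = lookup⁺-lookup⁻ {xs = ns} (λ j → γ j (ι j x))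
    on-edge : ∀ x → On γ (edge x)
    on-edge x j = sym (lookup-edge x j)
    apart : ∀ {x y} → x ≢ y → Disjoint (edge x) (edge y)
    apart x≢y zero eq = x≢y eq
    apart {x} {y} x≢y (suc j) eq = x≢y (ι-inj j (γ-injs j (trans (sym (lookup-edge x j)) (trans eq (lookup-edge y j)))))
    others? = λ x → ¬? (hd e ≟ x)
    others = filter others? (allFin n₁)
    -- The required size is `2 + r`: the column of `e` and `1 + r` further ones.
    columns = hd e ∷ take (suc r) others
    others-≢ : All (hd e ≢_) others
    others-≢ = All.all-filter others? (allFin n₁)
    columns-unique : Unique columns
    columns-unique = All.take⁺ (suc r) others-≢ ∷ Unique.take⁺ (suc r) (Unique.filter⁺ others? (allFin⁺ n₁))
    enough : suc r ≤ length others
    enough = s≤s⁻¹ (ℕ.≤-trans (ℕ.<⇒≤ (ℕ.≤-trans r<M M≤n₁)) (ℕ.≤-trans (ℕ.≤-reflexive (sym (length-tabulate id)))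
      (Unique-⊆-length (allFin⁺ n₁) all∈)))
      where
      all∈ : ∀ {x} → x ∈ allFin n₁ → x ∈ hd e ∷ others
      all∈ {x} x∈ with hd e ≟ x
      ... | yes e≡x = here (sym e≡x)
      ... | no e≢x  = there (∈-filter⁺ others? x∈ e≢x)

  module _ {R : List ℕ} (R-unique : Unique R) (R≢[] : R ≢ []) (R-range : All (λ r → 1 ≤ r × r ≤ n₁) R)
    (F : List (List E)) (distinct : Distinct F) (F⊆K : All (𝒦 R (n₁ ∷ ns)) F) (intersecting : Intersecting F) where

    open Levels R-unique R-range F distinct F⊆K intersecting

    maximum⇒star : length F ≡ bound R (n₁ ∷ ns) → IsStar R F
    maximum⇒star maximum = e , λ M M∈K → mk⇔ (to M) (from M M∈K)
      where
      level≡ : ∀ {r} → r ∈ R → length (level F r) ≡ starTerm (n₁ ∷ ns) r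
      level≡ = ∑-mono-tight R level≤ (trans (sym length-levels) maximum)
      smallest = least R R≢[]
      r = proj₁ smallest
      r∈ = proj₁ (proj₂ smallest)
      1≤r = At.1≤r r∈
      r≤n₁ = At.r≤n₁ r∈
      star-r = At.level-star r∈ (starTerm-≡ 1≤r r≤n₁ (level≡ r∈))
      e = proj₁ star-r
      -- The extension is taken with `r ∷ []` in place of `R`, for which the level alone already has
      -- full size.
      complete : ∀ N → IsMatching N → length N ≡ r → e ∈ N → N ∈ᶠ level F r
      complete N mN lN e∈ = decidable-stable (N ∈ᶠ? level F r) λ N∉ → ℕ.<-irrefl refl
        (ℕ.≤-trans (star-extension {R = r ∷ []} ([] ∷ []) ((1≤r , r≤n₁) ∷ []) (level-distinct r)
            (All.tabulate λ M∈ → let mM , lM = level-matchings r M∈ in mM , here lM) (proj₂ star-r) (mN , here lN) e∈ N∉)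
          (ℕ.≤-reflexive (trans (ℕ.+-identityʳ _) (sym (level≡ r∈)))))
      larger : ∀ {M} → M ∈ F → r < length M → e ∈ M
      larger {M} M∈ r< = decidable-stable (e ∈? M) λ e∉M →
        let N , mN , lN , e∈N , misses = avoiding 1≤r r< (proj₁ (All.lookup F⊆K M∈)) e∉M
            N′ , N′∈ , N≈N′ = find (complete N mN lN e∈N)
            f , f∈N′ , f∈M = intersecting (proj₁ (∈-level⁻ {r} N′∈)) M∈
        in misses (Equivalence.from N≈N′ f∈N′) f∈M
      through : ∀ {M} → M ∈ F → e ∈ M
      through {M} M∈ = case m≤n⇒m<n∨m≡n (proj₂ (proj₂ smallest) (proj₂ (All.lookup F⊆K M∈))) of λ where
        (inj₁ r<) → larger M∈ r<
        (inj₂ r≡) → proj₂ star-r (∈-filter⁺ (λ M → length M ℕ.≟ r) M∈ (sym r≡))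
      to : ∀ M → M ∈ᶠ F → e ∈ M
      to M M∈ᶠ = let M′ , M′∈ , M≈M′ = find M∈ᶠ in Equivalence.from M≈M′ (through M′∈)
      from : ∀ M → 𝒦 R (n₁ ∷ ns) M → e ∈ M → M ∈ᶠ F
      from M M∈K e∈ = decidable-stable (M ∈ᶠ? F) λ M∉ → ℕ.<-irrefl refl
        (ℕ.≤-trans (star-extension R-unique R-range distinct F⊆K through M∈K e∈ M∉) (ℕ.≤-reflexive (sym maximum)))

    star⇒maximum : IsStar R F → length F ≡ bound R (n₁ ∷ ns)
    star⇒maximum (e , star) = trans length-levels (∑-cong R λ {r} r∈ → ≡-starTerm (At.1≤r r∈) (At.r≤n₁ r∈) (At.star-count r∈ e (level-star′ r∈)))
      where
      -- Membership in the family is only up to equality of sets; for matchings this preserves the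
      -- length and hence the level.
      matching-length : ∀ {M N} → IsMatching M → IsMatching N → M ∼[ set ] N → length M ≡ length N
      matching-length mM mN M≈N = ℕ.≤-antisym (Unique-⊆-length (matching-unique mM) (Equivalence.to M≈N))
                                              (Unique-⊆-length (matching-unique mN) (Equivalence.from M≈N))
      level-star′ : ∀ {r} → r ∈ R → ∀ M → IsMatching M → length M ≡ r → (M ∈ᶠ level F r ⇔ e ∈ M)
      level-star′ {r} r∈ M mM lM = mk⇔
        (λ M∈ → let M′ , M′∈ , M≈M′ = find M∈ in Equivalence.to (star M (mM , subst (_∈ R) (sym lM) r∈)) (lose (proj₁ (∈-level⁻ {r} M′∈)) λ {z} → M≈M′ {z}))
        (λ e∈ → let M′ , M′∈ , M≈M′ = find (Equivalence.from (star M (mM , subst (_∈ R) (sym lM) r∈)) e∈)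
                in lose (∈-filter⁺ (λ M → length M ℕ.≟ r) M′∈ (trans (sym (matching-length mM (proj₁ (All.lookup F⊆K M′∈)) λ {z} → M≈M′ {z})) lM)) λ {z} → M≈M′ {z})

theorem3p1 : ∀ (m : ℕ) (ns : Vec ℕ (2 + m)) →
    1 ≤ head ns →
    Linked _≤_ ns →
    (R : List ℕ) → Unique R → R ≢ [] →
    All (λ r → 1 ≤ r × r ≤ head ns) R →
    (F : List (List (Edge ns))) → Distinct F →
    All (𝒦 R ns) F →
    Intersecting F →
    length F ≤ bound R ns × (length F ≡ bound R ns ⇔ IsStar R F)
theorem3p1 m (n₁ ∷ ns@(_ ∷ _)) 1≤n₁ (n₁≤n₂ ∷ linked) R R-unique R≢[] R-range F distinct F⊆K intersecting =
  upper , mk⇔ (maximum⇒star R-unique R≢[] R-range F distinct F⊆K intersecting)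
              (star⇒maximum R-unique R≢[] R-range F distinct F⊆K intersecting)
  where
  open Main {{ℕ.>-nonZero 1≤n₁}} (Linked⇒All ℕ.≤-trans n₁≤n₂ linked)
  open Levels R-unique R-range F distinct F⊆K intersecting using (upper)
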